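{- Let $G$ be a finite non-empty graph and let $a$ and $b$ be positive integers. Then the following three conditions are equivalent: (1) $G$ has a bramble of adhesion-order $\geq a$ and bag-order $\geq b$; (2) $G$ has a tangle of adhesion-order $\geq a$ and bag-order $\geq b$; (3) $G$ has no tree-cut decomposition of adhesion-width $<a$ and bag-width $<b$.
   Context: Graphs are finite and undirected; parallel edges are allowed, loops are not. A near-partition of a set $\Omega$ is a family of pairwise disjoint (possibly empty) subsets of $\Omega$ with union $\Omega$. For $X\subseteq V(G)$, $\delta(X)$ is the set of edges of $G$ with exactly one endpoint in $X$. Tree-cut decompositions. A tree-cut decomposition of $G$ is a pair $\mathcal{T}=(T,\mathcal{X})$ where $T$ is a tree and $\mathcal{X}=\{X_t : t\in V(T)\}$ is a near-partition of $V(G)$ indexed by the nodes of $T$; $X_t$ is the bag of $t$. For an edge $st$ of $T$, $\mathrm{adh}(st)$ is the set of edges $uv$ of $G$ such that the node whose bag contains $u$ and the node whose bag contains $v$ lie in different components of $T-st$. The edge $st$ is bold if $|\mathrm{adh}(st)|\geq 3$ and thin otherwise. For a node $t$, $\mathrm{adh}(t)$ is the union of the sets $\mathrm{adh}(st)$ over all bold edges $st$ of $T$ incident to $t$. The adhesion-width of $\mathcal{T}$ is $\max_{t\in V(T)}|\mathrm{adh}(t)|$ and the bag-width of $\mathcal{T}$ is $\max_{t\in V(T)}|X_t|$. Brambles. Two vertices $u,v$ of $G$ are 3-edge-connected in $G$ if $u=v$ or there are three pairwise edge-disjoint paths in $G$ connecting $u$ and $v$; a set $K\subseteq V(G)$ is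 3-edge-connected in $G$ if its elements are pairwise 3-edge-connected in $G$. A slab in $G$ is a pair $(H,K)$ where $H$ is a connected subgraph of $G$ and $K$ (the core) is a non-empty subset of $V(H)$ that is 3-edge-connected in $G$. Two slabs touch if their cores intersect. A bramble in $G$ is a family of pairwise touching slabs. A set $F\subseteq E(G)$ disconnects a slab $(H,K)$ if there are $u,v\in K$ lying in different connected components of $H-(F\cap E(H))$. $F$ is a disconnecting set for a bramble $\mathcal{B}$ if it disconnects every slab in $\mathcal{B}$. The adhesion-order of $\mathcal{B}$ is the minimum size of a disconnecting set for $\mathcal{B}$, or $+\infty$ if none exists. The bag-order of $\mathcal{B}$ is $\min_{(H,K)\in\mathcal{B}}|K|$, or $+\infty$ if $\mathcal{B}$ is empty. Tangles. A separation of $G$ is a near-partition $\{A,B\}$ of $V(G)$ into two sides; its order is $|\delta(A)|=|\delta(B)|$. It has two associated oriented separations $(A,B)$ and $(B,A)$. For a set $\mathcal{S}$ of separations, $\vec{\mathcal{S}}$ is the set of all oriented separations associated with elements of $\mathcal{S}$, and an orientation of $\mathcal{S}$ is a subset of $\vec{\mathcal{S}}$ containing precisely one oriented separation associated with each element of $\mathcal{S}$. An orientation $\mathcal{L}$ avoids a collection $\Sigma$ of sets of oriented separations if no subset of $\mathcal{L}$ belongs to $\Sigma$. A set $\sigma$ of oriented separations is consistent if it does not contain $(A,B)$ and $(C,D)$ with $B\cap D=\emptyset$. A star is a non-empty consistent set $\sigma$ of oriented separations such that $A\cap C=\emptyset$ for all distinct $(A,B),(C,D)\in\sigma$. For positive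 integers $a,b$, let $\mathcal{S}_a$ be the set of all separations of $G$ of order $<a$, and let $\Sigma_{a,b}$ be the set of all stars $\sigma\subseteq\vec{\mathcal{S}}_a$ such that $\left|\bigcup\{\delta(A) : (A,B)\in\sigma,\ |\delta(A)|\geq 3\}\right|<a$ and $\left|\bigcap\{B : (A,B)\in\sigma\}\right|<b$. An $(a,b)$-tangle in $G$ is a consistent orientation of $\mathcal{S}_a$ that avoids $\Sigma_{a,b}$; it is said to have adhesion-order $a$ and bag-order $b$.
   Formalization: That (2) implies (1), and hence (3), is stated only for a ≥ 3, since it fails for a ≤ 2: two vertices joined by one edge have a (1,2)-tangle but also a tree-cut decomposition of adhesion-width 0 and bag-width 1; all other implications are stated for all positive a, b. -}

module Defs where

open import Data.Bool.Base using (_xor_)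
open import Data.Fin.Base using (Fin)
open import Data.Fin.Properties as Finₚ using (any?)
open import Data.Fin.Subset
  using (Subset; _∈_; _⊆_; _∩_; _─_; _-_; ⊤; ⋃; ⋂; ∣_∣; Empty; Nonempty)
open import Data.Fin.Subset.Properties using (_∈?_)
open import Data.List.Base as List using (List; []; _∷_; allFin; filter)
open import Data.List.Extrema.Nat using (max)
open import Data.List.Membership.Propositional using () renaming (_∈_ to _∈ˡ_)
open import Data.List.Membership.Propositional.Properties using (∈-allFin)
open import Data.List.Relation.Binary.Disjoint.Propositional using (Disjoint)
open import Data.List.Relation.Unary.All using (All)
open import Data.List.Relation.Unary.Any using (here; there)
open import Data.List.Relation.Unary.Unique.Propositional using (Unique)
open import Data.Nat.Base using (ℕ; _≤_; _<_; _≥_)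
open import Data.Nat.Properties using (_≤?_)
open import Data.Product
  using (Σ; ∃; ∃₂; ∃!; ∃-syntax; _×_; _,_; proj₁; proj₂; swap)
open import Data.Product.Properties using (≡-dec)
open import Data.Sum.Base using (_⊎_; inj₁; inj₂)
open import Data.Vec.Base using (lookup; tabulate)
open import Level using (0ℓ)
open import Relation.Binary.Construct.Add.Supremum.NonStrict _≤_ using (_≤⁺_)
open import Relation.Binary.Construct.Closure.ReflexiveTransitive
  using (Star; ε; _◅_; _◅◅_)
open import Relation.Binary.Core using (Rel)
open import Relation.Binary.Definitions using (Decidable)
open import Relation.Binary.PropositionalEquality.Core using (_≡_; _≢_; refl)
open import Relation.Nullary.Construct.Add.Supremum using (_⁺; [_]; ⊤⁺)
open import Relation.Nullary.Decidable.Core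
  using (Dec; does; map′; ¬?; _×-dec_; _⊎-dec_)
open import Relation.Nullary.Negation.Core using (¬_)
open import Relation.Unary using (Pred)

------------------------------------------------------------------------
-- Graphs, walks, paths

-- Finite loopless multigraphs. The order in which `ends e` lists the two
-- endpoints of e carries no meaning: `Joins` below is symmetric.
record Graph : Set where
  field
    #V #E    : ℕ
    ends     : Fin #E → Fin #V × Fin #V
    loopless : ∀ e → proj₁ (ends e) ≢ proj₂ (ends e)

open Graph public

Vertex Edge : Graph → Set
Vertex G = Fin (#V G)
Edge   G = Fin (#E G)

Joins : (G : Graph) → Edge G → Vertex G → Vertex G → Set
Joins G e u v = ends G e ≡ (u , v) ⊎ ends G e ≡ (v , u)

Incident : (G : Graph) → Vertex G → Edge G → Set
Incident G v e = proj₁ (ends G e) ≡ v ⊎ proj₂ (ends G e) ≡ v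

record Step (G : Graph) (S : Subset (#E G)) (u v : Vertex G) : Set where
  constructor step
  field
    edge    : Edge G
    allowed : edge ∈ S
    joins   : Joins G edge u v

-- Walks all of whose edges lie in S; `Walk G ⊤` is the type of all walks.
Walk : (G : Graph) → Subset (#E G) → Rel (Vertex G) 0ℓ
Walk G S = Star (Step G S)

module _ {G : Graph} {S : Subset (#E G)} where

  edges : ∀ {u v} → Walk G S u v → List (Edge G)
  edges ε       = []
  edges (s ◅ w) = Step.edge s ∷ edges w

  -- The vertices reached by the successive steps, omitting the start.
  laterVertices : ∀ {u v} → Walk G S u v → List (Vertex G)
  laterVertices ε                   = []
  laterVertices (_◅_ {j = x} _ w) = x ∷ laterVertices w

  IsPath : ∀ {u v} → Walk G S u v → Set
  IsPath {u} w = Unique (u ∷ laterVertices w)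

  -- Two parallel edges form a cycle; going back and forth along a single
  -- edge does not.
  IsCycle : ∀ {u} → Walk G S u u → Set
  IsCycle w = edges w ≢ [] × Unique (edges w) × Unique (laterVertices w)

-- δ(X)
δ : (G : Graph) → Subset (#V G) → Subset (#E G)
δ G X = tabulate λ e → lookup X (proj₁ (ends G e)) xor lookup X (proj₂ (ends G e))

------------------------------------------------------------------------
-- Reachability is decidable (Warshall's algorithm)

module Warshall {n} {R : Rel (Fin n) 0ℓ} (R? : Decidable R) where

  -- Via ks u v: v is reachable from u with all intermediate vertices in ks.
  Via : List (Fin n) → Rel (Fin n) 0ℓ
  Via []       u v = u ≡ v ⊎ R u v
  Via (k ∷ ks) u v = Via ks u v ⊎ (Via ks u k × Via ks k v)

  via? : ∀ ks → Decidable (Via ks)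
  via? []       u v = (u Finₚ.≟ v) ⊎-dec R? u v
  via? (k ∷ ks) u v = via? ks u v ⊎-dec (via? ks u k ×-dec via? ks k v)

  sound : ∀ ks {u v} → Via ks u v → Star R u v
  sound []       (inj₁ refl)    = ε
  sound []       (inj₂ r)       = r ◅ ε
  sound (k ∷ ks) (inj₁ p)       = sound ks p
  sound (k ∷ ks) (inj₂ (p , q)) = sound ks p ◅◅ sound ks q

  base : ∀ ks {u v} → u ≡ v ⊎ R u v → Via ks u v
  base []       p = p
  base (k ∷ ks) p = inj₁ (base ks p)

  to : ∀ {k} ks {u} → Via (k ∷ ks) u k → Via ks u k
  to ks (inj₁ p)       = p
  to ks (inj₂ (p , _)) = p

  from : ∀ {k} ks {v} → Via (k ∷ ks) k v → Via ks k v
  from ks (inj₁ p)       = p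
  from ks (inj₂ (_ , p)) = p

  join : ∀ {ks k u v} → k ∈ˡ ks → Via ks u k → Via ks k v → Via ks u v
  join {ks = _ ∷ ks} (here refl) p q = inj₂ (to ks p , from ks q)
  join (there i) (inj₁ p)       (inj₁ q)       = inj₁ (join i p q)
  join (there i) (inj₁ p)       (inj₂ (q , r)) = inj₂ (join i p q , r)
  join (there i) (inj₂ (p , q)) (inj₁ r)       = inj₂ (p , join i q r)
  join (there i) (inj₂ (p , _)) (inj₂ (_ , s)) = inj₂ (p , s)

  complete : ∀ {u v} → Star R u v → Via (allFin n) u v
  complete ε                   = base (allFin n) (inj₁ refl)
  complete (_◅_ {j = x} r rs) =
    join (∈-allFin x) (base (allFin n) (inj₂ r)) (complete rs)

  star? : Decidable (Star R)
  star? u v = map′ (sound (allFin n)) complete (via? (allFin n) u v)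

joins? : ∀ G e u v → Dec (Joins G e u v)
joins? G e u v = (ends G e ≟ (u , v)) ⊎-dec (ends G e ≟ (v , u))
  where _≟_ = ≡-dec Finₚ._≟_ Finₚ._≟_

incident? : ∀ G v e → Dec (Incident G v e)
incident? G v e = (proj₁ (ends G e) Finₚ.≟ v) ⊎-dec (proj₂ (ends G e) Finₚ.≟ v)

walk? : ∀ G S → Decidable (Walk G S)
walk? G S = Warshall.star? λ u v →
  map′ (λ (e , i , j) → step e i j) (λ (step e i j) → e , i , j)
    (any? λ e → (e ∈? S) ×-dec joins? G e u v)

------------------------------------------------------------------------
-- Tree-cut decompositions

record IsTree (T : Graph) : Set where
  field
    nonEmpty  : 0 < #V T
    connected : ∀ s t → Walk T ⊤ s t
    acyclic   : ∀ {s} (w : Walk T ⊤ s s) → ¬ IsCycle w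

record IsNearPartition {k n} (X : Fin k → Subset n) : Set where
  field
    disjoint : ∀ {s t} → s ≢ t → Empty (X s ∩ X t)
    covers   : ∀ v → ∃[ t ] v ∈ X t

record TreeCutDecomposition (G : Graph) : Set where
  field
    T               : Graph
    isTree          : IsTree T
    bag             : Vertex T → Subset (#V G)
    isNearPartition : IsNearPartition bag

  nodeOf : Vertex G → Vertex T
  nodeOf v = proj₁ (IsNearPartition.covers isNearPartition v)

  adhEdge : Edge T → Subset (#E G)
  adhEdge f = tabulate λ e → does (¬? (walk? T (⊤ - f)
    (nodeOf (proj₁ (ends G e))) (nodeOf (proj₂ (ends G e)))))

  Bold : Edge T → Set
  Bold f = 3 ≤ ∣ adhEdge f ∣

  bold? : ∀ f → Dec (Bold f)
  bold? f = 3 ≤? ∣ adhEdge f ∣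

  adhNode : Vertex T → Subset (#E G)
  adhNode t = ⋃ (List.map adhEdge
    (filter (λ f → incident? T t f ×-dec bold? f) (allFin (#E T))))

  adhesionWidth : ℕ
  adhesionWidth = max 0 (List.map (λ t → ∣ adhNode t ∣) (allFin (#V T)))

  bagWidth : ℕ
  bagWidth = max 0 (List.map (λ t → ∣ bag t ∣) (allFin (#V T)))

------------------------------------------------------------------------
-- Brambles

ThreeEdgeConnected : (G : Graph) → Rel (Vertex G) 0ℓ
ThreeEdgeConnected G u v = u ≡ v ⊎
  (Σ (Walk G ⊤ u v) λ p → Σ (Walk G ⊤ u v) λ q → Σ (Walk G ⊤ u v) λ r →
    (IsPath p × IsPath q × IsPath r) ×
    (Disjoint (edges p) (edges q) ×
     Disjoint (edges p) (edges r) ×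
     Disjoint (edges q) (edges r)))

ThreeEdgeConnectedSet : (G : Graph) → Subset (#V G) → Set
ThreeEdgeConnectedSet G K = ∀ {u v} → u ∈ K → v ∈ K → ThreeEdgeConnected G u v

record Subgraph (G : Graph) : Set where
  field
    VH     : Subset (#V G)
    EH     : Subset (#E G)
    closed : ∀ {e} → e ∈ EH → proj₁ (ends G e) ∈ VH × proj₂ (ends G e) ∈ VH

-- Walks with edges in EH that start in VH stay in VH, by `closed`.
record Slab (G : Graph) : Set where
  field
    H             : Subgraph G
  open Subgraph H public
  field
    connected     : ∀ {u v} → u ∈ VH → v ∈ VH → Walk G EH u v
    core          : Subset (#V G)
    core-nonempty : Nonempty core
    core⊆H        : core ⊆ VH
    core-3ec      : ThreeEdgeConnectedSet G core

Touch : ∀ {G} → Slab G → Slab G → Set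
Touch s t = Nonempty (Slab.core s ∩ Slab.core t)

-- A finite graph has only finitely many slabs, so families are lists.
record Bramble (G : Graph) : Set where
  field
    slabs    : List (Slab G)
    touching : ∀ {s t} → s ∈ˡ slabs → t ∈ˡ slabs → Touch s t

Disconnects : ∀ {G} → Subset (#E G) → Slab G → Set
Disconnects {G} F s =
  ∃₂ λ u v → u ∈ core × v ∈ core × ¬ Walk G (EH ─ (F ∩ EH)) u v
  where open Slab s

DisconnectingSet : ∀ {G} → Bramble G → Subset (#E G) → Set
DisconnectingSet B F = All (Disconnects F) (Bramble.slabs B)

-- `IsMinimum P o`: o is the minimum of {k | P k}, with ⊤⁺ (that is, +∞) as
-- the minimum of the empty set.
IsMinimum : Pred ℕ 0ℓ → ℕ ⁺ → Set
IsMinimum P [ k ] = P k × (∀ {j} → P j → k ≤ j)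
IsMinimum P ⊤⁺    = ∀ {j} → ¬ P j

HasAdhesionOrder : ∀ {G} → Bramble G → ℕ ⁺ → Set
HasAdhesionOrder B =
  IsMinimum λ k → ∃[ F ] (DisconnectingSet B F × ∣ F ∣ ≡ k)

HasBagOrder : ∀ {G} → Bramble G → ℕ ⁺ → Set
HasBagOrder B =
  IsMinimum λ k → ∃[ s ] (s ∈ˡ Bramble.slabs B × ∣ Slab.core s ∣ ≡ k)

HasBramble≥ : Graph → ℕ → ℕ → Set
HasBramble≥ G a b = Σ (Bramble G) λ B → ∃₂ λ o o′ →
  HasAdhesionOrder B o × HasBagOrder B o′ × [ a ] ≤⁺ o × [ b ] ≤⁺ o′

------------------------------------------------------------------------
-- Tangles

-- A pair (A , B) of vertex sets stands for an oriented separation once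
-- `IsSeparation` holds. An unoriented separation is such a pair up to `swap`.
Sides : Graph → Set
Sides G = Subset (#V G) × Subset (#V G)

record IsSeparation (G : Graph) (s : Sides G) : Set where
  field
    disjoint : Empty (proj₁ s ∩ proj₂ s)
    covers   : ∀ v → v ∈ proj₁ s ⊎ v ∈ proj₂ s

sepOrder : (G : Graph) → Sides G → ℕ
sepOrder G (A , _) = ∣ δ G A ∣

-- The oriented separations associated with elements of 𝒮ₐ.
S⃗ : (G : Graph) → ℕ → Pred (Sides G) 0ℓ
S⃗ G a s = IsSeparation G s × sepOrder G s < a

record IsOrientation (G : Graph) (a : ℕ) (L : Pred (Sides G) 0ℓ) : Set where
  field
    within  : ∀ {s} → L s → S⃗ G a s
    exactly : ∀ {s} → S⃗ G a s → ∃! _≡_ λ r → (r ≡ s ⊎ r ≡ swap s) × L r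

-- The two members (A , B) and (C , D) may coincide.
Consistent : ∀ {G} → Pred (Sides G) 0ℓ → Set
Consistent σ = ∀ {s t} → σ s → σ t → ¬ Empty (proj₂ s ∩ proj₂ t)

-- Finite sets of oriented separations are given by lists, in which
-- repetitions are immaterial.
record IsStar {G : Graph} (σ : List (Sides G)) : Set where
  field
    nonEmpty   : σ ≢ []
    consistent : Consistent {G} (_∈ˡ σ)
    disjoint   : ∀ {s t} → s ∈ˡ σ → t ∈ˡ σ → s ≢ t → Empty (proj₁ s ∩ proj₁ t)

boldUnion : (G : Graph) → List (Sides G) → Subset (#E G)
boldUnion G σ = ⋃ (List.map (λ s → δ G (proj₁ s))
  (filter (λ s → 3 ≤? ∣ δ G (proj₁ s) ∣) σ))

-- Σ_{a,b}
record ForbiddenStar (G : Graph) (a b : ℕ) (σ : List (Sides G)) : Set where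
  field
    within     : All (S⃗ G a) σ
    isStar     : IsStar {G} σ
    smallUnion : ∣ boldUnion G σ ∣ < a
    smallMeet  : ∣ ⋂ (List.map proj₂ σ) ∣ < b

record IsTangle (G : Graph) (a b : ℕ) (L : Pred (Sides G) 0ℓ) : Set where
  field
    isOrientation : IsOrientation G a L
    consistent    : Consistent {G} L
    avoids        : ∀ {σ} → ForbiddenStar G a b σ → ¬ All L σ

-- For a ≤ 2 this is strictly weaker than the absence of a decomposition of
-- widths < a and < b, since 𝒮ₐ then omits thin separations of order ≥ a: two
-- vertices joined by one edge have a (1,2)-tangle {(∅,V)}, yet also a
-- decomposition of adhesion-width 0 and bag-width 1.
HasTangle≥ : Graph → ℕ → ℕ → Set₁
HasTangle≥ G a b = ∃₂ λ a′ b′ → a′ ≥ a × b′ ≥ b × ∃ (IsTangle G a′ b′)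

HasDecomposition< : Graph → ℕ → ℕ → Set
HasDecomposition< G a b = Σ (TreeCutDecomposition G) λ 𝒯 →
  TreeCutDecomposition.adhesionWidth 𝒯 < a × TreeCutDecomposition.bagWidth 𝒯 < b

{-# OPTIONS --safe #-}

-- A bramble orients every separation of order < a towards the cores that its
-- cut fails to disconnect, which is a tangle. A bramble, and for a ≥ 3 a
-- tangle, also makes each node of a decomposition of small widths point along
-- an incident edge of the tree; two nodes pointing at each other see disjoint
-- sides, which is absurd.
--
-- Conversely, let R be a class of vertices pairwise inseparable by cuts of at
-- most two edges. Each component of G − R sends at most two edges to R, and
-- contracting it into one of its neighbours gives the torso of R, in which no
-- more than |F| edges run between the components of G − F. Declare subsets of
-- R small as long as R has no tree into small parts. If two of the remaining
-- big sets are disjoint, the trees witnessing that they are big can be pushed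
-- onto a minimum cut between them and glued there. So either the big sets
-- pairwise intersect, and the big traces on R of components of G − F are the
-- cores of a bramble (3-edge-connected by Menger's theorem), or the torso has
-- a tree without small parts left over. In the latter case for all classes,
-- the trees of the torsos are assembled along cuts of at most two edges. A
-- decomposition of adhesion-width < 3 has no bold edges, hence adhesion-width
-- 0, so a < 3 reduces to a = 3.

module Submission where

open import Defs
open import Data.Nat.Base using (ℕ; _≤_; _<_)
open import Data.Product.Base using (_×_)
open import Function.Bundles using (_⇔_)
open import Relation.Nullary.Negation.Core using (¬_)

open import Data.Bool.Base using (Bool; true; false; _xor_)
open import Data.Bool.Properties as Boolₚ using ()
open import Data.Empty using (⊥-elim) renaming (⊥ to Absurd)
open import Data.Fin.Base using (Fin; fromℕ<; zero; suc)
open import Data.Fin.Properties as Finₚ using (any?)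
open import Data.Fin.Subset
  using (Subset; inside; outside; _∈_; _∉_; _⊆_; _⊂_; _∩_; _∪_; _─_; _-_; ∁; ⊤; ⊥; ⋃; ⋂; ⁅_⁆; ∣_∣; Empty; Nonempty)
open import Data.Fin.Subset.Properties
open import Data.List.Base as List using (List; []; _∷_; _++_; allFin; deduplicate; filter; length; map; replicate)
open import Data.List.Extrema.Nat using (max; max<v⁺; xs≤max)
open import Data.List.Membership.Propositional using (find; lose) renaming (_∈_ to _∈ˡ_; _∉_ to _∉ˡ_)
open import Data.List.Membership.Propositional.Properties
  using (∈-allFin; ∈-deduplicate⁺; ∈-deduplicate⁻; ∈-filter⁺; ∈-filter⁻; ∈-insert; ∈-map⁺; ∈-map⁻; ∈-++⁺ˡ; ∈-++⁺ʳ; ∈-++⁻; ∈-∃++)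
open import Data.List.Properties using (length-map; ++-identityʳ)
open import Data.List.Relation.Binary.Permutation.Propositional
  using (_↭_; ↭-refl; ↭-sym; ↭-trans; ↭-swap; prep)
open import Data.List.Relation.Binary.Permutation.Propositional.Properties
  using (∈-resp-↭; drop-∷; shift; filter-↭; ↭-length) renaming (++⁺ʳ to ↭-++⁺ʳ)
open import Data.List.Relation.Unary.All as All using (All; []; _∷_)
open import Data.List.Relation.Unary.All.Properties using (map⁺; ¬All⇒Any¬; ¬Any⇒All¬; All¬⇒¬Any)
open import Data.List.Relation.Unary.AllPairs as AllPairs using (AllPairs; []; _∷_)
open import Data.List.Relation.Unary.AllPairs.Properties using (++⁺)
open import Data.List.Relation.Unary.Any as Any using (Any; here; there)
open import Data.List.Relation.Unary.Unique.DecPropositional.Properties using (deduplicate-!)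
open import Data.List.Relation.Unary.Unique.Propositional using (Unique)
open import Data.Nat.Base using (zero; suc; _+_; z≤n; s≤s)
open import Data.Nat.Induction using (<-wellFounded)
open import Data.Nat.Properties as ℕₚ using (_≤?_)
open import Data.Product using (Σ; ∃; ∃!; ∃₂; ∃-syntax; _,_; proj₁; proj₂; swap)
open import Data.Sum.Base as Sum using (_⊎_; inj₁; inj₂; [_,_]′)
open import Data.Vec.Base using ([]; _∷_; lookup; tabulate; here; there)
open import Data.Vec.Properties as Vecₚ using (lookup∘tabulate; lookup⇒[]=; []=⇒lookup)
open import Function.Base using (_∘_; case_of_; id)
open import Function.Bundles using (mk⇔)
open import Induction.WellFounded using (Acc; acc)
open import Level using (0ℓ)
open import Relation.Binary.Construct.Add.Supremum.NonStrict _≤_ using (_≤⁺_; [_]; _≤⊤⁺; ≤⁺-trans)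
open import Relation.Binary.Construct.Closure.ReflexiveTransitive as Star using (Star; ε; _◅_; _◅◅_)
open import Relation.Binary.Core using (Rel)
open import Relation.Binary.PropositionalEquality
  using (_≡_; _≢_; refl; sym; trans; cong; cong₂; subst; subst₂; ≢-sym; module ≡-Reasoning)
open import Relation.Nullary.Construct.Add.Supremum using ([_]; ⊤⁺)
open import Relation.Nullary.Decidable using (Dec; yes; no; does; ¬?; _×-dec_; _⊎-dec_; map′; dec-true)

-- A core is 3-edge-connected, hence lies in one class. Duality on all of V(G) would give pairwise
-- intersecting sets that thin cuts can still split, so it is run inside each class, and thin cuts
-- reappear only when the trees are assembled.
--
-- Adhesion counts the union of the bold cuts around a node. Submodularity of single cuts is
-- therefore too weak for pushing a tree onto a minimum cut; `bold-restrict` treats the whole union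
-- at once.
--
-- A torso keeps the vertex and edge names of G and changes only the endpoint map, so that edge sets
-- of both can be compared. A component of G - R has at most two edges to R, and contracting it into
-- a neighbour turns one of them into a loop; at most one is left to be charged to F.
--
-- The choice of that neighbour is exploited in the assembly: while a part A is decomposed, r is
-- taken at an edge leaving A and preferred as the target, so that everything beyond A collapses to
-- r and the torso of R serves for A as well.

-- Finite subsets and their cardinalities

fromPred : ∀ {n} {P : Fin n → Set} → (∀ x → Dec (P x)) → Subset n
fromPred P? = tabulate (does ∘ P?)

∈-fromPred⁺ : ∀ {n} {P : Fin n → Set} (P? : ∀ x → Dec (P x)) {x} → P x → x ∈ fromPred P?
∈-fromPred⁺ P? {x} p =
  lookup⇒[]= x _ (trans (lookup∘tabulate (does ∘ P?) x) (dec-true (P? x) p))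

∈-fromPred⁻ : ∀ {n} {P : Fin n → Set} (P? : ∀ x → Dec (P x)) {x} → x ∈ fromPred P? → P x
∈-fromPred⁻ P? {x} x∈ with P? x | trans (sym (lookup∘tabulate (does ∘ P?) x)) ([]=⇒lookup x∈)
... | yes p | _ = p
... | no  _ | ()

∈-lookup : ∀ {n} {p : Subset n} {x} → lookup p x ≡ true → x ∈ p
∈-lookup {p = p} {x} = lookup⇒[]= x p

∉-lookup : ∀ {n} {p : Subset n} {x} → lookup p x ≡ false → x ∉ p
∉-lookup eq x∈ with trans (sym eq) ([]=⇒lookup x∈)
... | ()

lookup-∈ : ∀ {n} {p : Subset n} {x} → x ∈ p → lookup p x ≡ true
lookup-∈ = []=⇒lookup

lookup-∉ : ∀ {n} {p : Subset n} {x} → x ∉ p → lookup p x ≡ false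
lookup-∉ {p = p} {x} x∉ with lookup p x in eq
... | true  = ⊥-elim (x∉ (∈-lookup eq))
... | false = refl

∈-─⁻ : ∀ {n} {p q : Subset n} {x} → x ∈ p ─ q → x ∈ p × x ∉ q
∈-─⁻ {p = p} {q} {x} x∈ = p─q⊆p p q x∈ , λ x∈q → disj p q x∈ x∈q
  where
  disj : ∀ {n} (p q : Subset n) {x} → x ∈ p ─ q → x ∉ q
  disj (_ ∷ p)       (inside  ∷ q) {zero}  () here
  disj (_ ∷ p)       (_ ∷ q)       {suc x} (there i) (there j) = disj p q i j

∈-─⁺ : ∀ {n} {p q : Subset n} {x} → x ∈ p → x ∉ q → x ∈ p ─ q
∈-─⁺ = x∈p∧x∉q⇒x∈p─q

∈-minus⁻ : ∀ {n} {p : Subset n} {x y} → x ∈ p - y → x ∈ p × x ≢ y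
∈-minus⁻ {x = x} {y} x∈ with ∈-─⁻ x∈
... | x∈p , x∉ = x∈p , λ x≡y → x∉ (subst (_∈ ⁅ y ⁆) (sym x≡y) (x∈⁅x⁆ y))

∈-⋃⁺ : ∀ {n} {ps : List (Subset n)} {p x} → p ∈ˡ ps → x ∈ p → x ∈ ⋃ ps
∈-⋃⁺ (here refl) x∈ = x∈p∪q⁺ (inj₁ x∈)
∈-⋃⁺ (there i)   x∈ = x∈p∪q⁺ (inj₂ (∈-⋃⁺ i x∈))

∈-⋃⁻ : ∀ {n} (ps : List (Subset n)) {x} → x ∈ ⋃ ps → ∃[ p ] (p ∈ˡ ps × x ∈ p)
∈-⋃⁻ []       x∈ = ⊥-elim (∉⊥ x∈)
∈-⋃⁻ (p ∷ ps) x∈ with x∈p∪q⁻ p (⋃ ps) x∈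
... | inj₁ x∈p = p , here refl , x∈p
... | inj₂ x∈⋃ with ∈-⋃⁻ ps x∈⋃
...   | q , i , x∈q = q , there i , x∈q

∈-⋂⁻ : ∀ {n} {ps : List (Subset n)} {p x} → p ∈ˡ ps → x ∈ ⋂ ps → x ∈ p
∈-⋂⁻ {ps = _ ∷ ps} (here refl) x∈ = proj₁ (x∈p∩q⁻ _ (⋂ ps) x∈)
∈-⋂⁻ {ps = p ∷ ps} (there i)   x∈ = ∈-⋂⁻ i (proj₂ (x∈p∩q⁻ p (⋂ ps) x∈))

bit : Bool → ℕ
bit true  = 1
bit false = 0

∣∷∣ : ∀ {n} x (p : Subset n) → ∣ x ∷ p ∣ ≡ bit x + ∣ p ∣
∣∷∣ true  p = refl
∣∷∣ false p = refl

-- Each element occurs on the left at most as often as on the right. Inequalities of submodular type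
-- thus reduce to following a single edge.
card₂ : ∀ {n} (p q p′ q′ : Subset n) →
  (∀ {i} → i ∈ p → i ∈ p′ ⊎ i ∈ q′) → (∀ {i} → i ∈ q → i ∈ p′ ⊎ i ∈ q′) →
  (∀ {i} → i ∈ p → i ∈ q → i ∈ p′ × i ∈ q′) → ∣ p ∣ + ∣ q ∣ ≤ ∣ p′ ∣ + ∣ q′ ∣
card₂ [] [] [] [] _ _ _ = z≤n
card₂ (x ∷ p) (y ∷ q) (x′ ∷ p′) (y′ ∷ q′) f g h
  rewrite ∣∷∣ x p | ∣∷∣ y q | ∣∷∣ x′ p′ | ∣∷∣ y′ q′ =
  subst₂ _≤_ (interchange (bit x) (bit y) ∣ p ∣ ∣ q ∣)
    (interchange (bit x′) (bit y′) ∣ p′ ∣ ∣ q′ ∣)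
    (ℕₚ.+-mono-≤ (heads x y x′ y′ (⊎-head ∘ f ∘ at) (⊎-head ∘ g ∘ at)
        (λ ex ey → let i , j = h (at ex) (at ey) in un i , un j))
      (card₂ p q p′ q′ (⊎-tail ∘ f ∘ there) (⊎-tail ∘ g ∘ there)
        (λ i j → let k , l = h (there i) (there j) in drop-there k , drop-there l)))
  where
  interchange : ∀ a b c d → (a + b) + (c + d) ≡ (a + c) + (b + d)
  interchange a b c d = begin
    (a + b) + (c + d) ≡⟨ ℕₚ.+-assoc a b (c + d) ⟩
    a + (b + (c + d)) ≡⟨ cong (a +_) (sym (ℕₚ.+-assoc b c d)) ⟩
    a + ((b + c) + d) ≡⟨ cong (λ t → a + (t + d)) (ℕₚ.+-comm b c) ⟩
    a + ((c + b) + d) ≡⟨ cong (a +_) (ℕₚ.+-assoc c b d) ⟩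
    a + (c + (b + d)) ≡⟨ sym (ℕₚ.+-assoc a c (b + d)) ⟩
    (a + c) + (b + d) ∎
    where open ≡-Reasoning
  at : ∀ {n s} {p : Subset n} → s ≡ true → zero ∈ (s ∷ p)
  at refl = here
  un : ∀ {n s} {p : Subset n} → zero ∈ (s ∷ p) → s ≡ true
  un here = refl
  ⊎-head : ∀ {n s t} {p q : Subset n} → zero ∈ (s ∷ p) ⊎ zero ∈ (t ∷ q) → s ≡ true ⊎ t ≡ true
  ⊎-head = Sum.map un un
  ⊎-tail : ∀ {n s t i} {p q : Subset n} → suc i ∈ (s ∷ p) ⊎ suc i ∈ (t ∷ q) → i ∈ p ⊎ i ∈ q
  ⊎-tail = Sum.map drop-there drop-there
  heads : ∀ x y x′ y′ → (x ≡ true → x′ ≡ true ⊎ y′ ≡ true) →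
    (y ≡ true → x′ ≡ true ⊎ y′ ≡ true) → (x ≡ true → y ≡ true → x′ ≡ true × y′ ≡ true) →
    bit x + bit y ≤ bit x′ + bit y′
  heads false false _ _ _ _ _ = z≤n
  heads true true x′ y′ _ _ h with h refl refl
  ... | refl , refl = ℕₚ.≤-refl
  heads true false x′ y′ f _ _ with f refl
  ... | inj₁ refl = s≤s z≤n
  ... | inj₂ refl = ℕₚ.m≤n+m 1 (bit x′)
  heads false true x′ y′ _ g _ with g refl
  ... | inj₁ refl = s≤s z≤n
  ... | inj₂ refl = ℕₚ.m≤n+m 1 (bit x′)

∣p∣≤1+∣p-x∣ : ∀ {n} (p : Subset n) x → ∣ p ∣ ≤ 1 + ∣ p - x ∣
∣p∣≤1+∣p-x∣ {n} p x = begin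
  ∣ p ∣             ≤⟨ ℕₚ.m≤m+n ∣ p ∣ ∣ ⊥ {n} ∣ ⟩
  ∣ p ∣ + ∣ ⊥ {n} ∣ ≤⟨ card₂ p ⊥ ⁅ x ⁆ (p - x) f (⊥-elim ∘ ∉⊥) (λ _ i → ⊥-elim (∉⊥ i)) ⟩
  ∣ ⁅ x ⁆ ∣ + ∣ p - x ∣ ≡⟨ cong (_+ ∣ p - x ∣) (∣⁅x⁆∣≡1 x) ⟩
  1 + ∣ p - x ∣ ∎
  where
  open ℕₚ.≤-Reasoning
  f : ∀ {i} → i ∈ p → i ∈ ⁅ x ⁆ ⊎ i ∈ p - x
  f {i} i∈ with i Finₚ.≟ x
  ... | yes refl = inj₁ (x∈⁅x⁆ x)
  ... | no  i≢x  = inj₂ (x∈p∧x≢y⇒x∈p-y i∈ i≢x)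

-- A relation replaces the injective map because `charge` finds its edge by search; injectivity then
-- concerns `Charge` alone, whichever edge the search returns.
card-injection : ∀ {n n′} (ρ : Fin n → Fin n′ → Set) (p : Subset n) (q : Subset n′) →
  (∀ {i} → i ∈ p → ∃[ j ] (j ∈ q × ρ i j)) →
  (∀ {i i′ j} → i ∈ p → i′ ∈ p → ρ i j → ρ i′ j → i ≡ i′) → ∣ p ∣ ≤ ∣ q ∣
card-injection {n} {n′} ρ p q f inj = go (∣ p ∣) p q ℕₚ.≤-refl f inj
  where
  go : ∀ k (p : Subset n) (q : Subset n′) → ∣ p ∣ ≤ k → (∀ {i} → i ∈ p → ∃[ j ] (j ∈ q × ρ i j)) →
    (∀ {i i′ j} → i ∈ p → i′ ∈ p → ρ i j → ρ i′ j → i ≡ i′) → ∣ p ∣ ≤ ∣ q ∣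
  go zero    p q p≤k f inj = ℕₚ.≤-trans p≤k z≤n
  go (suc k) p q p≤k f inj with nonempty? p
  ... | no  e       = subst (λ r → ∣ r ∣ ≤ ∣ q ∣) (sym (Empty-unique e))
                        (subst (_≤ ∣ q ∣) (sym (∣⊥∣≡0 n)) z≤n)
  ... | yes (i , i∈p) with f i∈p
  ...   | j , j∈q , ρij = begin
    ∣ p ∣         ≤⟨ ∣p∣≤1+∣p-x∣ p i ⟩
    1 + ∣ p - i ∣ ≤⟨ s≤s (go k (p - i) (q - j) (ℕₚ.≤-pred (ℕₚ.≤-trans (x∈p⇒∣p-x∣<∣p∣ i∈p) p≤k)) f′
                       (λ a b → inj (proj₁ (∈-minus⁻ a)) (proj₁ (∈-minus⁻ b)))) ⟩
    1 + ∣ q - j ∣ ≤⟨ x∈p⇒∣p-x∣<∣p∣ j∈q ⟩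
    ∣ q ∣ ∎
    where
    open ℕₚ.≤-Reasoning
    f′ : ∀ {i′} → i′ ∈ p - i → ∃[ j′ ] (j′ ∈ q - j × ρ i′ j′)
    f′ i′∈ with ∈-minus⁻ i′∈
    ... | i′∈p , i′≢i with f i′∈p
    ...   | j′ , j′∈q , ρ′ = j′ , x∈p∧x≢y⇒x∈p-y j′∈q (λ { refl → i′≢i (inj i′∈p i∈p ρ′ ρij) }) , ρ′

card-three : ∀ {n} {p : Subset n} {x y z} → x ∈ p → y ∈ p → z ∈ p →
  x ≢ y → x ≢ z → y ≢ z → 3 ≤ ∣ p ∣
card-three {p = p} {x} {y} {z} x∈ y∈ z∈ x≢y x≢z y≢z = begin
  3                   ≤⟨ s≤s (s≤s (s≤s z≤n)) ⟩
  3 + ∣ p - x - y - z ∣ ≤⟨ s≤s (s≤s (x∈p⇒∣p-x∣<∣p∣ z∈′)) ⟩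
  2 + ∣ p - x - y ∣   ≤⟨ s≤s (x∈p⇒∣p-x∣<∣p∣ y∈′) ⟩
  1 + ∣ p - x ∣       ≤⟨ x∈p⇒∣p-x∣<∣p∣ x∈ ⟩
  ∣ p ∣ ∎
  where
  open ℕₚ.≤-Reasoning
  y∈′ : y ∈ p - x
  y∈′ = x∈p∧x≢y⇒x∈p-y y∈ (≢-sym x≢y)
  z∈′ : z ∈ p - x - y
  z∈′ = x∈p∧x≢y⇒x∈p-y (x∈p∧x≢y⇒x∈p-y z∈ (≢-sym x≢z)) (≢-sym y≢z)

card-list : ∀ {n} {p : Subset n} {xs} → (∀ {i} → i ∈ p → i ∈ˡ xs) → ∣ p ∣ ≤ List.length xs
card-list {n} {p} {[]} f =
  subst (_≤ 0) (cong ∣_∣ (sym (Empty-unique λ (_ , i) → case f i of λ ()))) (ℕₚ.≤-reflexive (∣⊥∣≡0 n))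
card-list {n} {p} {x ∷ xs} f = ℕₚ.≤-trans (∣p∣≤1+∣p-x∣ p x) (s≤s (card-list λ i∈ →
  let i∈p , i≢x = ∈-minus⁻ i∈ in case f i∈p of λ { (here eq) → ⊥-elim (i≢x eq) ; (there j) → j }))

-- The element x counts twice on the right and not at all on the left. For two thin cuts that share
-- an edge the arithmetic is 2 + 2 - 2 = 2.
card-drop₂ : ∀ {n} {p q r : Subset n} {x} → (∀ {i} → i ∈ p → i ∈ q ⊎ i ∈ r) → x ∉ p → x ∈ q → x ∈ r →
  2 + ∣ p ∣ ≤ ∣ q ∣ + ∣ r ∣
card-drop₂ {p = p} {q} {r} {x} f x∉p x∈q x∈r = begin
  2 + ∣ p ∣                     ≤⟨ s≤s (p⊂q⇒∣p∣<∣q∣ (p⊆p∪q ⁅ x ⁆ , x , x∈p∪q⁺ (inj₂ (x∈⁅x⁆ x)) , x∉p)) ⟩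
  1 + ∣ p ∪ ⁅ x ⁆ ∣             ≡⟨ ℕₚ.+-comm 1 ∣ p ∪ ⁅ x ⁆ ∣ ⟩
  ∣ p ∪ ⁅ x ⁆ ∣ + 1             ≡⟨ cong (∣ p ∪ ⁅ x ⁆ ∣ +_) (sym (∣⁅x⁆∣≡1 x)) ⟩
  ∣ p ∪ ⁅ x ⁆ ∣ + ∣ ⁅ x ⁆ ∣     ≤⟨ card₂ (p ∪ ⁅ x ⁆) ⁅ x ⁆ q r
    (λ i → [ f , (λ j → inj₁ (at j)) ]′ (x∈p∪q⁻ p ⁅ x ⁆ i)) (λ j → inj₁ (at j))
    (λ _ j → at j , subst (_∈ r) (sym (x∈⁅y⁆⇒x≡y x j)) x∈r) ⟩
  ∣ q ∣ + ∣ r ∣ ∎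
  where
  open ℕₚ.≤-Reasoning
  at : ∀ {i} → i ∈ ⁅ x ⁆ → i ∈ q
  at j = subst (_∈ q) (sym (x∈⁅y⁆⇒x≡y x j)) x∈q

-- Cuts and walks

-- A bare endpoint map rather than a `Graph`, because contraction onto a class creates loops.
Ends : ℕ → ℕ → Set
Ends m n = Fin m → Fin n × Fin n

opaque
  cut : ∀ {m n} → Ends m n → Subset n → Subset m
  cut en X = tabulate λ e → lookup X (proj₁ (en e)) xor lookup X (proj₂ (en e))

  δ≡cut : ∀ G X → δ G X ≡ cut (ends G) X
  δ≡cut G X = refl

module _ {m n} (en : Ends m n) where

  src tgt : Fin m → Fin n
  src e = proj₁ (en e)
  tgt e = proj₂ (en e)

  Across : Subset n → Fin m → Set
  Across X e = (src e ∈ X × tgt e ∉ X) ⊎ (src e ∉ X × tgt e ∈ X)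

  opaque
    unfolding cut

    ∈-cut⁻ : ∀ {X e} → e ∈ cut en X → Across X e
    ∈-cut⁻ {X} {e} e∈ with lookup X (src e) in p | lookup X (tgt e) in q
                         | trans (sym (lookup∘tabulate _ e)) (lookup-∈ e∈)
    ... | true  | true  | ()
    ... | true  | false | _ = inj₁ (∈-lookup p , ∉-lookup q)
    ... | false | true  | _ = inj₂ (∉-lookup p , ∈-lookup q)
    ... | false | false | ()

    ∈-cut⁺ : ∀ {X e} → Across X e → e ∈ cut en X
    ∈-cut⁺ {X} {e} (inj₁ (u∈ , v∉)) =
      ∈-lookup (trans (lookup∘tabulate _ e) (cong₂ _xor_ (lookup-∈ u∈) (lookup-∉ v∉)))
    ∈-cut⁺ {X} {e} (inj₂ (u∉ , v∈)) =
      ∈-lookup (trans (lookup∘tabulate _ e) (cong₂ _xor_ (lookup-∉ u∉) (lookup-∈ v∈)))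

  cut-⊥ : ∣ cut en ⊥ ∣ ≡ 0
  cut-⊥ = trans (cong ∣_∣ (Empty-unique λ (e , e∈) →
    [ (λ (i , _) → ∉⊥ i) , (λ (_ , i) → ∉⊥ i) ]′ (∈-cut⁻ e∈))) (∣⊥∣≡0 m)

  Link : Fin m → Fin n → Fin n → Set
  Link e x y = en e ≡ (x , y) ⊎ en e ≡ (y , x)

  across-link : ∀ {X e x y} → Link e x y → x ∈ X → y ∉ X → e ∈ cut en X
  across-link (inj₁ eq) x∈ y∉ rewrite sym (cong proj₁ eq) | sym (cong proj₂ eq) = ∈-cut⁺ (inj₁ (x∈ , y∉))
  across-link (inj₂ eq) x∈ y∉ rewrite sym (cong proj₁ eq) | sym (cong proj₂ eq) = ∈-cut⁺ (inj₂ (y∉ , x∈))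

  ends-across : ∀ {X e} → e ∈ cut en X → ∃₂ λ x y → Link e x y × x ∈ X × y ∉ X
  ends-across {X} {e} e∈ with ∈-cut⁻ e∈
  ... | inj₁ (x∈ , y∉) = _ , _ , inj₁ refl , x∈ , y∉
  ... | inj₂ (x∉ , y∈) = _ , _ , inj₂ refl , y∈ , x∉

  cut-at : ∀ {X e x y} → Link e x y → e ∈ cut en X → (x ∈ X × y ∉ X) ⊎ (y ∈ X × x ∉ X)
  cut-at (inj₁ eq) e∈ rewrite sym (cong proj₁ eq) | sym (cong proj₂ eq) = Sum.map₂ swap (∈-cut⁻ e∈)
  cut-at (inj₂ eq) e∈ rewrite sym (cong proj₁ eq) | sym (cong proj₂ eq) = Sum.swap (Sum.map₂ swap (∈-cut⁻ e∈))

  cut-ext : ∀ {X Y} → (∀ {e} → Across X e → Across Y e) → (∀ {e} → Across Y e → Across X e) → cut en X ≡ cut en Y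
  cut-ext f g = ⊆-antisym (∈-cut⁺ ∘ f ∘ ∈-cut⁻) (∈-cut⁺ ∘ g ∘ ∈-cut⁻)

  cut-∁ : ∀ X → cut en (∁ X) ≡ cut en X
  cut-∁ X = cut-ext
    (λ { (inj₁ (u , v)) → inj₂ (x∈∁p⇒x∉p u , x∉∁p⇒x∈p v) ; (inj₂ (u , v)) → inj₁ (x∉∁p⇒x∈p u , x∈∁p⇒x∉p v) })
    (λ { (inj₁ (u , v)) → inj₂ (x∈p⇒x∉∁p u , x∉p⇒x∈∁p v) ; (inj₂ (u , v)) → inj₁ (x∉p⇒x∈∁p u , x∈p⇒x∉∁p v) })

  link-end : ∀ {e x y} → Link e x y → src e ≡ x ⊎ tgt e ≡ x
  link-end (inj₁ eq) = inj₁ (cong proj₁ eq)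
  link-end (inj₂ eq) = inj₂ (cong proj₂ eq)

module _ {G : Graph} where

  walk-crosses : ∀ {S X u v} (w : Walk G S u v) → u ∈ X → v ∉ X →
    ∃[ e ] (e ∈ˡ edges w × e ∈ S × e ∈ cut (ends G) X)
  walk-crosses ε u∈ v∉ = ⊥-elim (v∉ u∈)
  walk-crosses {X = X} (_◅_ {j = x} (step e a j) w) u∈ v∉ with x ∈? X
  ... | no  x∉ = e , here refl , a , across-link (ends G) j u∈ x∉
  ... | yes x∈ with walk-crosses w x∈ v∉
  ...   | f , i , b , c = f , there i , b , c

  mapWalk : ∀ {S S′} → S ⊆ S′ → ∀ {u v} → Walk G S u v → Walk G S′ u v
  mapWalk f = Star.map λ (step e a j) → step e (f a) j

  revWalk : ∀ {S u v} → Walk G S u v → Walk G S v u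
  revWalk = Star.reverse λ (step e a j) → step e a (Sum.swap j)

  3ec⇒3≤∣cut∣ : ∀ {X u v} → ThreeEdgeConnected G u v → u ∈ X → v ∉ X → 3 ≤ ∣ cut (ends G) X ∣
  3ec⇒3≤∣cut∣ (inj₁ refl) u∈ v∉ = ⊥-elim (v∉ u∈)
  3ec⇒3≤∣cut∣ (inj₂ (p , q , r , _ , dpq , dpr , dqr)) u∈ v∉
    with walk-crosses p u∈ v∉ | walk-crosses q u∈ v∉ | walk-crosses r u∈ v∉
  ... | e , e∈p , _ , e∈ | f , f∈q , _ , f∈ | g , g∈r , _ , g∈ =
    card-three e∈ f∈ g∈ (λ { refl → dpq (e∈p , f∈q) }) (λ { refl → dpr (e∈p , g∈r) })
      (λ { refl → dqr (f∈q , g∈r) })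

-- Loop erasure

module _ {n} {R : Rel (Fin n) 0ℓ} where

  stops : ∀ {u v} → Star R u v → List (Fin n)
  stops ε                 = []
  stops (_◅_ {j = x} _ w) = x ∷ stops w

  Simple : ∀ {u v} → Star R u v → Set
  Simple {u} w = Unique (u ∷ stops w)

  suffix : ∀ {u v x} (w : Star R u v) → Simple w → x ∈ˡ (u ∷ stops w) → ∃ λ (w′ : Star R x v) → Simple w′
  suffix w       s       (here refl) = w , s
  suffix (_ ◅ w) (_ ∷ s) (there i)   = suffix w s i

  erase : ∀ {u v} → Star R u v → ∃ λ (w : Star R u v) → Simple w
  erase ε = ε , [] ∷ []
  erase {u} (r ◅ w) with erase w
  ... | w′ , s with Any.any? (u Finₚ.≟_) (_ ∷ stops w′)
  ...   | yes i = suffix w′ s i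
  ...   | no  i = r ◅ w′ , ¬Any⇒All¬ _ i ∷ s

laterVertices≡stops : ∀ {G S u v} (w : Walk G S u v) → laterVertices w ≡ stops w
laterVertices≡stops ε       = refl
laterVertices≡stops (_ ◅ w) = cong (_ ∷_) (laterVertices≡stops w)

toPath : ∀ {G S u v} → Walk G S u v → ∃ λ (w : Walk G S u v) → IsPath w
toPath w with erase w
... | w′ , s = w′ , subst (λ l → Unique (_ ∷ l)) (sym (laterVertices≡stops w′)) s

edges⊆ : ∀ {G S u v} (w : Walk G S u v) {e} → e ∈ˡ edges w → e ∈ S
edges⊆ (step e a j ◅ w) (here refl) = a
edges⊆ (_ ◅ w)          (there i)   = edges⊆ w i

joins-functional : ∀ G {e u v x y} → Joins G e u v → Joins G e x y → u ≡ x ⊎ u ≡ y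
joins-functional G (inj₁ p) (inj₁ q) = inj₁ (cong proj₁ (trans (sym p) q))
joins-functional G (inj₁ p) (inj₂ q) = inj₂ (cong proj₁ (trans (sym p) q))
joins-functional G (inj₂ p) (inj₁ q) = inj₂ (cong proj₂ (trans (sym p) q))
joins-functional G (inj₂ p) (inj₂ q) = inj₁ (cong proj₂ (trans (sym p) q))

∈-edges⇒∈-vertices : ∀ {G S u v} (w : Walk G S u v) {e x y} → e ∈ˡ edges w → Joins G e x y →
  x ∈ˡ (u ∷ laterVertices w)
∈-edges⇒∈-vertices {G} (step e a j ◅ w) (here refl) j′ =
  Sum.[ here , (λ eq → there (here eq)) ] (joins-functional G j′ j)
∈-edges⇒∈-vertices (_ ◅ w) (there i) j′ = there (∈-edges⇒∈-vertices w i j′)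

isPath⇒uniqueEdges : ∀ {G S u v} (w : Walk G S u v) → IsPath w → Unique (edges w)
isPath⇒uniqueEdges ε                _       = []
isPath⇒uniqueEdges (step e a j ◅ w) (p ∷ s) =
  ¬Any⇒All¬ _ (λ i → All¬⇒¬Any p (∈-edges⇒∈-vertices w i j)) ∷ isPath⇒uniqueEdges w s

edges-mapWalk : ∀ {G : Graph} {S S′ : Subset (#E G)} (f : S ⊆ S′) {u v} (w : Walk G S u v) → edges (mapWalk f w) ≡ edges w
edges-mapWalk f ε       = refl
edges-mapWalk f (s ◅ w) = cong (Step.edge s ∷_) (edges-mapWalk f w)

laterVertices-mapWalk : ∀ {G : Graph} {S S′ : Subset (#E G)} (f : S ⊆ S′) {u v} (w : Walk G S u v) →
  laterVertices (mapWalk f w) ≡ laterVertices w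
laterVertices-mapWalk f ε       = refl
laterVertices-mapWalk f (_ ◅ w) = cong (_ ∷_) (laterVertices-mapWalk f w)

pathIn : ∀ {G S u v} → Walk G S u v → ∃ λ (p : Walk G ⊤ u v) → IsPath p × (∀ {e} → e ∈ˡ edges p → e ∈ S)
pathIn w with toPath w
... | w′ , s = mapWalk (λ _ → ∈⊤) w′
  , subst (λ l → Unique (_ ∷ l)) (sym (laterVertices-mapWalk _ w′)) s
  , λ e∈ → edges⊆ w′ (subst (_ ∈ˡ_) (edges-mapWalk _ w′) e∈)

-- Bold unions

_≟ˢ_ : ∀ {n} (p q : Subset n) → Dec (p ≡ q)
_≟ˢ_ = Vecₚ.≡-dec Boolₚ._≟_

opaque
  bold : ∀ {m n} → Ends m n → List (Subset n) → Subset m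
  bold en σ = ⋃ (List.map (cut en) (filter (λ Y → 3 ≤? ∣ cut en Y ∣) σ))

module _ {m n} (en : Ends m n) where

  opaque
    unfolding bold

    ∈-bold⁺ : ∀ {σ Y e} → Y ∈ˡ σ → 3 ≤ ∣ cut en Y ∣ → e ∈ cut en Y → e ∈ bold en σ
    ∈-bold⁺ i 3≤ e∈ = ∈-⋃⁺ (∈-map⁺ (cut en) (∈-filter⁺ (λ Y → 3 ≤? ∣ cut en Y ∣) i 3≤)) e∈

    ∈-bold⁻ : ∀ σ {e} → e ∈ bold en σ → ∃[ Y ] (Y ∈ˡ σ × 3 ≤ ∣ cut en Y ∣ × e ∈ cut en Y)
    ∈-bold⁻ σ e∈ with ∈-⋃⁻ _ e∈
    ... | p , p∈ , e∈p with ∈-map⁻ (cut en) p∈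
    ...   | Y , Y∈ , refl with ∈-filter⁻ (λ Y → 3 ≤? ∣ cut en Y ∣) {xs = σ} Y∈
    ...     | i , 3≤ = Y , i , 3≤ , e∈p

  ∣cut∣≤∣bold∣ : ∀ {σ Y} → Y ∈ˡ σ → 3 ≤ ∣ cut en Y ∣ → ∣ cut en Y ∣ ≤ ∣ bold en σ ∣
  ∣cut∣≤∣bold∣ i 3≤ = p⊆q⇒∣p∣≤∣q∣ (∈-bold⁺ i 3≤)

  private
    either : ∀ {X U e} → e ∈ cut en (X ∩ U) → e ∈ cut en X ⊎ e ∈ cut en U
    either {X} {U} e∈ with ends-across en e∈
    ... | x , y , l , x∈ , y∉ with x∈p∩q⁻ X U x∈ | y ∈? X
    ...   | x∈X , x∈U | no  y∉X = inj₁ (across-link en l x∈X y∉X)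
    ...   | x∈X , x∈U | yes y∈X = inj₂ (across-link en l x∈U λ y∈U → y∉ (x∈p∩q⁺ (y∈X , y∈U)))

    -- Such an edge runs from Y ∩ U to the outside of U ∪ Z and so leaves Y and U at once. Allowing
    -- any Z above Y serves a single set as well as the union of a family.
    inner : ∀ {Y Z U e} → Y ⊆ Z → e ∈ cut en (Y ∩ U) → e ∈ cut en (U ∪ Z) → e ∈ cut en Y × e ∈ cut en U
    inner {Y} {Z} {U} Y⊆Z e∈ e∈′ with ends-across en e∈′
    ... | x , y , l , _ , y∉ with cut-at en l e∈
    ...   | inj₂ (y∈ , _) = ⊥-elim (y∉ (x∈p∪q⁺ (inj₁ (proj₂ (x∈p∩q⁻ Y U y∈)))))
    ...   | inj₁ (x∈ , _) with x∈p∩q⁻ Y U x∈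
    ...     | x∈Y , x∈U = across-link en l x∈Y (λ y∈Y → y∉ (x∈p∪q⁺ (inj₂ (Y⊆Z y∈Y))))
                        , across-link en l x∈U (λ y∈U → y∉ (x∈p∪q⁺ (inj₁ y∈U)))

    outer : ∀ {U e} I → e ∈ cut en (U ∪ ⋃ I) → (∃[ Y ] (Y ∈ˡ I × e ∈ cut en Y)) ⊎ e ∈ cut en U
    outer {U} I e∈ with ends-across en e∈
    ... | x , y , l , x∈ , y∉ with x∈p∪q⁻ U (⋃ I) x∈
    ...   | inj₁ x∈U = inj₂ (across-link en l x∈U (λ y∈U → y∉ (x∈p∪q⁺ (inj₁ y∈U))))
    ...   | inj₂ x∈I with ∈-⋃⁻ I x∈I
    ...     | Y , i , x∈Y = inj₁ (Y , i , across-link en l x∈Y (λ y∈Y → y∉ (x∈p∪q⁺ (inj₂ (∈-⋃⁺ i y∈Y)))))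

  cut-submodular : ∀ X U → ∣ cut en (X ∩ U) ∣ + ∣ cut en (U ∪ X) ∣ ≤ ∣ cut en X ∣ + ∣ cut en U ∣
  cut-submodular X U = card₂ _ _ _ _ either outer₁ (inner id)
    where
    outer₁ : ∀ {e} → e ∈ cut en (U ∪ X) → e ∈ cut en X ⊎ e ∈ cut en U
    outer₁ e∈ with ends-across en e∈
    ... | x , y , l , x∈ , y∉ with x∈p∪q⁻ U X x∈
    ...   | inj₁ x∈U = inj₂ (across-link en l x∈U (λ y∈U → y∉ (x∈p∪q⁺ (inj₁ y∈U))))
    ...   | inj₂ x∈X = inj₁ (across-link en l x∈X (λ y∈X → y∉ (x∈p∪q⁺ (inj₂ y∈X))))

  -- Submodularity for a whole family: the bold union of σ and the cut of U are
  -- compared, edge by edge, with the bold union of the restrictions and the cut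
  -- of U enlarged by the bold members of σ.
  bold-restrict : ∀ U σ → (∀ {Z} → Z ⊆ ⋃ σ → ∣ cut en U ∣ ≤ ∣ cut en (U ∪ Z) ∣) →
    ∣ bold en (List.map (_∩ U) σ) ∣ ≤ ∣ bold en σ ∣
  bold-restrict U σ min = ℕₚ.+-cancelʳ-≤ ∣ cut en (U ∪ ⋃ I) ∣ _ _ (ℕₚ.≤-trans
    (card₂ (bold en (List.map (_∩ U) σ)) (cut en (U ∪ ⋃ I)) (bold en σ) (cut en U) f g h)
    (ℕₚ.+-monoʳ-≤ ∣ bold en σ ∣ (min ⋃I⊆)))
    where
    bold? : ∀ Y → Dec (3 ≤ ∣ cut en Y ∣)
    bold? Y = 3 ≤? ∣ cut en Y ∣
    I : List (Subset n)
    I = filter bold? σ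
    ⋃I⊆ : ⋃ I ⊆ ⋃ σ
    ⋃I⊆ x∈ with ∈-⋃⁻ I x∈
    ... | Y , i , x∈Y = ∈-⋃⁺ (proj₁ (∈-filter⁻ bold? {xs = σ} i)) x∈Y
    -- Restriction does not enlarge a cut, so every bold restriction comes from a bold member of σ.
    thin : ∀ {Y} → Y ∈ˡ σ → ∣ cut en (Y ∩ U) ∣ ≤ ∣ cut en Y ∣
    thin {Y} i = ℕₚ.+-cancelʳ-≤ ∣ cut en (U ∪ Y) ∣ _ _ (ℕₚ.≤-trans (cut-submodular Y U)
      (ℕₚ.+-monoʳ-≤ ∣ cut en Y ∣ (min (∈-⋃⁺ i))))
    source : ∀ {e} → e ∈ bold en (List.map (_∩ U) σ) → ∃[ Y ] (Y ∈ˡ σ × 3 ≤ ∣ cut en Y ∣ × e ∈ cut en (Y ∩ U))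
    source e∈ with ∈-bold⁻ _ e∈
    ... | _ , i , 3≤ , e∈Y with ∈-map⁻ (_∩ U) i
    ...   | Y , j , refl = Y , j , ℕₚ.≤-trans 3≤ (thin j) , e∈Y
    f : ∀ {e} → e ∈ bold en (List.map (_∩ U) σ) → e ∈ bold en σ ⊎ e ∈ cut en U
    f e∈ with source e∈
    ... | Y , i , 3≤ , e∈Y = Sum.map₁ (∈-bold⁺ i 3≤) (either {Y} e∈Y)
    g : ∀ {e} → e ∈ cut en (U ∪ ⋃ I) → e ∈ bold en σ ⊎ e ∈ cut en U
    g e∈ = Sum.map₁ (λ (Y , i , e∈Y) → let j , 3≤ = ∈-filter⁻ bold? {xs = σ} i in ∈-bold⁺ j 3≤ e∈Y) (outer I e∈)
    h : ∀ {e} → e ∈ bold en (List.map (_∩ U) σ) → e ∈ cut en (U ∪ ⋃ I) → e ∈ bold en σ × e ∈ cut en U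
    h e∈ e∈′ with source e∈
    ... | Y , i , 3≤ , e∈Y with inner {Y} (∈-⋃⁺ (∈-filter⁺ bold? i 3≤)) e∈Y e∈′
    ...   | p , q = ∈-bold⁺ i 3≤ p , q

bold-mono : ∀ {m n n′} (en : Ends m n) (en′ : Ends m n′) {σ τ} →
  (∀ {Y} → Y ∈ˡ σ → 3 ≤ ∣ cut en Y ∣ → ∃[ Z ] (Z ∈ˡ τ × cut en Y ≡ cut en′ Z)) → bold en σ ⊆ bold en′ τ
bold-mono en en′ {σ} f {e} e∈ with ∈-bold⁻ en σ e∈
... | Y , i , 3≤ , e∈Y with f i 3≤
...   | Z , j , eq = ∈-bold⁺ en′ j (subst (λ p → 3 ≤ ∣ p ∣) eq 3≤) (subst (e ∈_) eq e∈Y)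

-- Searching through all subsets

allSubsets : ∀ n → List (Subset n)
allSubsets zero    = [] ∷ []
allSubsets (suc n) = List.map (inside ∷_) (allSubsets n) ++ List.map (outside ∷_) (allSubsets n)

∈-allSubsets : ∀ {n} (p : Subset n) → p ∈ˡ allSubsets n
∈-allSubsets []            = here refl
∈-allSubsets (inside  ∷ p) = ∈-++⁺ˡ (∈-map⁺ (inside ∷_) (∈-allSubsets p))
∈-allSubsets (outside ∷ p) = ∈-++⁺ʳ (List.map (inside ∷_) (allSubsets _)) (∈-map⁺ (outside ∷_) (∈-allSubsets p))

argmin : ∀ {n} {Q : Subset n → Set} → (∀ X → Dec (Q X)) → (f : Subset n → ℕ) → ∀ {X₀} → Q X₀ →
  ∃[ S ] (Q S × (∀ {X} → Q X → f S ≤ f X))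
argmin {n} {Q} Q? f {X₀} q₀ = go X₀ q₀ (<-wellFounded (f X₀))
  where
  go : ∀ X → Q X → Acc _<_ (f X) → ∃[ S ] (Q S × (∀ {X} → Q X → f S ≤ f X))
  go X q (acc rs) with anySubset? (λ Y → Q? Y ×-dec (f Y ℕₚ.<? f X))
  ... | yes (Y , q′ , lt) = go Y q′ (rs lt)
  ... | no  none          = X , q , λ q′ → ℕₚ.≮⇒≥ λ lt → none (_ , q′ , lt)

Apart : ∀ {n} → Subset n → Subset n → Set
Apart p q = ∀ {x} → x ∈ p → x ∉ q

allOr : ∀ {A : Set} {P : A → Set} {Q : Set} {xs} → All (λ x → P x ⊎ Q) xs → All P xs ⊎ Q
allOr []            = inj₁ []
allOr (inj₂ q ∷ _)  = inj₂ q
allOr (inj₁ p ∷ ps) = Sum.map₁ (p ∷_) (allOr ps)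

-- Trees of parts, and their duality

NoLeaf : ∀ {n} → Subset n → Set
NoLeaf _ = Absurd

module Trees {m n : ℕ} (en : Ends m n) (Ω : Subset n)
  (en∈Ω : ∀ e → proj₁ (en e) ∈ Ω × proj₂ (en e) ∈ Ω) (a b : ℕ) where

  -- The list `W ∷ cs` collects the sets cut off by the tree edges at the node, `W` by the edge to
  -- the parent and `cs` by those to the children. Repetitions in `cs` are tolerated.
  record Node (W : Subset n) (cs : List (Subset n)) : Set where
    field
      below : ∀ {c} → c ∈ˡ cs → c ⊆ W
      apart : ∀ {c d} → c ∈ˡ cs → d ∈ˡ cs → c ≢ d → Apart c d
      bold< : ∣ bold en (W ∷ cs) ∣ < a
      bag<  : ∣ W ─ ⋃ cs ∣ < b

  -- A rooted tree-cut decomposition of the part W of Ω, whose root bag is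
  -- W ─ ⋃ cs when cs are the parts below the root; leaves are unexplored parts.
  data RTree (L : Subset n → Set) : Subset n → Set where
    leaf : ∀ {W} → L W → RTree L W
    node : ∀ {W} cs → Node W cs → All (RTree L) cs → RTree L W

  module _ {L : Subset n → Set} (P : Subset n → Set) (l : ∀ {W} → L W → P W)
    (k : ∀ {W} cs → Node W cs → All (RTree L) cs → All P cs → P W) where

    elim  : ∀ {W} → RTree L W → P W
    elims : ∀ {cs} → All (RTree L) cs → All P cs
    elim (leaf x)       = l x
    elim (node cs c ts) = k cs c ts (elims ts)
    elims []       = []
    elims (t ∷ ts) = elim t ∷ elims ts

  bind : ∀ {L L′ : Subset n → Set} → (∀ {W} → L W → RTree L′ W) → ∀ {W} → RTree L W → RTree L′ W
  bind {L} {L′} f = elim (RTree L′) f (λ cs c _ → node cs c)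

  cut-co : ∀ X → cut en (Ω ─ X) ≡ cut en X
  cut-co X = cut-ext en
    (λ { {e} (inj₁ (u , v)) → inj₂ (proj₂ (∈-─⁻ u) , out (proj₂ (en∈Ω e)) v)
       ; {e} (inj₂ (u , v)) → inj₁ (out (proj₁ (en∈Ω e)) u , proj₂ (∈-─⁻ v)) })
    (λ { {e} (inj₁ (u , v)) → inj₂ ((λ i → proj₂ (∈-─⁻ i) u) , ∈-─⁺ (proj₂ (en∈Ω e)) v)
       ; {e} (inj₂ (u , v)) → inj₁ (∈-─⁺ (proj₁ (en∈Ω e)) u , λ i → proj₂ (∈-─⁻ i) v) })
    where
    out : ∀ {x} → x ∈ Ω → x ∉ Ω ─ X → x ∈ X
    out {x} x∈Ω x∉ with x ∈? X
    ... | yes x∈ = x∈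
    ... | no  x∉X = ⊥-elim (x∉ (∈-─⁺ x∈Ω x∉X))

  module _ {L : Subset n → Set} where

    -- All parts of the tree lie in Y, and no subset of Y lowers the cut of U when added to it. So
    -- `bold-restrict` applies at every node.
    restrict : ∀ U {Y} → (∀ {Z} → Z ⊆ Y → ∣ cut en U ∣ ≤ ∣ cut en (U ∪ Z) ∣) →
      (∀ {W} → L W → L (W ∩ U)) → ∀ {W} → RTree L W → W ⊆ Y → RTree L (W ∩ U)
    restrict U {Y} min cl = elim (λ W → W ⊆ Y → RTree L (W ∩ U)) (λ l _ → leaf (cl l)) k
      where
      k : ∀ {W} cs → Node W cs → All (RTree L) cs → All (λ W → W ⊆ Y → RTree L (W ∩ U)) cs →
        W ⊆ Y → RTree L (W ∩ U)
      k {W} cs nd _ ps W⊆Y = node (List.map (_∩ U) cs) nd′ (children below ps)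
        where
        open Node nd
        children : ∀ {cs} → (∀ {c} → c ∈ˡ cs → c ⊆ W) → All (λ W → W ⊆ Y → RTree L (W ∩ U)) cs →
          All (RTree L) (List.map (_∩ U) cs)
        children sub []       = []
        children sub (p ∷ ps) = p (λ i → W⊆Y (sub (here refl) i)) ∷ children (sub ∘ there) ps
        ⋃⊆ : ⋃ (W ∷ cs) ⊆ Y
        ⋃⊆ x∈ with ∈-⋃⁻ (W ∷ cs) x∈
        ... | _ , here refl , i = W⊆Y i
        ... | _ , there j   , i = W⊆Y (below j i)
        nd′ : Node (W ∩ U) (List.map (_∩ U) cs)
        nd′ .Node.below i x∈ with ∈-map⁻ (_∩ U) i
        ... | c , j , refl with x∈p∩q⁻ c U x∈
        ...   | p , q = x∈p∩q⁺ (below j p , q)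
        nd′ .Node.apart i j c≢d x∈ y∈ with ∈-map⁻ (_∩ U) i | ∈-map⁻ (_∩ U) j
        ... | c , i′ , refl | d , j′ , refl =
          apart i′ j′ (λ { refl → c≢d refl }) (proj₁ (x∈p∩q⁻ c U x∈)) (proj₁ (x∈p∩q⁻ d U y∈))
        nd′ .Node.bold< = ℕₚ.≤-<-trans (bold-restrict en U (W ∷ cs) λ Z⊆ → min λ i → ⋃⊆ (Z⊆ i)) bold<
        nd′ .Node.bag< = ℕₚ.≤-<-trans (p⊆q⇒∣p∣≤∣q∣ f) bag<
          where
          f : (W ∩ U) ─ ⋃ (List.map (_∩ U) cs) ⊆ W ─ ⋃ cs
          f x∈ with ∈-─⁻ x∈
          ... | i , j with x∈p∩q⁻ W U i
          ...   | x∈W , x∈U = ∈-─⁺ x∈W λ x∈⋃ → let c , c∈ , x∈c = ∈-⋃⁻ cs x∈⋃ in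
                  j (∈-⋃⁺ (∈-map⁺ (_∩ U) c∈) (x∈p∩q⁺ (x∈c , x∈U)))

    others : Subset n → List (Subset n) → List (Subset n)
    others c = filter (λ d → ¬? (d ≟ˢ c))

    ∈-others⁻ : ∀ {c d cs} → d ∈ˡ others c cs → d ∈ˡ cs × d ≢ c
    ∈-others⁻ {c} {cs = cs} = ∈-filter⁻ (λ d → ¬? (d ≟ˢ c)) {xs = cs}

    -- The same node seen from its neighbour c: the tree edges around it stay, and complementing a
    -- part in Ω preserves its cut, so neither bound is lost.
    turnNode : ∀ {W cs c} → W ⊆ Ω → Node W cs → c ∈ˡ cs → Node (Ω ─ c) ((Ω ─ W) ∷ others c cs)
    turnNode {W} {cs} {c} W⊆Ω nd c∈ = record
      { below = λ { (here refl) x∈ → let p , q = ∈-─⁻ x∈ in ∈-─⁺ p λ i → q (below c∈ i)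
                  ; (there j) x∈ → let d∈ , d≢c = ∈-others⁻ j in
                      ∈-─⁺ (W⊆Ω (below d∈ x∈)) (apart d∈ c∈ d≢c x∈) }
      ; apart = λ { (here refl) (here refl) ne → ⊥-elim (ne refl)
                  ; (here refl) (there j) _ x∈ y∈ → proj₂ (∈-─⁻ x∈) (below (proj₁ (∈-others⁻ j)) y∈)
                  ; (there i) (here refl) _ x∈ y∈ → proj₂ (∈-─⁻ y∈) (below (proj₁ (∈-others⁻ i)) x∈)
                  ; (there i) (there j) → apart (proj₁ (∈-others⁻ i)) (proj₁ (∈-others⁻ j)) }
      ; bold< = ℕₚ.≤-<-trans (p⊆q⇒∣p∣≤∣q∣ (bold-mono en en
          λ { (here refl) _ → c , there c∈ , cut-co c
            ; (there (here refl)) _ → W , here refl , cut-co W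
            ; (there (there j)) _ → _ , there (proj₁ (∈-others⁻ j)) , refl })) bold<
      ; bag< = ℕₚ.≤-<-trans (p⊆q⇒∣p∣≤∣q∣ f) bag<
      }
      where
      open Node nd
      f : (Ω ─ c) ─ ⋃ ((Ω ─ W) ∷ others c cs) ⊆ W ─ ⋃ cs
      f {x} x∈ with ∈-─⁻ x∈
      ... | i , j with ∈-─⁻ i
      ...   | x∈Ω , x∉c = ∈-─⁺ x∈W x∉⋃
        where
        x∈W : x ∈ W
        x∈W with x ∈? W
        ... | yes p = p
        ... | no  p = ⊥-elim (j (∈-⋃⁺ {ps = (Ω ─ W) ∷ others c cs} (here refl) (∈-─⁺ x∈Ω p)))
        x∉⋃ : x ∉ ⋃ cs
        x∉⋃ p with ∈-⋃⁻ cs p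
        ... | d , d∈ , x∈d = j (∈-⋃⁺ {ps = (Ω ─ W) ∷ others c cs} (there (∈-filter⁺ (λ d → ¬? (d ≟ˢ c)) d∈ λ { refl → x∉c x∈d })) x∈d)

    turnTree : ∀ {W cs c} → W ⊆ Ω → Node W cs → c ∈ˡ cs → RTree L (Ω ─ W) →
      (∀ {d} → d ∈ˡ cs → d ≢ c → RTree L d) → RTree L (Ω ─ c)
    turnTree W⊆Ω nd c∈ t ts = node _ (turnNode W⊆Ω nd c∈)
      (t ∷ All.tabulate λ j → let d∈ , d≢c = ∈-others⁻ j in ts d∈ d≢c)

    Rooted : Fin n → Set
    Rooted x = (∃[ W ] (x ∈ W × L W)) ⊎ (∃[ cs ] (Node Ω cs × x ∉ ⋃ cs × All (RTree L) cs))

    -- On the way down towards x, the tree for the complement of W grows by the node just left. Once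
    -- x lies below no child, hanging that tree beside the children makes the node a root.
    rerootAt : ∀ x {W} → RTree L W → W ⊆ Ω → x ∈ W → RTree L (Ω ─ W) → Rooted x
    rerootAt x = elim (λ W → W ⊆ Ω → x ∈ W → RTree L (Ω ─ W) → Rooted x)
      (λ l _ x∈ _ → inj₁ (_ , x∈ , l)) k
      where
      k : ∀ {W} cs → Node W cs → All (RTree L) cs →
        All (λ W → W ⊆ Ω → x ∈ W → RTree L (Ω ─ W) → Rooted x) cs → W ⊆ Ω → x ∈ W → RTree L (Ω ─ W) → Rooted x
      k {W} cs nd ts ps W⊆Ω x∈W t with x ∈? ⋃ cs
      ... | yes x∈ with ∈-⋃⁻ cs x∈
      ...   | c , c∈ , x∈c = All.lookup ps c∈ (λ i → W⊆Ω (below c∈ i)) x∈c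
                (turnTree W⊆Ω nd c∈ t λ d∈ _ → All.lookup ts d∈)
        where open Node nd
      k {W} cs nd ts ps W⊆Ω x∈W t | no x∉ = inj₂ ((Ω ─ W) ∷ cs , nd′ , x∉′ , t ∷ ts)
        where
        open Node nd
        x∉′ : x ∉ ⋃ ((Ω ─ W) ∷ cs)
        x∉′ i = [ (λ j → proj₂ (∈-─⁻ j) x∈W) , x∉ ]′ (x∈p∪q⁻ (Ω ─ W) (⋃ cs) i)
        nd′ : Node Ω ((Ω ─ W) ∷ cs)
        nd′ .Node.below (here refl) i = proj₁ (∈-─⁻ i)
        nd′ .Node.below (there j)   i = W⊆Ω (below j i)
        nd′ .Node.apart (here refl) (here refl) ne = ⊥-elim (ne refl)
        nd′ .Node.apart (here refl) (there j) _ p q = proj₂ (∈-─⁻ p) (below j q)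
        nd′ .Node.apart (there i) (here refl) _ p q = proj₂ (∈-─⁻ q) (below i p)
        nd′ .Node.apart (there i) (there j) = apart i j
        nd′ .Node.bold< = ℕₚ.≤-<-trans (p⊆q⇒∣p∣≤∣q∣ (bold-mono en en
          λ { (here refl) 3≤ → ⊥-elim (ℕₚ.<⇒≱ 3≤ (ℕₚ.≤-trans (ℕₚ.≤-reflexive cutΩ) z≤n))
            ; (there (here refl)) _ → W , here refl , cut-co W
            ; (there (there j)) _ → _ , there j , refl })) bold<
          where
          cutΩ : ∣ cut en Ω ∣ ≡ 0
          cutΩ = trans (cong ∣_∣ (trans (sym (cut-co Ω)) (cong (cut en)
            (Empty-unique λ (_ , i) → let p , q = ∈-─⁻ i in q p)))) (cut-⊥ en)
        nd′ .Node.bag< = ℕₚ.≤-<-trans (p⊆q⇒∣p∣≤∣q∣ f) bag<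
          where
          f : Ω ─ ⋃ ((Ω ─ W) ∷ cs) ⊆ W ─ ⋃ cs
          f {y} y∈ with ∈-─⁻ y∈ | y ∈? W
          ... | _ , j | yes y∈W = ∈-─⁺ y∈W λ i → j (x∈p∪q⁺ (inj₂ i))
          ... | y∈Ω , j | no y∉W = ⊥-elim (j (x∈p∪q⁺ (inj₁ (∈-─⁺ y∈Ω y∉W))))

    IsLeaf : Subset n → Subset n → Set
    IsLeaf A W = L W ⊎ W ≡ A

  module _ {L : Subset n → Set} {A : Subset n} (A≠∅ : Nonempty A) where

    private
      Turns : Subset n → Set
      Turns W = A ⊆ W × (RTree L (Ω ─ W) → RTree L (Ω ─ A))

    -- A nonempty leaf A can occur only once, so turning the tree around to
    -- make it the root removes it.
    rootAtLeaf : ∀ {W} → RTree (IsLeaf {L} A) W → W ⊆ Ω → RTree L W ⊎ Turns W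
    rootAtLeaf = elim (λ W → W ⊆ Ω → RTree L W ⊎ Turns W)
      (λ { (inj₁ l) _ → inj₁ (leaf l) ; (inj₂ refl) _ → inj₂ (id , id) }) k
      where
      k : ∀ {W} cs → Node W cs → All (RTree (IsLeaf {L} A)) cs →
        All (λ W → W ⊆ Ω → RTree L W ⊎ Turns W) cs → W ⊆ Ω → RTree L W ⊎ Turns W
      k {W} cs nd _ ps W⊆Ω = decide (scan (All.tabulate λ c∈ → All.lookup ps c∈ λ i → W⊆Ω (below c∈ i)))
        where
        open Node nd
        scan : ∀ {cs} → All (λ c → RTree L c ⊎ Turns c) cs → All (RTree L) cs ⊎ (∃[ c ] (c ∈ˡ cs × Turns c))
        scan []           = inj₁ []
        scan (inj₂ t ∷ _) = inj₂ (_ , here refl , t)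
        scan (inj₁ t ∷ r) with scan r
        ... | inj₁ ts           = inj₁ (t ∷ ts)
        ... | inj₂ (c , i , t′) = inj₂ (c , there i , t′)
        decide : All (RTree L) cs ⊎ (∃[ c ] (c ∈ˡ cs × Turns c)) → RTree L W ⊎ Turns W
        decide (inj₁ ts) = inj₁ (node cs nd ts)
        decide (inj₂ (c , c∈ , A⊆c , f)) = inj₂ ((λ i → below c∈ (A⊆c i)) , λ t → f (turnTree W⊆Ω nd c∈ t rest))
          where
          rest : ∀ {d} → d ∈ˡ cs → d ≢ c → RTree L d
          rest d∈ d≢c with All.lookup ps d∈ (λ i → W⊆Ω (below d∈ i))
          ... | inj₁ t         = t
          ... | inj₂ (A⊆d , _) = let x , x∈A = A≠∅ in ⊥-elim (apart d∈ c∈ d≢c (A⊆d x∈A) (A⊆c x∈A))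

  Ω─Ω≡⊥ : Ω ─ Ω ≡ ⊥
  Ω─Ω≡⊥ = Empty-unique λ (_ , i) → let p , q = ∈-─⁻ i in q p

  module _ (3≤a : 3 ≤ a) (0<b : 0 < b) where

    private
      0<a : 0 < a
      0<a = ℕₚ.≤-trans (s≤s z≤n) 3≤a

    emptyTree : ∀ {L} → RTree L ⊥
    emptyTree {L} = node [] (record
      { below = λ ()
      ; apart = λ ()
      ; bold< = ℕₚ.≤-<-trans (p⊆q⇒∣p∣≤∣q∣ f) (subst (_< a) (sym (cut-⊥ en)) 0<a)
      ; bag< = ℕₚ.≤-<-trans (p⊆q⇒∣p∣≤∣q∣ (p─q⊆p (⊥ {n}) (⋃ []))) (subst (_< b) (sym (∣⊥∣≡0 n)) 0<b)
      }) []
      where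
      f : bold en (⊥ ∷ []) ⊆ cut en ⊥
      f e∈ with ∈-bold⁻ en (⊥ ∷ []) e∈
      ... | _ , here refl , _ , i = i

    -- A bold cut is part of the bold union at the root of the tree; a thin one has at most two
    -- edges, and there `3 ≤ a` is used.
    cut<a : ∀ {L W} → RTree L W → L W ⊎ ∣ cut en W ∣ < a
    cut<a (leaf l) = inj₁ l
    cut<a {W = W} (node cs nd _) with 3 ≤? ∣ cut en W ∣
    ... | yes 3≤ = inj₂ (ℕₚ.≤-<-trans (∣cut∣≤∣bold∣ en (here refl) 3≤) (Node.bold< nd))
    ... | no  ≰  = inj₂ (ℕₚ.<-≤-trans (ℕₚ.≰⇒> ≰) 3≤a)

    -- The new node has an empty bag, and its bold union lies in the cut of S because Ω has an empty
    -- cut.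
    glue : ∀ {L S} → S ⊆ Ω → ∣ cut en S ∣ < a → RTree L S → RTree L (Ω ─ S) → RTree L Ω
    glue {L} {S} S⊆Ω cut< t u = node (S ∷ (Ω ─ S) ∷ []) nd (t ∷ u ∷ [])
      where
      nd : Node Ω (S ∷ (Ω ─ S) ∷ [])
      nd .Node.below (here refl) = S⊆Ω
      nd .Node.below (there (here refl)) i = proj₁ (∈-─⁻ i)
      nd .Node.apart (here refl) (here refl) ne = ⊥-elim (ne refl)
      nd .Node.apart (here refl) (there (here refl)) _ p q = proj₂ (∈-─⁻ q) p
      nd .Node.apart (there (here refl)) (here refl) _ p q = proj₂ (∈-─⁻ p) q
      nd .Node.apart (there (here refl)) (there (here refl)) ne = ⊥-elim (ne refl)
      nd .Node.bold< = ℕₚ.≤-<-trans (p⊆q⇒∣p∣≤∣q∣ f) cut<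
        where
        f : bold en (Ω ∷ S ∷ (Ω ─ S) ∷ []) ⊆ cut en S
        f e∈ with ∈-bold⁻ en _ e∈
        ... | _ , here refl , _ , i = ⊥-elim ([ (λ (_ , j) → j (proj₂ (en∈Ω _))) , (λ (j , _) → j (proj₁ (en∈Ω _))) ]′ (∈-cut⁻ en i))
        ... | _ , there (here refl) , _ , i = i
        ... | _ , there (there (here refl)) , _ , i = subst (_ ∈_) (cut-co S) i
      nd .Node.bag< = subst (_< b) (sym (trans (cong ∣_∣ (Empty-unique none)) (∣⊥∣≡0 n))) 0<b
        where
        none : Empty (Ω ─ ⋃ (S ∷ (Ω ─ S) ∷ []))
        none (x , x∈) with ∈-─⁻ x∈ | x ∈? S
        ... | _ , j   | yes x∈S = j (∈-⋃⁺ {ps = S ∷ (Ω ─ S) ∷ []} (here refl) x∈S)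
        ... | x∈Ω , j | no  x∉S = j (∈-⋃⁺ {ps = S ∷ (Ω ─ S) ∷ []} (there (here refl)) (∈-─⁺ x∈Ω x∉S))

    Below : (Subset n → Set) → Subset n → Subset n → Set
    Below L A W = L W ⊎ W ⊆ A

    module _ {L : Subset n → Set} (L? : ∀ W → Dec (L W)) (L⊥ : L ⊥) (down : ∀ {W X} → W ⊆ X → L X → L W) where

      -- A leaf within A that is neither small nor A itself is a smaller big set, to which `resolve`
      -- can pass. Without one, every leaf that is not small equals A.
      properLeaf : ∀ A {W} → RTree (Below L A) W → RTree (IsLeaf {L} A) W ⊎ (∃[ B ] (B ⊂ A × ¬ L B))
      properLeaf A = elim (λ W → RTree (IsLeaf {L} A) W ⊎ (∃[ B ] (B ⊂ A × ¬ L B))) l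
        (λ cs nd _ ps → Sum.map₁ (node cs nd) (allOr ps))
        where
        l : ∀ {W} → Below L A W → RTree (IsLeaf {L} A) W ⊎ (∃[ B ] (B ⊂ A × ¬ L B))
        l (inj₁ x) = inj₁ (leaf (inj₁ x))
        l {W} (inj₂ W⊆A) with L? W | W ≟ˢ A
        ... | yes x | _        = inj₁ (leaf (inj₁ x))
        ... | no _  | yes refl = inj₁ (leaf (inj₂ refl))
        ... | no ¬x | no  W≢A  = inj₂ (W , (W⊆A , strict) , ¬x)
          where
          strict : ∃[ x ] (x ∈ A × x ∉ W)
          strict with nonempty? (A ─ W)
          ... | yes (x , x∈) = x , ∈-─⁻ x∈
          ... | no  e = ⊥-elim (W≢A (⊆-antisym W⊆A λ {x} x∈A → case x ∈? W of λ
                { (yes i) → i ; (no i) → ⊥-elim (e (x , ∈-─⁺ x∈A i)) }))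

      join : ∀ {A B} → A ⊆ Ω → B ⊆ Ω → Apart A B → ¬ L A → ¬ L B →
        RTree L (Ω ─ A) → RTree L (Ω ─ B) → RTree L Ω
      join {A} {B} A⊆Ω B⊆Ω A∥B ¬LA ¬LB tA tB =
        glue S⊆Ω (ℕₚ.≤-<-trans (minS ((λ {_} → id) , A⊆co)) cutA<) tS tΩ─S
        where
        Q : Subset n → Set
        Q S = A ⊆ S × S ⊆ Ω ─ B
        Q? : ∀ S → Dec (Q S)
        Q? S = (A ⊆? S) ×-dec (S ⊆? Ω ─ B)
        A⊆co : A ⊆ Ω ─ B
        A⊆co i = ∈-─⁺ (A⊆Ω i) (A∥B i)
        minimal = argmin Q? (λ S → ∣ cut en S ∣) ((λ {_} → id) , A⊆co)
        S : Subset n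
        S = proj₁ minimal
        A⊆S : A ⊆ S
        A⊆S = proj₁ (proj₁ (proj₂ minimal))
        S⊆co : S ⊆ Ω ─ B
        S⊆co = proj₂ (proj₁ (proj₂ minimal))
        S⊆Ω : S ⊆ Ω
        S⊆Ω i = proj₁ (∈-─⁻ (S⊆co i))
        minS : ∀ {X} → Q X → ∣ cut en S ∣ ≤ ∣ cut en X ∣
        minS = proj₂ (proj₂ minimal)
        -- If the tree of Ω ─ A were a leaf, Ω ─ A would be small and with it its subset B.
        cutA< : ∣ cut en A ∣ < a
        cutA< with cut<a tA
        ... | inj₁ l = ⊥-elim (¬LB (down (λ i → ∈-─⁺ (B⊆Ω i) λ j → A∥B j i) l))
        ... | inj₂ h = subst (λ c → ∣ c ∣ < a) (cut-co A) h
        minB : ∀ {Z} → Z ⊆ Ω ─ B → ∣ cut en S ∣ ≤ ∣ cut en (S ∪ Z) ∣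
        minB {Z} Z⊆ = minS ((λ i → x∈p∪q⁺ (inj₁ (A⊆S i))) , λ i → [ S⊆co , Z⊆ ]′ (x∈p∪q⁻ S Z i))
        -- Enlarging Ω ─ S within Ω ─ A means shrinking S while keeping A inside, and complements
        -- have equal cuts.
        minA : ∀ {Z} → Z ⊆ Ω ─ A → ∣ cut en (Ω ─ S) ∣ ≤ ∣ cut en ((Ω ─ S) ∪ Z) ∣
        minA {Z} Z⊆ = subst₂ (λ p q → ∣ p ∣ ≤ ∣ q ∣) (sym (cut-co S)) (cut-co ((Ω ─ S) ∪ Z))
          (minS ((λ i → ∈-─⁺ (A⊆Ω i) λ j → [ (λ k → proj₂ (∈-─⁻ k) (A⊆S i)) , (λ k → proj₂ (∈-─⁻ (Z⊆ k)) i) ]′ (x∈p∪q⁻ (Ω ─ S) Z j))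
               , λ {x} i → case x ∈? S of λ
                   { (yes j) → S⊆co j
                   ; (no j) → ⊥-elim (proj₂ (∈-─⁻ i) (x∈p∪q⁺ (inj₁ (∈-─⁺ (proj₁ (∈-─⁻ i)) j)))) }))
        meet : ∀ X U → X ∩ U ⊆ X
        meet X U i = proj₁ (x∈p∩q⁻ X U i)
        tS : RTree L S
        tS = subst (RTree L) (⊆-antisym (λ i → proj₂ (x∈p∩q⁻ (Ω ─ B) S i)) λ i → x∈p∩q⁺ (S⊆co i , i))
          (restrict S minB (λ {W} → down (meet W S)) tB id)
        tΩ─S : RTree L (Ω ─ S)
        tΩ─S = subst (RTree L) (⊆-antisym (λ i → proj₂ (x∈p∩q⁻ (Ω ─ A) (Ω ─ S) i))
            λ i → let p , q = ∈-─⁻ i in x∈p∩q⁺ (∈-─⁺ p (λ j → q (A⊆S j)) , i))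
          (restrict (Ω ─ S) minA (λ {W} → down (meet W (Ω ─ S))) tA id)

      -- For a disjoint pair that cannot be shrunk, the witnessing trees have no other big leaves
      -- than A and B, so rerooting there gives trees of their complements. The descent may reach
      -- any big set, so all of them need witnesses.
      resolve : (∀ A → A ⊆ Ω → ¬ L A → RTree (Below L A) Ω) →
        ∀ A B → Acc _<_ (∣ A ∣ + ∣ B ∣) → A ⊆ Ω → B ⊆ Ω → Apart A B → ¬ L A → ¬ L B → RTree L Ω
      resolve wit A B (acc rs) A⊆Ω B⊆Ω A∥B ¬LA ¬LB
        with properLeaf A (wit A A⊆Ω ¬LA) | properLeaf B (wit B B⊆Ω ¬LB)
      ... | inj₂ (A′ , A′⊂A , ¬LA′) | _ =
        resolve wit A′ B (rs (ℕₚ.+-monoˡ-< ∣ B ∣ (p⊂q⇒∣p∣<∣q∣ A′⊂A)))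
          (λ i → A⊆Ω (proj₁ A′⊂A i)) B⊆Ω (λ i → A∥B (proj₁ A′⊂A i)) ¬LA′ ¬LB
      ... | inj₁ _ | inj₂ (B′ , B′⊂B , ¬LB′) =
        resolve wit A B′ (rs (ℕₚ.+-monoʳ-< ∣ A ∣ (p⊂q⇒∣p∣<∣q∣ B′⊂B)))
          A⊆Ω (λ i → B⊆Ω (proj₁ B′⊂B i)) (λ i j → A∥B i (proj₁ B′⊂B j)) ¬LA ¬LB′
      ... | inj₁ tA | inj₁ tB with rootAtLeaf (filled ¬LA) tA id | rootAtLeaf (filled ¬LB) tB id
        where
        filled : ∀ {X} → ¬ L X → Nonempty X
        filled {X} ¬LX with nonempty? X
        ... | yes ne = ne
        ... | no  e  = ⊥-elim (¬LX (subst L (sym (Empty-unique e)) L⊥))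
      ...   | inj₁ t | _ = t
      ...   | inj₂ _ | inj₁ t = t
      ...   | inj₂ (_ , f) | inj₂ (_ , g) = join A⊆Ω B⊆Ω A∥B ¬LA ¬LB (f rest) (g rest)
        where
        rest : RTree L (Ω ─ Ω)
        rest = leaf (subst L (sym Ω─Ω≡⊥) L⊥)

    -- Keeping only generators makes smallness downward closed by definition.
    Small : List (Subset n) → Subset n → Set
    Small 𝒩 W = Any (W ⊆_) 𝒩

    shrink : ∀ {𝒩 W X} → W ⊆ X → Small 𝒩 X → Small 𝒩 W
    shrink W⊆X (here X⊆N) = here λ i → X⊆N (W⊆X i)
    shrink W⊆X (there s)  = there (shrink W⊆X s)

    -- The object dual to a tree: like a tangle, it is pairwise intersecting and has a member in
    -- every star. With A = B, `meets` makes the members nonempty.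
    record Dense (stars : List (List (Subset n))) : Set where
      field
        ℬ     : List (Subset n)
        inΩ   : ∀ {A} → A ∈ˡ ℬ → A ⊆ Ω
        meets : ∀ {A B} → A ∈ˡ ℬ → B ∈ˡ ℬ → Nonempty (A ∩ B)
        hits  : ∀ {cs} → cs ∈ˡ stars → ∃[ c ] (c ∈ˡ cs × c ∈ˡ ℬ)

    -- Every subset of Ω is declared small when this keeps Ω indecomposable
    -- into small parts, and big otherwise; a big set comes with the tree
    -- that forbids declaring it small.
    duality : ∀ stars → All (Node Ω) stars → Dense stars ⊎ RTree NoLeaf Ω
    duality stars nodes = Sum.map₂ (bind empty) (decide (allSubsets n) (⊥ ∷ []) []
        (λ A _ → inj₁ (∈-allSubsets A)) (λ ()) (λ ()) (here refl))
      where
      empty : ∀ {W} → Small (⊥ ∷ []) W → RTree NoLeaf W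
      empty (here W⊆⊥) = subst (RTree _) (sym (Empty-unique λ (_ , i) → ∉⊥ (W⊆⊥ i))) emptyTree

      Witness : List (Subset n) → Subset n → Set
      Witness 𝒩 A = RTree (Below (Small 𝒩) A) Ω

      discard : ∀ {𝒩 A} → Small 𝒩 A → Witness 𝒩 A → RTree (Small 𝒩) Ω
      discard s = bind λ { (inj₁ l) → leaf l ; (inj₂ W⊆A) → leaf (shrink W⊆A s) }

      finish : ∀ 𝒩 ℬ → (∀ A → A ⊆ Ω → A ∈ˡ 𝒩 ⊎ A ∈ˡ ℬ) → (∀ {A} → A ∈ˡ ℬ → A ⊆ Ω) →
        (∀ {A} → A ∈ˡ ℬ → Witness 𝒩 A) → ⊥ ∈ˡ 𝒩 → Dense stars ⊎ RTree (Small 𝒩) Ω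
      finish 𝒩 ℬ all ℬ⊆ wit ⊥∈ with Any.any? (λ A → Any.any? (λ B → ¬? (nonempty? (A ∩ B))) ℬ) ℬ
      ... | yes any with find any
      ...   | A , A∈ , any′ with find any′
      -- A set listed as big may lie in a set declared small later; its witness is then already a
      -- tree into small parts.
      ...     | B , B∈ , e with Any.any? (A ⊆?_) 𝒩 | Any.any? (B ⊆?_) 𝒩
      ...       | yes s | _     = inj₂ (discard s (wit A∈))
      ...       | no _  | yes s = inj₂ (discard s (wit B∈))
      ...       | no ¬a | no ¬b = inj₂ (resolve (λ W → Any.any? (W ⊆?_) 𝒩) (lose ⊥∈ id) shrink wit′ A B
                    (<-wellFounded _) (ℬ⊆ A∈) (ℬ⊆ B∈) (λ i j → e (_ , x∈p∩q⁺ (i , j))) ¬a ¬b)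
        where
        wit′ : ∀ A → A ⊆ Ω → ¬ Small 𝒩 A → Witness 𝒩 A
        wit′ A A⊆Ω ¬s with all A A⊆Ω
        ... | inj₁ A∈𝒩 = ⊥-elim (¬s (lose A∈𝒩 id))
        ... | inj₂ A∈ℬ = wit A∈ℬ
      finish 𝒩 ℬ all ℬ⊆ wit ⊥∈ | no none with All.all? (λ cs → Any.any? (λ c → Any.any? (c ≟ˢ_) ℬ) cs) stars
      ... | yes h = inj₁ record
        { ℬ = ℬ
        ; inΩ = ℬ⊆
        ; meets = λ {A} {B} A∈ B∈ → case nonempty? (A ∩ B) of λ
            { (yes ne) → ne ; (no e) → ⊥-elim (none (lose A∈ (lose B∈ e))) }
        ; hits = λ cs∈ → find (All.lookup h cs∈)
        }
      -- A star without a big member has small members only, so it is a tree into small parts by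
      -- itself.
      ... | no ¬h with find (¬All⇒Any¬ (λ cs → Any.any? (λ c → Any.any? (c ≟ˢ_) ℬ) cs) stars ¬h)
      ...   | cs , cs∈ , miss = inj₂ (node cs nd (All.tabulate leaves))
        where
        nd : Node Ω cs
        nd = All.lookup nodes cs∈
        leaves : ∀ {c} → c ∈ˡ cs → RTree (Small 𝒩) c
        leaves {c} c∈ with all c (Node.below nd c∈)
        ... | inj₁ c∈𝒩 = leaf (lose c∈𝒩 id)
        ... | inj₂ c∈ℬ = ⊥-elim (miss (lose c∈ c∈ℬ))

      decide : ∀ todo 𝒩 ℬ → (∀ A → A ⊆ Ω → A ∈ˡ todo ⊎ A ∈ˡ 𝒩 ⊎ A ∈ˡ ℬ) → (∀ {A} → A ∈ˡ ℬ → A ⊆ Ω) →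
        (∀ {A} → A ∈ˡ ℬ → Witness 𝒩 A) → ⊥ ∈ˡ 𝒩 → Dense stars ⊎ RTree (Small 𝒩) Ω
      decide [] 𝒩 ℬ all ℬ⊆ wit ⊥∈ = finish 𝒩 ℬ (λ A A⊆Ω → [ (λ ()) , id ]′ (all A A⊆Ω)) ℬ⊆ wit ⊥∈
      decide (A ∷ todo) 𝒩 ℬ all ℬ⊆ wit ⊥∈ with A ⊆? Ω
      ... | no A⊈Ω = decide todo 𝒩 ℬ (λ B B⊆Ω → case all B B⊆Ω of λ
        { (inj₁ (here refl)) → ⊥-elim (A⊈Ω B⊆Ω) ; (inj₁ (there i)) → inj₁ i ; (inj₂ r) → inj₂ r }) ℬ⊆ wit ⊥∈
      ... | yes A⊆Ω with decide todo (A ∷ 𝒩) ℬ (λ B B⊆Ω → case all B B⊆Ω of λ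
            { (inj₁ (here refl)) → inj₂ (inj₁ (here refl)) ; (inj₁ (there i)) → inj₁ i
            ; (inj₂ (inj₁ i)) → inj₂ (inj₁ (there i)) ; (inj₂ (inj₂ i)) → inj₂ (inj₂ i) }) ℬ⊆
            (λ B∈ → bind (λ { (inj₁ s) → leaf (inj₁ (there s)) ; (inj₂ s) → leaf (inj₂ s) }) (wit B∈)) (there ⊥∈)
      ...   | inj₁ dense = inj₁ dense
      ...   | inj₂ t = decide todo 𝒩 (A ∷ ℬ) (λ B B⊆Ω → case all B B⊆Ω of λ
            { (inj₁ (here refl)) → inj₂ (inj₂ (here refl)) ; (inj₁ (there i)) → inj₁ i
            ; (inj₂ (inj₁ i)) → inj₂ (inj₁ i) ; (inj₂ (inj₂ i)) → inj₂ (inj₂ (there i)) })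
            (λ { (here refl) → A⊆Ω ; (there i) → ℬ⊆ i })
            (λ { (here refl) → bind (λ { (here W⊆A) → leaf (inj₂ W⊆A) ; (there s) → leaf (inj₁ s) }) t ; (there i) → wit i }) ⊥∈

-- Menger's theorem

module Flow (G : Graph) where

  record Arc : Set where
    constructor arc
    field
      edge      : Edge G
      tail head : Vertex G
      joins     : Joins G edge tail head
  open Arc

  used : List Arc → List (Edge G)
  used = map edge

  -- The arcs of a list carry flow from the sources (with multiplicity) to the sinks.
  Balanced : List Arc → List (Vertex G) → List (Vertex G) → Set
  Balanced as sources sinks = map tail as ++ sinks ↭ map head as ++ sources

  Clear : List Arc → Edge G → Set
  Clear as e = All (λ a → edge a ≢ e) as

  data Distinct : List Arc → Set where
    []  : Distinct []
    _∷_ : ∀ {a as} → Clear as (edge a) → Distinct as → Distinct (a ∷ as)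

  split : ∀ {as a} → a ∈ˡ as → ∃₂ λ (xs ys : List Arc) → as ≡ xs ++ a ∷ ys
  split = ∈-∃++

  weaken : ∀ xs {a ys} {b : Arc} → b ∈ˡ xs ++ ys → b ∈ˡ xs ++ a ∷ ys
  weaken []       i         = there i
  weaken (x ∷ xs) (here p)  = here p
  weaken (x ∷ xs) (there i) = there (weaken xs i)

  distinct-drop : ∀ xs {a ys} → Distinct (xs ++ a ∷ ys) → Distinct (xs ++ ys) × Clear (xs ++ ys) (edge a)
  distinct-drop []       (c ∷ d) = d , c
  distinct-drop (x ∷ xs) {a} {ys} (c ∷ d) with distinct-drop xs d
  ... | d′ , c′ = All.tabulate (λ i → All.lookup c (weaken xs i)) ∷ d′
                , (λ eq → All.lookup c (∈-insert xs) (sym eq)) ∷ c′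

  strengthen : ∀ xs {a ys} {b : Arc} → b ∈ˡ xs ++ a ∷ ys → b ≡ a ⊎ b ∈ˡ xs ++ ys
  strengthen []       (here p)  = inj₁ p
  strengthen []       (there i) = inj₂ i
  strengthen (x ∷ xs) (here p)  = inj₂ (here p)
  strengthen (x ∷ xs) (there i) = Sum.map₂ there (strengthen xs i)

  extract : ∀ {A : Set} (f : Arc → A) xs {a ys} → map f (xs ++ a ∷ ys) ↭ f a ∷ map f (xs ++ ys)
  extract f []       = ↭-refl
  extract f (x ∷ xs) = ↭-trans (prep (f x) (extract f xs)) (↭-swap (f x) _ ↭-refl)

  pull : ∀ (xs : List (Vertex G)) x ys → xs ++ x ∷ ys ↭ x ∷ xs ++ ys
  pull xs x ys = shift x xs ys

  -- Once the arc a is consumed, the unit of flow that started at `tail a` starts at `head a`.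
  remove : ∀ xs {a ys S T} → Balanced (xs ++ a ∷ ys) (tail a ∷ S) T → Balanced (xs ++ ys) (head a ∷ S) T
  remove xs {a} {ys} {S} {T} bal = drop-∷ {x = tail a} (↭-trans (↭-trans
      (↭-sym (↭-++⁺ʳ T (extract tail xs))) bal)
    (↭-trans (↭-++⁺ʳ (tail a ∷ S) (extract head xs))
    (↭-trans (pull (head a ∷ map head (xs ++ ys)) (tail a) S)
             (prep (tail a) (↭-sym (pull (map head (xs ++ ys)) (head a) S))))))

  insert : ∀ a {as S T} → Balanced as (head a ∷ S) T → Balanced (a ∷ as) (tail a ∷ S) T
  insert a {as} {S} {T} bal = ↭-trans (prep (tail a) bal)
    (↭-trans (prep (tail a) (pull (map head as) (head a) S))
             (↭-sym (pull (head a ∷ map head as) (tail a) S)))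

  module _ (v : Vertex G) where

    -- Each walk is stored with an edge set that contains it. Disjointness of these sets survives
    -- the later shortening of walks to paths.
    data Routes (E : Edge G → Set) : List (Vertex G) → List (Subset (#E G)) → Set where
      []  : Routes E [] []
      _∷_ : ∀ {x xs S Ss} → Walk G S x v × (∀ {e} → e ∈ S → E e) × All (λ S′ → ∀ {e} → e ∈ S → e ∉ S′) Ss →
        Routes E xs Ss → Routes E (x ∷ xs) (S ∷ Ss)

    routes-map : ∀ {E E′ : Edge G → Set} → (∀ {e} → E e → E′ e) → ∀ {xs Ss} → Routes E xs Ss → Routes E′ xs Ss
    routes-map f []                   = []
    routes-map f ((w , i , d) ∷ rs) = (w , (λ e∈ → f (i e∈)) , d) ∷ routes-map f rs

    within : ∀ {E xs Ss} → Routes E xs Ss → All (λ S → ∀ {e} → e ∈ S → E e) Ss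
    within []                 = []
    within ((_ , i , _) ∷ rs) = i ∷ within rs

    -- By balance, a source other than v is the tail of some arc. The route takes that arc and
    -- consumes it, so the number of arcs bounds the recursion; arcs left at the end are discarded.
    decompose : ∀ k xs as → length as ≤ k → Distinct as → Balanced as xs (replicate (length xs) v) →
      ∃[ Ss ] Routes (_∈ˡ used as) xs Ss
    decompose k [] as _ _ _ = [] , []
    decompose k (x ∷ xs) as ≤k dis bal with x Finₚ.≟ v
    ... | yes refl with decompose k xs as ≤k dis (drop-∷ (↭-trans (↭-sym (pull (map tail as) x _))
                          (↭-trans bal (pull (map head as) x xs))))
    ...   | Ss , rs = ⊥ ∷ Ss , (ε , (λ e∈ → ⊥-elim (∉⊥ e∈)) , All.tabulate (λ _ e∈ → ⊥-elim (∉⊥ e∈))) ∷ rs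
    decompose k (x ∷ xs) as ≤k dis bal | no x≢v with ∈-++⁻ (map tail as) (∈-resp-↭ (↭-sym bal) (∈-insert (map head as)))
    ... | inj₂ i = ⊥-elim (x≢v (replicated (suc (length xs)) i))
      where
      replicated : ∀ k {y} → y ∈ˡ replicate k v → y ≡ v
      replicated (suc k) (here p)  = p
      replicated (suc k) (there i) = replicated k i
    ... | inj₁ i with ∈-map⁻ tail i
    ...   | a , a∈ , refl with split a∈
    decompose zero (x ∷ xs) as ≤k dis bal | no x≢v | inj₁ i | a , a∈ , refl | ps , qs , refl
      with subst (_≤ 0) (↭-length (shift a ps qs)) ≤k
    ... | ()
    decompose (suc k) (x ∷ xs) as ≤k dis bal | no x≢v | inj₁ i | a , a∈ , refl | ps , qs , refl
      with distinct-drop ps dis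
    ... | dis′ , clear with decompose k (head a ∷ xs) (ps ++ qs) fits dis′ (remove ps bal)
      where
      fits : length (ps ++ qs) ≤ k
      fits = ℕₚ.≤-pred (subst (_≤ suc k) (↭-length (shift a ps qs)) ≤k)
    ...   | S ∷ Ss , (w , w⊆ , d) ∷ rs = (⁅ edge a ⁆ ∪ S) ∷ Ss
      , ( step (edge a) (x∈p∪q⁺ (inj₁ (x∈⁅x⁆ _))) (joins a) ◅ mapWalk (q⊆p∪q ⁅ edge a ⁆ S) w
        , (λ {e} e∈ → [ (λ j → subst (_∈ˡ used (ps ++ a ∷ qs)) (sym (x∈⁅y⁆⇒x≡y (edge a) j)) (∈-map⁺ edge (∈-insert ps)))
                  , (λ j → keep (w⊆ j)) ]′ (x∈p∪q⁻ ⁅ edge a ⁆ S e∈))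
        , All.zipWith (λ { (S⊆ , S∥) {e} e∈ e∈′ → [ (λ j → fresh (S⊆ e∈′) (x∈⁅y⁆⇒x≡y (edge a) j)) , (λ j → S∥ j e∈′) ]′
            (x∈p∪q⁻ ⁅ edge a ⁆ S e∈) }) (within rs , d)
        ) ∷ routes-map keep rs
      where
      keep : ∀ {e} → e ∈ˡ used (ps ++ qs) → e ∈ˡ used (ps ++ a ∷ qs)
      keep e∈ with ∈-map⁻ edge e∈
      ... | b , b∈ , refl = ∈-map⁺ edge (weaken ps b∈)
      fresh : ∀ {e} → e ∈ˡ used (ps ++ qs) → e ≢ edge a
      fresh e∈ eq with ∈-map⁻ edge e∈
      ... | b , b∈ , refl = All.lookup clear b∈ eq

  module _ (as : List Arc) where

    Reverse : Edge G → Vertex G → Vertex G → Set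
    Reverse e x y = Any (λ a → edge a ≡ e × tail a ≡ y × head a ≡ x) as

    Residual : Rel (Vertex G) 0ℓ
    Residual x y = ∃[ e ] (Joins G e x y × (Clear as e ⊎ Reverse e x y))

    residual? : ∀ x y → Dec (Residual x y)
    residual? x y = any? λ e → joins? G e x y ×-dec
      (All.all? (λ a → ¬? (edge a Finₚ.≟ e)) as ⊎-dec
       Any.any? (λ a → (edge a Finₚ.≟ e) ×-dec ((tail a Finₚ.≟ y) ×-dec (head a Finₚ.≟ x))) as)

    track : ∀ {x y} → Star Residual x y → List (Edge G)
    track ε             = []
    track ((e , _) ◅ w) = e ∷ track w

    ∈-track⇒∈-stops : ∀ {x y} (w : Star Residual x y) {e p q} → e ∈ˡ track w → Joins G e p q → p ∈ˡ (x ∷ stops w)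
    ∈-track⇒∈-stops ((e , j , _) ◅ w) (here refl) j′ =
      Sum.[ here , (λ eq → there (here eq)) ] (joins-functional G j′ j)
    ∈-track⇒∈-stops (_ ◅ w) (there i) j′ = there (∈-track⇒∈-stops w i j′)

    -- The walk is processed from its end. Simplicity keeps the first edge off the remaining track,
    -- and arcs off the track do not change, so the residual status of that edge is still valid when
    -- its turn comes.
    augment : ∀ {x y} (w : Star Residual x y) → Simple w → Distinct as → ∀ {S T} → Balanced as S T →
      ∃[ as′ ] (Distinct as′ × Balanced as′ (x ∷ S) (y ∷ T) ×
        (∀ {a} → edge a ∉ˡ track w → (a ∈ˡ as → a ∈ˡ as′) × (a ∈ˡ as′ → a ∈ˡ as)))
    augment {x} ε _ dis {S} {T} bal = as , dis
      , ↭-trans (pull (map tail as) x T) (↭-trans (prep x bal) (↭-sym (pull (map head as) x S)))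
      , λ _ → id , id
    augment {x} (_◅_ {j = z} (e , j , r) w) (p ∷ s) dis bal with augment w s dis bal
    ... | as′ , dis′ , bal′ , same = extend r
      where
      e∉ : e ∉ˡ track w
      e∉ i = All¬⇒¬Any p (∈-track⇒∈-stops w i j)
      extend : Clear as e ⊎ Reverse e x z → ∃[ as″ ] (Distinct as″ × Balanced as″ _ _ ×
        (∀ {a} → edge a ∉ˡ (e ∷ track w) → (a ∈ˡ as → a ∈ˡ as″) × (a ∈ˡ as″ → a ∈ˡ as)))
      extend (inj₁ clear) = arc e x z j ∷ as′
        , All.tabulate (λ {a} a∈ eq → All.lookup clear (proj₂ (same (λ i → e∉ (subst (_∈ˡ track w) eq i))) a∈) eq) ∷ dis′
        , insert (arc e x z j) bal′
        , λ a∉ → (λ i → there (proj₁ (same (a∉ ∘ there)) i))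
               , λ { (here refl) → ⊥-elim (a∉ (here refl)) ; (there i) → proj₂ (same (a∉ ∘ there)) i }
      extend (inj₂ rev) with find rev
      ... | a , a∈ , refl , refl , refl with split (proj₁ (same e∉) a∈)
      ...   | ps , qs , refl = ps ++ qs , proj₁ (distinct-drop ps dis′) , remove ps bal′
        , λ b∉ → (λ i → [ (λ { refl → ⊥-elim (b∉ (here refl)) }) , id ]′ (strengthen ps (proj₁ (same (b∉ ∘ there)) i)))
               , λ i → proj₂ (same (b∉ ∘ there)) (weaken ps i)

  module _ (u v : Vertex G) where

    IsFlow : ℕ → List Arc → Set
    IsFlow k as = Distinct as × Balanced as (replicate k u) (replicate k v)

    flow : ∀ k → (∀ {S} → u ∈ S → v ∉ S → k ≤ ∣ cut (ends G) S ∣) → ∃ (IsFlow k)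
    flow zero    _ = [] , [] , ↭-refl
    flow (suc k) wide with flow k (λ u∈ v∉ → ℕₚ.≤-trans (ℕₚ.n≤1+n k) (wide u∈ v∉))
    ... | as , dis , bal with Warshall.star? (residual? as) u v
    ...   | yes w with erase w
    ...     | w′ , s with augment as w′ s dis bal
    ...       | as′ , dis′ , bal′ , _ = as′ , dis′ , bal′
    flow (suc k) wide | as , dis , bal | no ¬w = ⊥-elim (ℕₚ.<⇒≱ (wide u∈S v∉S) cut≤k)
      where
      reach? : ∀ x → Dec (Star (Residual as) u x)
      reach? = Warshall.star? (residual? as) u
      S : Subset (#V G)
      S = fromPred reach?
      u∈S : u ∈ S
      u∈S = ∈-fromPred⁺ reach? ε
      v∉S : v ∉ S
      v∉S i = ¬w (∈-fromPred⁻ reach? i)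
      closed : ∀ {x y} → x ∈ S → Residual as x y → y ∈ S
      closed i r = ∈-fromPred⁺ reach? (∈-fromPred⁻ reach? i ◅◅ (r ◅ ε))
      Out : Arc → Set
      Out a = tail a ∈ S × head a ∉ S
      out? : ∀ a → Dec (Out a)
      out? a = (tail a ∈? S) ×-dec ¬? (head a ∈? S)
      noIn : ∀ {a} → a ∈ˡ as → head a ∈ S → tail a ∈ S
      noIn {a} a∈ i = closed i (edge a , Sum.swap (joins a) , inj₂ (lose a∈ (refl , refl , refl)))
      cnt : List (Vertex G) → ℕ
      cnt xs = length (filter (_∈? S) xs)
      cnt-++ : ∀ xs ys → cnt (xs ++ ys) ≡ cnt xs + cnt ys
      cnt-++ []       ys = refl
      cnt-++ (x ∷ xs) ys with x ∈? S
      ... | yes _ = cong suc (cnt-++ xs ys)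
      ... | no _  = cnt-++ xs ys
      cnt-u : ∀ k → cnt (replicate k u) ≡ k
      cnt-u zero    = refl
      cnt-u (suc k) with u ∈? S
      ... | yes _ = cong suc (cnt-u k)
      ... | no u∉ = ⊥-elim (u∉ u∈S)
      cnt-v : ∀ k → cnt (replicate k v) ≡ 0
      cnt-v zero    = refl
      cnt-v (suc k) with v ∈? S
      ... | yes v∈ = ⊥-elim (v∉S v∈)
      ... | no _   = cnt-v k
      count-out : ∀ bs → (∀ {a} → a ∈ˡ bs → head a ∈ S → tail a ∈ S) →
        cnt (map tail bs) ≡ cnt (map head bs) + length (filter out? bs)
      count-out []       _ = refl
      count-out (b ∷ bs) f with tail b ∈? S | head b ∈? S
      ... | yes _ | yes _ = cong suc (count-out bs (f ∘ there))
      ... | yes _ | no  _ = trans (cong suc (count-out bs (f ∘ there))) (sym (ℕₚ.+-suc _ _))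
      ... | no ¬t | yes h = ⊥-elim (¬t (f (here refl) h))
      ... | no _  | no  _ = count-out bs (f ∘ there)
      -- Members of S are counted on both sides of `bal`: all k sources are in S, and no sink is.
      out≡k : length (filter out? as) ≡ k
      out≡k = ℕₚ.+-cancelˡ-≡ (cnt (map head as)) _ _ (begin
        cnt (map head as) + length (filter out? as) ≡⟨ sym (count-out as noIn) ⟩
        cnt (map tail as)                           ≡⟨ sym (ℕₚ.+-identityʳ _) ⟩
        cnt (map tail as) + 0                       ≡⟨ cong (cnt (map tail as) +_) (sym (cnt-v k)) ⟩
        cnt (map tail as) + cnt (replicate k v)     ≡⟨ sym (cnt-++ (map tail as) _) ⟩
        cnt (map tail as ++ replicate k v)          ≡⟨ ↭-length (filter-↭ (_∈? S) bal) ⟩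
        cnt (map head as ++ replicate k u)          ≡⟨ cnt-++ (map head as) _ ⟩
        cnt (map head as) + cnt (replicate k u)     ≡⟨ cong (cnt (map head as) +_) (cnt-u k) ⟩
        cnt (map head as) + k ∎)
        where open ≡-Reasoning
      carried : ∀ {e} → e ∈ cut (ends G) S → e ∈ˡ used (filter out? as)
      carried {e} e∈ with ends-across (ends G) e∈
      ... | x , y , l , x∈ , y∉ with Any.any? (λ a → edge a Finₚ.≟ e) as
      ...   | no ¬a = ⊥-elim (y∉ (closed x∈ (e , l , inj₁ (¬Any⇒All¬ as ¬a))))
      ...   | yes any with find any
      ...     | a , a∈ , refl with tail a ∈? S | head a ∈? S
      ...       | yes t | no h  = ∈-map⁺ edge (∈-filter⁺ out? a∈ (t , h))
      ...       | no ¬t | yes h = ⊥-elim (¬t (noIn a∈ h))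
      ...       | yes t | yes h = ⊥-elim ([ (λ (_ , q) → q h) , (λ (_ , q) → q t) ]′ (cut-at (ends G) (joins a) e∈))
      ...       | no ¬t | no ¬h = ⊥-elim ([ (λ (q , _) → ¬t q) , (λ (q , _) → ¬h q) ]′ (cut-at (ends G) (joins a) e∈))
      cut≤k : ∣ cut (ends G) S ∣ ≤ k
      cut≤k = subst (∣ cut (ends G) S ∣ ≤_) (trans (length-map edge (filter out? as)) out≡k) (card-list carried)

    three-routes : ∀ {E Ss} → Routes v E (u ∷ u ∷ u ∷ []) Ss → ThreeEdgeConnected G u v
    three-routes ((p , _ , (pq ∷ pr ∷ [])) ∷ ((q , _ , (qr ∷ [])) ∷ ((r , _ , []) ∷ []))) =
      inj₂ (proj₁ p′ , proj₁ q′ , proj₁ r′ , (proj₁ (proj₂ p′) , proj₁ (proj₂ q′) , proj₁ (proj₂ r′))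
        , (λ (i , j) → pq (proj₂ (proj₂ p′) i) (proj₂ (proj₂ q′) j))
        , (λ (i , j) → pr (proj₂ (proj₂ p′) i) (proj₂ (proj₂ r′) j))
        , (λ (i , j) → qr (proj₂ (proj₂ q′) i) (proj₂ (proj₂ r′) j)))
      where
      p′ = pathIn p
      q′ = pathIn q
      r′ = pathIn r

    menger₃ : (∀ {S} → u ∈ S → v ∉ S → 3 ≤ ∣ cut (ends G) S ∣) → ThreeEdgeConnected G u v
    menger₃ wide = carry (flow 3 wide)
      where
      carry : ∃ (IsFlow 3) → ThreeEdgeConnected G u v
      carry (as , dis , bal) = three-routes (proj₂ (decompose v (length as) (u ∷ u ∷ u ∷ []) as ℕₚ.≤-refl dis bal))

-- Three-edge-connected classes

module Components (G : Graph) where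

  private
    en : Ends (#E G) (#V G)
    en = ends G

  inside? : ∀ X e → Dec (src en e ∈ X × tgt en e ∈ X)
  inside? X e = (src en e ∈? X) ×-dec (tgt en e ∈? X)

  within : Subset (#V G) → Subset (#E G)
  within X = fromPred (inside? X)

  within-link : ∀ {X e x y} → e ∈ within X → Link en e x y → x ∈ X × y ∈ X
  within-link {X} e∈ (inj₁ eq) rewrite sym (cong proj₁ eq) | sym (cong proj₂ eq) = ∈-fromPred⁻ (inside? X) e∈
  within-link {X} e∈ (inj₂ eq) rewrite sym (cong proj₁ eq) | sym (cong proj₂ eq) = swap (∈-fromPred⁻ (inside? X) e∈)

  link-within : ∀ {X e x y} → Link en e x y → x ∈ X → y ∈ X → e ∈ within X
  link-within {X} (inj₁ eq) x∈ y∈ rewrite sym (cong proj₁ eq) | sym (cong proj₂ eq) = ∈-fromPred⁺ (inside? X) (x∈ , y∈)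
  link-within {X} (inj₂ eq) x∈ y∈ rewrite sym (cong proj₁ eq) | sym (cong proj₂ eq) = ∈-fromPred⁺ (inside? X) (y∈ , x∈)

  within-mono : ∀ {X Y} → X ⊆ Y → within X ⊆ within Y
  within-mono {X} {Y} f e∈ = let p , q = ∈-fromPred⁻ (inside? X) e∈ in ∈-fromPred⁺ (inside? Y) (f p , f q)

  walk-stays : ∀ {X x y} → Walk G (within X) x y → x ∈ X → y ∈ X
  walk-stays ε                x∈ = x∈
  walk-stays (step e a j ◅ w) x∈ = walk-stays w (proj₂ (within-link a j))

  opaque
    comp : Subset (#E G) → Vertex G → Subset (#V G)
    comp S v = fromPred (walk? G S v)

    comp⁺ : ∀ {S v x} → Walk G S v x → x ∈ comp S v
    comp⁺ {S} {v} = ∈-fromPred⁺ (walk? G S v)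

    comp⁻ : ∀ {S v x} → x ∈ comp S v → Walk G S v x
    comp⁻ {S} {v} = ∈-fromPred⁻ (walk? G S v)

  Connected : Subset (#V G) → Vertex G → Set
  Connected M v = ∀ {x} → x ∈ M → Walk G (within M) v x

  module Trim (X : Subset (#V G)) (v : Vertex G) (v∈X : v ∈ X) where

    part : Subset (#V G)
    part = comp (within X) v

    part⊆ : part ⊆ X
    part⊆ x∈ = walk-stays (comp⁻ x∈) v∈X

    part-connected : Connected part v
    part-connected x∈ = go (comp⁺ ε) (comp⁻ x∈)
      where
      go : ∀ {y x} → y ∈ part → Walk G (within X) y x → Walk G (within part) y x
      go y∈ ε                = ε
      go y∈ (step e a j ◅ w) = step e (link-within j y∈ z∈) j ◅ go z∈ w
        where z∈ = comp⁺ (comp⁻ y∈ ◅◅ (step e a j ◅ ε))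

    -- An edge leaving the component but not X would extend the component. So thin sets can be made
    -- connected and stay thin.
    cut-part : cut en part ⊆ cut en X
    cut-part e∈ with ends-across en e∈
    ... | x , y , l , x∈ , y∉ = across-link en l (part⊆ x∈) λ y∈X →
      y∉ (comp⁺ (comp⁻ x∈ ◅◅ (step _ (link-within l (part⊆ x∈) y∈X) l ◅ ε)))

  -- The edge e joins A to B: it is counted in both cuts and lies inside the union.
  cut-join : ∀ {A B e} → Apart A B → e ∈ cut en A → e ∈ cut en B →
    2 + ∣ cut en (A ∪ B) ∣ ≤ ∣ cut en A ∣ + ∣ cut en B ∣
  cut-join {A} {B} {e} A∥B e∈A e∈B = card-drop₂ f e∉ e∈A e∈B
    where
    f : ∀ {i} → i ∈ cut en (A ∪ B) → i ∈ cut en A ⊎ i ∈ cut en B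
    f i∈ with ends-across en i∈
    ... | x , y , l , x∈ , y∉ with x∈p∪q⁻ A B x∈
    ...   | inj₁ x∈A = inj₁ (across-link en l x∈A λ y∈ → y∉ (x∈p∪q⁺ (inj₁ y∈)))
    ...   | inj₂ x∈B = inj₂ (across-link en l x∈B λ y∈ → y∉ (x∈p∪q⁺ (inj₂ y∈)))
    e∉ : e ∉ cut en (A ∪ B)
    e∉ e∈ with ends-across en e∈A
    ... | x , y , l , x∈ , y∉ with cut-at en l e∈B
    ...   | inj₁ (x∈B , _) = A∥B x∈ x∈B
    ...   | inj₂ (y∈B , _) with cut-at en l e∈
    ...     | inj₁ (_ , y∉∪) = y∉∪ (x∈p∪q⁺ (inj₂ y∈B))
    ...     | inj₂ (_ , x∉∪) = x∉∪ (x∈p∪q⁺ (inj₁ x∈))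

  Thin : Subset (#V G) → Set
  Thin X = ∣ cut en X ∣ ≤ 2

  thin-join : ∀ {A B e} → Apart A B → e ∈ cut en A → e ∈ cut en B → Thin A → Thin B → Thin (A ∪ B)
  thin-join A∥B i j tA tB = ℕₚ.+-cancelˡ-≤ 2 _ _ (ℕₚ.≤-trans (cut-join A∥B i j) (ℕₚ.+-mono-≤ tA tB))

  -- Posimodularity makes M ─ S or S ─ M thin; as M is connected and has an
  -- edge to S ─ M, either difference has an edge to the rest of the union.
  thin-union : ∀ {M S v e x y} → v ∈ M → Connected M v → Thin M → Thin S →
    Link en e x y → x ∈ M → y ∉ M → y ∈ S → Thin (M ∪ S)
  thin-union {M} {S} {v} {e} {x} {y} v∈ conn tM tS l x∈M y∉M y∈S with nonempty? (M ∩ ∁ S)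
  ... | no e′ = subst Thin (⊆-antisym (λ i → x∈p∪q⁺ (inj₂ i)) λ i → [ M⊆S , id ]′ (x∈p∪q⁻ M S i)) tS
    where
    M⊆S : M ⊆ S
    M⊆S {z} z∈ with z ∈? S
    ... | yes i = i
    ... | no  i = ⊥-elim (e′ (z , x∈p∩q⁺ (z∈ , x∉p⇒x∈∁p i)))
  ... | yes (z , z∈) with ∣ cut en (M ∩ ∁ S) ∣ ≤? 2
  ...   | yes t = subst Thin (⊆-antisym to from) (thin-join (λ i j → x∈∁p⇒x∉p (proj₂ (x∈p∩q⁻ M (∁ S) i)) j)
            (proj₁ (proj₂ bridge)) (proj₂ (proj₂ bridge)) t tS)
    where
    to : (M ∩ ∁ S) ∪ S ⊆ M ∪ S
    to i = x∈p∪q⁺ (Sum.map₁ (λ j → proj₁ (x∈p∩q⁻ M (∁ S) j)) (x∈p∪q⁻ (M ∩ ∁ S) S i))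
    from : M ∪ S ⊆ (M ∩ ∁ S) ∪ S
    from {i} i∈ with i ∈? S | x∈p∪q⁻ M S i∈
    ... | yes q | _      = x∈p∪q⁺ (inj₂ q)
    ... | no  q | inj₁ p = x∈p∪q⁺ (inj₁ (x∈p∩q⁺ (p , x∉p⇒x∈∁p q)))
    ... | no  q | inj₂ p = ⊥-elim (q p)
    bridge : ∃[ f ] (f ∈ cut en (M ∩ ∁ S) × f ∈ cut en S)
    bridge with x ∈? S
    ... | no x∉S = e , across-link en l (x∈p∩q⁺ (x∈M , x∉p⇒x∈∁p x∉S)) (λ i → y∉M (proj₁ (x∈p∩q⁻ M (∁ S) i)))
                     , across-link en (Sum.swap l) y∈S x∉S
    ... | yes x∈S with walk-crosses (revWalk (conn x∈M) ◅◅ conn (proj₁ (x∈p∩q⁻ M (∁ S) z∈))) x∈S (x∈∁p⇒x∉p (proj₂ (x∈p∩q⁻ M (∁ S) z∈)))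
    ...   | f , _ , f∈M , f∈S with ends-across en f∈S
    ...     | p , q , k , p∈S , q∉S = f , across-link en (Sum.swap k) (x∈p∩q⁺ (proj₂ (within-link f∈M k) , x∉p⇒x∈∁p q∉S))
                (λ i → x∈∁p⇒x∉p (proj₂ (x∈p∩q⁻ M (∁ S) i)) p∈S) , f∈S
  ...   | no ¬t = subst Thin (⊆-antisym to from) (thin-join (λ i j → x∈∁p⇒x∉p (proj₂ (x∈p∩q⁻ S (∁ M) j)) i)
            (across-link en l x∈M y∉M) (across-link en (Sum.swap l) (x∈p∩q⁺ (y∈S , x∉p⇒x∈∁p y∉M)) (λ i → x∈∁p⇒x∉p (proj₂ (x∈p∩q⁻ S (∁ M) i)) x∈M)) tM t)
    where
    to : M ∪ (S ∩ ∁ M) ⊆ M ∪ S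
    to i = x∈p∪q⁺ (Sum.map₂ (λ j → proj₁ (x∈p∩q⁻ S (∁ M) j)) (x∈p∪q⁻ M (S ∩ ∁ M) i))
    from : M ∪ S ⊆ M ∪ (S ∩ ∁ M)
    from {i} i∈ with i ∈? M | x∈p∪q⁻ M S i∈
    ... | yes q | _      = x∈p∪q⁺ (inj₁ q)
    ... | no  q | inj₂ p = x∈p∪q⁺ (inj₂ (x∈p∩q⁺ (p , x∉p⇒x∈∁p q)))
    ... | no  q | inj₁ p = ⊥-elim (q p)
    deMorgan : ∁ (S ∩ ∁ M) ≡ ∁ S ∪ M
    deMorgan = ⊆-antisym
      (λ {i} i∈ → case i ∈? M of λ
        { (yes q) → x∈p∪q⁺ (inj₂ q)
        ; (no q)  → x∈p∪q⁺ (inj₁ (x∉p⇒x∈∁p λ p → x∈∁p⇒x∉p i∈ (x∈p∩q⁺ (p , x∉p⇒x∈∁p q)))) })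
      (λ i∈ → x∉p⇒x∈∁p λ j → let p , q = x∈p∩q⁻ S (∁ M) j in
        [ (λ k → x∈∁p⇒x∉p k p) , x∈∁p⇒x∉p q ]′ (x∈p∪q⁻ (∁ S) M i∈))
    t : Thin (S ∩ ∁ M)
    -- Submodularity for M and ∁ S is posimodularity for M and S. Of the four edges available, M ─ S
    -- takes at least three.
    t = ℕₚ.≤-trans (ℕₚ.+-cancelˡ-≤ 3 _ _ (begin
      3 + ∣ cut en (S ∩ ∁ M) ∣                          ≤⟨ ℕₚ.+-monoˡ-≤ _ (ℕₚ.≰⇒> ¬t) ⟩
      ∣ cut en (M ∩ ∁ S) ∣ + ∣ cut en (S ∩ ∁ M) ∣       ≡⟨ cong (λ c → ∣ cut en (M ∩ ∁ S) ∣ + ∣ c ∣)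
                                                             (trans (sym (cut-∁ en (S ∩ ∁ M))) (cong (cut en) deMorgan)) ⟩
      ∣ cut en (M ∩ ∁ S) ∣ + ∣ cut en (∁ S ∪ M) ∣       ≤⟨ cut-submodular en M (∁ S) ⟩
      ∣ cut en M ∣ + ∣ cut en (∁ S) ∣                   ≡⟨ cong (λ c → ∣ cut en M ∣ + ∣ c ∣) (cut-∁ en S) ⟩
      ∣ cut en M ∣ + ∣ cut en S ∣                       ≤⟨ ℕₚ.+-mono-≤ tM tS ⟩
      4 ∎)) (s≤s z≤n)
      where open ℕₚ.≤-Reasoning

module Class (G : Graph) (r : Vertex G) where

  open Components G

  private
    en : Ends (#E G) (#V G)
    en = ends G

  Separated : Vertex G → Vertex G → Set
  Separated u v = ∃[ S ] (Thin S × u ∈ S × v ∉ S)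

  separated? : ∀ u v → Dec (Separated u v)
  separated? u v = anySubset? λ S → (∣ cut en S ∣ ≤? 2) ×-dec ((u ∈? S) ×-dec ¬? (v ∈? S))

  separated-sym : ∀ {u v} → Separated u v → Separated v u
  separated-sym (S , t , u∈ , v∉) = ∁ S , subst (λ c → ∣ c ∣ ≤ 2) (sym (cut-∁ en S)) t , x∉p⇒x∈∁p v∉ , x∈p⇒x∉∁p u∈

  opaque
    R : Subset (#V G)
    R = fromPred λ v → ¬? (separated? r v)

    R⁻ : ∀ {v} → v ∈ R → ¬ Separated r v
    R⁻ = ∈-fromPred⁻ λ v → ¬? (separated? r v)

    R⁺ : ∀ {v} → ¬ Separated r v → v ∈ R
    R⁺ = ∈-fromPred⁺ λ v → ¬? (separated? r v)

  r∈R : r ∈ R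
  r∈R = R⁺ λ (_ , _ , r∈ , r∉) → r∉ r∈

  -- Wherever r lies, a thin cut between u and v separates it from one of the two.
  R-inseparable : ∀ {u v} → u ∈ R → v ∈ R → ¬ Separated u v
  R-inseparable u∈ v∈ (S , t , u∈S , v∉S) with r ∈? S
  ... | yes r∈ = R⁻ v∈ (S , t , r∈ , v∉S)
  ... | no  r∉ = R⁻ u∈ (separated-sym (S , t , u∈S , r∉))

  R-3ec : ThreeEdgeConnectedSet G R
  R-3ec u∈ v∈ = Flow.menger₃ G _ _ λ {S} u∈S v∉S → case 3 ≤? ∣ cut en S ∣ of λ
    { (yes p) → p ; (no p) → ⊥-elim (R-inseparable u∈ v∈ (S , ℕₚ.≤-pred (ℕₚ.≰⇒> p) , u∈S , v∉S)) }

  thin-outside : ∀ {v} → v ∉ R → ∃[ S ] (Thin S × v ∈ S × Apart S R)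
  thin-outside {v} v∉ with separated? r v
  ... | no ¬s = ⊥-elim (v∉ (R⁺ ¬s))
  ... | yes (S , t , r∈ , v∉S) = ∁ S , subst (λ c → ∣ c ∣ ≤ 2) (sym (cut-∁ en S)) t , x∉p⇒x∈∁p v∉S
    , λ x∈ x∈R → R⁻ x∈R (S , t , r∈ , x∈∁p⇒x∉p x∈)

  module _ {v : Vertex G} (v∉R : v ∉ R) where

    -- While an edge leads from M to some y outside M and R, a thin set around y is added;
    -- `thin-union` keeps the result thin and trimming keeps it connected. The number k bounds the
    -- vertices outside M. At the end M is a component of G - R, whence `D-thin`.
    grow : ∀ k M → #V G ≤ k + ∣ M ∣ → v ∈ M → Thin M → Apart M R → Connected M v →
      ∃[ M ] (v ∈ M × Thin M × Apart M R × Connected M v × (∀ {e x y} → Link en e x y → x ∈ M → y ∉ R → y ∈ M))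
    grow k M n≤ v∈ t M∥R conn with any? (λ e → any? λ x → any? λ y →
      joins? G e x y ×-dec ((x ∈? M) ×-dec (¬? (y ∈? M) ×-dec ¬? (y ∈? R))))
    ... | no none = M , v∈ , t , M∥R , conn , λ {e} {x} {y} l x∈ y∉R → case y ∈? M of λ
      { (yes y∈) → y∈ ; (no y∉) → ⊥-elim (none (e , x , y , l , x∈ , y∉ , y∉R)) }
    ... | yes (e , x , y , l , x∈ , y∉M , y∉R) with thin-outside y∉R
    ...   | S , tS , y∈S , S∥R = continue k n≤
      where
      v∈′ : v ∈ M ∪ S
      v∈′ = x∈p∪q⁺ (inj₁ v∈)
      open Trim (M ∪ S) v v∈′
      M⊆part : M ⊆ part
      M⊆part i = comp⁺ (mapWalk (within-mono (p⊆p∪q S)) (conn i))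
      y∈part : y ∈ part
      y∈part = comp⁺ (comp⁻ (M⊆part x∈) ◅◅ (step e (link-within l (x∈p∪q⁺ (inj₁ x∈)) (x∈p∪q⁺ (inj₂ y∈S))) l ◅ ε))
      bigger : ∣ M ∣ < ∣ part ∣
      bigger = p⊂q⇒∣p∣<∣q∣ (M⊆part , y , y∈part , y∉M)
      continue : ∀ k → #V G ≤ k + ∣ M ∣ → _
      continue zero n≤ = ⊥-elim (ℕₚ.<-irrefl refl (ℕₚ.<-≤-trans bigger (ℕₚ.≤-trans (∣p∣≤n part) n≤)))
      continue (suc k) n≤ = grow k part
        (ℕₚ.≤-trans n≤ (ℕₚ.≤-trans (ℕₚ.≤-reflexive (sym (ℕₚ.+-suc k ∣ M ∣))) (ℕₚ.+-monoʳ-≤ k bigger)))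
        (comp⁺ ε) (ℕₚ.≤-trans (p⊆q⇒∣p∣≤∣q∣ cut-part) (thin-union v∈ conn t tS l x∈ y∉M y∈S))
        (λ i → [ M∥R , S∥R ]′ (x∈p∪q⁻ M S (part⊆ i))) part-connected

    grown : ∃[ M ] (v ∈ M × Thin M × Apart M R × Connected M v × (∀ {e x y} → Link en e x y → x ∈ M → y ∉ R → y ∈ M))
    grown with thin-outside v∉R
    ... | S , t , v∈S , S∥R = grow (#V G) part (ℕₚ.m≤m+n (#V G) ∣ part ∣) (comp⁺ ε)
        (ℕₚ.≤-trans (p⊆q⇒∣p∣≤∣q∣ cut-part) t) (λ i → S∥R (part⊆ i)) part-connected
      where open Trim S v v∈S

  -- The component of v in G − R; for v ∈ R this is {v}.
  D : Vertex G → Subset (#V G)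
  D v = comp (within (∁ R)) v

  v∈D : ∀ {v} → v ∈ D v
  v∈D = comp⁺ ε

  module _ {v : Vertex G} (v∉R : v ∉ R) where

    D-apart : Apart (D v) R
    D-apart x∈ = x∈∁p⇒x∉p (walk-stays (comp⁻ x∈) (x∉p⇒x∈∁p v∉R))

    D-closed : ∀ {e x y} → Link en e x y → x ∈ D v → y ∉ R → y ∈ D v
    D-closed l x∈ y∉R = comp⁺ (comp⁻ x∈ ◅◅ (step _ (link-within l (x∉p⇒x∈∁p (D-apart x∈)) (x∉p⇒x∈∁p y∉R)) l ◅ ε))

    D-thin : Thin (D v)
    D-thin with grown v∉R
    ... | M , v∈M , t , M∥R , conn , closed = subst Thin (⊆-antisym to from) t
      where
      to : M ⊆ D v
      to x∈ = comp⁺ (mapWalk (within-mono λ i → x∉p⇒x∈∁p (M∥R i)) (conn x∈))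
      go : ∀ {y x} → y ∈ M → Walk G (within (∁ R)) y x → x ∈ M
      go y∈ ε                = y∈
      go y∈ (step e a j ◅ w) = go (closed j y∈ (x∈∁p⇒x∉p (proj₂ (within-link a j)))) w
      from : D v ⊆ M
      from x∈ = go v∈M (comp⁻ x∈)

    D-connected : Connected (D v) v
    D-connected = Trim.part-connected (∁ R) v (x∉p⇒x∈∁p v∉R)

  D-≡ : ∀ {x v} → x ∈ D v → D x ≡ D v
  D-≡ x∈ = ⊆-antisym (λ y∈ → comp⁺ (comp⁻ x∈ ◅◅ comp⁻ y∈)) (λ y∈ → comp⁺ (revWalk (comp⁻ x∈) ◅◅ comp⁻ y∈))

-- Brambles in torsos

minimum : ∀ {P : ℕ → Set} → (∀ k → Dec (P k)) → ∀ N → (∀ {k} → P k → k ≤ N) → ∃ (IsMinimum P)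
minimum {P} P? N bounded = go (suc N) 0 (ℕₚ.+-identityʳ (suc N)) (λ _ → z≤n)
  where
  go : ∀ k j → k + j ≡ suc N → (∀ {i} → P i → j ≤ i) → ∃ (IsMinimum P)
  go zero    j eq low = ⊤⁺ , λ p → ℕₚ.<⇒≱ (s≤s (bounded p)) (subst (_≤ _) eq (low p))
  go (suc k) j eq low with P? j
  ... | yes p = [ j ] , p , low
  ... | no ¬p = go k (suc j) (trans (ℕₚ.+-suc k j) eq) λ {i} q →
    ℕₚ.≤∧≢⇒< (low q) λ { refl → ¬p q }

minimum≥ : ∀ {P : ℕ → Set} {o b} → IsMinimum P o → (∀ {k} → P k → b ≤ k) → [ b ] ≤⁺ o
minimum≥ {o = [ k ]} (p , _) f = [ f p ]
minimum≥ {o = ⊤⁺}    _       f = _ ≤⊤⁺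

≥minimum : ∀ {P : ℕ → Set} {o b} → IsMinimum P o → [ b ] ≤⁺ o → ∀ {k} → P k → b ≤ k
≥minimum {o = [ _ ]} (_ , low) [ b≤ ] p = ℕₚ.≤-trans b≤ (low p)
≥minimum {o = ⊤⁺}    none      _      p = ⊥-elim (none p)

module _ {G : Graph} where

  disconnects? : ∀ F (s : Slab G) → Dec (Disconnects F s)
  disconnects? F s = any? λ u → any? λ v → (u ∈? core) ×-dec ((v ∈? core) ×-dec ¬? (walk? G (EH ─ (F ∩ EH)) u v))
    where open Slab s

  bramble≥ : ∀ (B : Bramble G) {a b} → (∀ {F} → DisconnectingSet B F → a ≤ ∣ F ∣) →
    (∀ {s} → s ∈ˡ Bramble.slabs B → b ≤ ∣ Slab.core s ∣) → HasBramble≥ G a b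
  bramble≥ B {a} {b} adh bag =
    B , proj₁ o , proj₁ o′ , proj₂ o , proj₂ o′
      , minimum≥ (proj₂ o) (λ { (F , d , refl) → adh d }) , minimum≥ (proj₂ o′) (λ { (s , i , refl) → bag i })
    where
    o = minimum (λ k → anySubset? λ F → All.all? (disconnects? F) (Bramble.slabs B) ×-dec (∣ F ∣ ℕₚ.≟ k))
          (#E G) (λ { (F , _ , refl) → ∣p∣≤n F })
    o′ = minimum (λ k → map′ find (λ (_ , i , p) → lose i p)
            (Any.any? (λ s → ∣ Slab.core s ∣ ℕₚ.≟ k) (Bramble.slabs B)))
          (#V G) (λ { (s , _ , refl) → ∣p∣≤n (Slab.core s) })

module Torso (G : Graph) (r : Vertex G) where

  open Components G
  open Class G r public

  private
    en : Ends (#E G) (#V G)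
    en = ends G

  -- Preferring r makes π send to r the only component of G − R that can have
  -- edges to R and yet leave A, see anchor⇒π≡r.
  opaque
    pick : Subset (#V G) → Vertex G
    pick X with any? (λ e → (e ∈? cut en X) ×-dec incident? G r e)
    ... | yes _ = r
    ... | no  _ with any? (λ e → e ∈? cut en X)
    ...   | no  _             = r
    ...   | yes (e , _) with src en e ∈? X
    ...     | yes _ = tgt en e
    ...     | no  _ = src en e

    pick-spec : ∀ {X} → r ∉ X → (pick X ≡ r × (∀ {e} → e ∉ cut en X)) ⊎
      (∃₂ λ e x → Link en e x (pick X) × x ∈ X × pick X ∉ X)
    pick-spec {X} r∉X with any? (λ e → (e ∈? cut en X) ×-dec incident? G r e)
    ... | yes (e , e∈ , inc) with ends-across en e∈
    ...   | x , y , l , x∈ , y∉ = inj₂ (e , x , subst (Link en e x) y≡r l , x∈ , r∉X)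
      where
      y≡r : y ≡ r
      y≡r = agree l inc
        where
        agree : Link en e x y → Incident G r e → y ≡ r
        agree (inj₁ eq) (inj₁ p) = ⊥-elim (r∉X (subst (_∈ X) (trans (sym (cong proj₁ eq)) p) x∈))
        agree (inj₁ eq) (inj₂ p) = trans (sym (cong proj₂ eq)) p
        agree (inj₂ eq) (inj₁ p) = trans (sym (cong proj₁ eq)) p
        agree (inj₂ eq) (inj₂ p) = ⊥-elim (r∉X (subst (_∈ X) (trans (sym (cong proj₂ eq)) p) x∈))
    pick-spec {X} r∉X | no _ with any? (λ e → e ∈? cut en X)
    ... | no none = inj₁ (refl , λ e∈ → none (_ , e∈))
    ... | yes (e , e∈) with src en e ∈? X | ∈-cut⁻ en e∈
    ...   | yes u∈ | inj₁ (_ , v∉) = inj₂ (e , _ , inj₁ refl , u∈ , v∉)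
    ...   | yes u∈ | inj₂ (u∉ , _) = ⊥-elim (u∉ u∈)
    ...   | no u∉  | inj₁ (u∈ , _) = ⊥-elim (u∉ u∈)
    ...   | no u∉  | inj₂ (_ , v∈) = inj₂ (e , _ , inj₂ refl , v∈ , u∉)

    pick-prefers : ∀ {X e} → e ∈ cut en X → Incident G r e → pick X ≡ r
    pick-prefers {X} e∈ inc with any? (λ e → (e ∈? cut en X) ×-dec incident? G r e)
    ... | yes _ = refl
    ... | no  n = ⊥-elim (n (_ , e∈ , inc))

  -- The retraction onto R that sends each component of G − R to one of its
  -- at most two neighbours; contracting along it yields the torso of R.
  opaque
    π : Vertex G → Vertex G
    π v with v ∈? R
    ... | yes _ = v
    ... | no  _ = pick (D v)

    π-R : ∀ {v} → v ∈ R → π v ≡ v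
    π-R {v} v∈ with v ∈? R
    ... | yes _ = refl
    ... | no v∉ = ⊥-elim (v∉ v∈)

    π-D : ∀ {v} → v ∉ R → π v ≡ pick (D v)
    π-D {v} v∉ with v ∈? R
    ... | yes v∈ = ⊥-elim (v∉ v∈)
    ... | no _   = refl

  r∉D : ∀ {v} → v ∉ R → r ∉ D v
  r∉D v∉ r∈ = D-apart v∉ r∈ r∈R

  pick∈R : ∀ {v} → v ∉ R → pick (D v) ∈ R
  pick∈R {v} v∉ with pick-spec (r∉D v∉)
  ... | inj₁ (eq , _) = subst (_∈ R) (sym eq) r∈R
  ... | inj₂ (e , x , l , x∈ , p∉) with pick (D v) ∈? R
  ...   | yes p∈ = p∈
  ...   | no p∉R = ⊥-elim (p∉ (D-closed v∉ l x∈ p∉R))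

  opaque
    unfolding π

    π∈R : ∀ v → π v ∈ R
    π∈R v with v ∈? R
    ... | yes v∈ = v∈
    ... | no v∉  = pick∈R v∉

  D∉R : ∀ {x v} → v ∉ R → x ∈ D v → x ∉ R
  D∉R v∉ x∈ = D-apart v∉ x∈

  π-≡ : ∀ {x v} → v ∉ R → x ∈ D v → π x ≡ π v
  π-≡ v∉ x∈ = trans (π-D (D∉R v∉ x∈)) (trans (cong pick (D-≡ x∈)) (sym (π-D v∉)))

  torso : Ends (#E G) (#V G)
  torso e = π (src en e) , π (tgt en e)

  torso∈R : ∀ e → proj₁ (torso e) ∈ R × proj₂ (torso e) ∈ R
  torso∈R e = π∈R (src en e) , π∈R (tgt en e)

  module Contract (F : Subset (#E G)) where

    W : Vertex G → Vertex G → Set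
    W = Walk G (∁ F)

    unjoined? : ∀ e → Dec (¬ W (π (src en e)) (π (tgt en e)))
    unjoined? e = ¬? (walk? G (∁ F) (π (src en e)) (π (tgt en e)))

    -- The torso edges that run between components of G - F. Contraction has moved their ends, so
    -- they need not belong to F.
    unjoined : Subset (#E G)
    unjoined = fromPred unjoined?

    Touches : Subset (#V G) → Edge G → Set
    Touches X e = src en e ∈ X ⊎ tgt en e ∈ X

    link-touches : ∀ {X e x y} → Link en e x y → x ∈ X → Touches X e
    link-touches l x∈ = Sum.map (λ eq → subst (_∈ _) (sym eq) x∈) (λ eq → subst (_∈ _) (sym eq) x∈) (link-end en l)

    -- An edge within R pays for itself. An edge between R and a component of G - R is paid for by
    -- an edge of F touching that component, which is injective because a component has at most one
    -- unjoined edge.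
    Charge : Edge G → Edge G → Set
    Charge e f = (e ≡ f × src en e ∈ R × tgt en e ∈ R) ⊎ (∃[ v ] (v ∉ R × e ∈ cut en (D v) × Touches (D v) f))

    free : ∀ {f} → f ∉ F → f ∈ ∁ F
    free = x∉p⇒x∈∁p

    -- If F misses the component D u and all its edges to R, a walk outside F
    -- runs through D u from π u to q.
    charge-component : ∀ {e u q} → Link en e u q → u ∉ R → q ∈ R → ¬ W (π u) (π q) →
      ∃[ f ] (f ∈ F × Touches (D u) f)
    charge-component {e} {u} {q} l u∉ q∈ ¬w with any? (λ f → (f ∈? F) ×-dec ((src en f ∈? D u) ⊎-dec (tgt en f ∈? D u)))
    ... | yes p = p
    ... | no none = ⊥-elim (¬w (subst₂ W (sym (π-D u∉)) (sym (π-R q∈)) (start (pick-spec (r∉D u∉)))))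
      where
      miss : ∀ {f} → Touches (D u) f → f ∈ ∁ F
      miss t = free λ f∈ → none (_ , f∈ , t)
      e∈ : e ∈ cut en (D u)
      e∈ = across-link en l v∈D λ q∈D → D-apart u∉ q∈D q∈
      through : ∀ {x} → x ∈ D u → W x q
      through x∈ = mapWalk (λ f∈ → miss (inj₁ (proj₁ (∈-fromPred⁻ (inside? (D u)) f∈)))) (revWalk (D-connected u∉ x∈))
        ◅◅ (step e (miss (link-touches l v∈D)) l ◅ ε)
      start : _ → W (pick (D u)) q
      start (inj₁ (_ , none′)) = ⊥-elim (none′ e∈)
      start (inj₂ (f , x , k , x∈ , _)) = step f (miss (link-touches k x∈)) (Sum.swap k) ◅ through x∈

    charge : ∀ {e} → e ∈ unjoined → ∃[ f ] (f ∈ F × Charge e f)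
    charge {e} e∈ with ∈-fromPred⁻ unjoined? e∈ | src en e ∈? R | tgt en e ∈? R
    ... | ¬w | no u∉  | no v∉ = ⊥-elim (¬w (subst (W _) (sym (π-≡ u∉ (D-closed u∉ (inj₁ refl) v∈D v∉))) ε))
    ... | ¬w | no u∉  | yes v∈ with charge-component (inj₁ refl) u∉ v∈ ¬w
    ...   | f , f∈ , t = f , f∈ , inj₂ (_ , u∉ , across-link en (inj₁ refl) v∈D (λ i → D-apart u∉ i v∈) , t)
    charge {e} e∈ | ¬w | yes u∈ | no v∉ with charge-component (inj₂ refl) v∉ u∈ (λ w → ¬w (revWalk w))
    ...   | f , f∈ , t = f , f∈ , inj₂ (_ , v∉ , across-link en (inj₂ refl) v∈D (λ i → D-apart v∉ i u∈) , t)
    charge {e} e∈ | ¬w | yes u∈ | yes v∈ with e ∈? F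
    ... | yes e∈F = e , e∈F , inj₁ (refl , u∈ , v∈)
    ... | no e∉F  = ⊥-elim (¬w (subst₂ W (sym (π-R u∈)) (sym (π-R v∈)) (step e (free e∉F) (inj₁ refl) ◅ ε)))

    touches-same : ∀ {v w f} → v ∉ R → w ∉ R → Touches (D v) f → Touches (D w) f → D v ≡ D w
    touches-same v∉ w∉ (inj₁ i) (inj₁ j) = trans (sym (D-≡ i)) (D-≡ j)
    touches-same v∉ w∉ (inj₂ i) (inj₂ j) = trans (sym (D-≡ i)) (D-≡ j)
    touches-same v∉ w∉ (inj₁ i) (inj₂ j) = trans (sym (D-≡ (D-closed v∉ (inj₁ refl) i (D-apart w∉ j)))) (D-≡ j)
    touches-same v∉ w∉ (inj₂ i) (inj₁ j) = trans (sym (D-≡ (D-closed v∉ (inj₂ refl) i (D-apart w∉ j)))) (D-≡ j)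

    -- Of the at most two edges of δ(D v), the picked one is not unjoined.
    one-per-component : ∀ {v e e′} → v ∉ R → e ∈ cut en (D v) → e′ ∈ cut en (D v) → e ∈ unjoined → e′ ∈ unjoined → e ≡ e′
    one-per-component {v} {e} {e′} v∉ e∈ e′∈ ue ue′ with pick-spec (r∉D v∉)
    ... | inj₁ (_ , none) = ⊥-elim (none e∈)
    ... | inj₂ (f , x , l , x∈ , p∉) with e Finₚ.≟ e′
    ...   | yes eq = eq
    ...   | no e≢e′ = ⊥-elim (ℕₚ.<⇒≱ (card-three (across-link en l x∈ p∉) e∈ e′∈ (f≢ ue) (f≢ ue′) e≢e′) (D-thin v∉))
      where
      same : π x ≡ π (pick (D v))
      same = trans (trans (π-≡ v∉ x∈) (π-D v∉)) (sym (π-R (pick∈R v∉)))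
      π-link : ∀ {x y} → Link en f x y → π x ≡ π y → π (src en f) ≡ π (tgt en f)
      π-link (inj₁ eq) p = trans (cong (π ∘ proj₁) eq) (trans p (sym (cong (π ∘ proj₂) eq)))
      π-link (inj₂ eq) p = trans (cong (π ∘ proj₁) eq) (trans (sym p) (sym (cong (π ∘ proj₂) eq)))
      f≢ : ∀ {e} → e ∈ unjoined → f ≢ e
      f≢ u refl = ∈-fromPred⁻ unjoined? u (subst (W _) (π-link l same) ε)

    ∣unjoined∣≤ : ∣ unjoined ∣ ≤ ∣ F ∣
    ∣unjoined∣≤ = card-injection Charge unjoined F charge inj
      where
      inj : ∀ {e e′ f} → e ∈ unjoined → e′ ∈ unjoined → Charge e f → Charge e′ f → e ≡ e′
      inj ue ue′ (inj₁ (refl , _)) (inj₁ (refl , _)) = refl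
      inj ue ue′ (inj₁ (refl , u∈ , v∈)) (inj₂ (v , v∉ , _ , t)) =
        ⊥-elim ([ (λ i → D-apart v∉ i u∈) , (λ i → D-apart v∉ i v∈) ]′ t)
      inj ue ue′ (inj₂ (v , v∉ , _ , t)) (inj₁ (refl , u∈ , v∈)) =
        ⊥-elim ([ (λ i → D-apart v∉ i u∈) , (λ i → D-apart v∉ i v∈) ]′ t)
      inj ue ue′ (inj₂ (v , v∉ , e∈ , t)) (inj₂ (w , w∉ , e′∈ , t′)) =
        one-per-component v∉ e∈ (subst (λ X → _ ∈ cut en X) (sym (touches-same v∉ w∉ t t′)) e′∈) ue ue′

    trace : Vertex G → Subset (#V G)
    trace v = comp (∁ F) v ∩ R

    trace⁻ : ∀ {v x} → x ∈ trace v → W v x × x ∈ R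
    trace⁻ {v} i = let p , q = x∈p∩q⁻ (comp (∁ F) v) R i in comp⁻ p , q

    trace⁺ : ∀ {v x} → W v x → x ∈ R → x ∈ trace v
    trace⁺ w x∈ = x∈p∩q⁺ (comp⁺ w , x∈)

    cut-trace : ∀ v → cut torso (trace v) ⊆ unjoined
    cut-trace v {e} e∈ with ∈-cut⁻ torso e∈
    ... | inj₁ (p , q) = ∈-fromPred⁺ unjoined? λ w → q (trace⁺ (proj₁ (trace⁻ p) ◅◅ w) (π∈R (tgt en e)))
    ... | inj₂ (p , q) = ∈-fromPred⁺ unjoined? λ w → p (trace⁺ (proj₁ (trace⁻ q) ◅◅ revWalk w) (π∈R (src en e)))

    traces : List (Subset (#V G))
    traces = List.map trace (allFin (#V G))

  module Dichotomy (a b : ℕ) (3≤a : 3 ≤ a) (0<b : 0 < b) where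

    open Trees torso R torso∈R a b public

    private
      cut-R : ∀ {e} → e ∉ cut torso R
      cut-R {e} e∈ = [ (λ (_ , j) → j (π∈R (tgt en e))) , (λ (j , _) → j (π∈R (src en e))) ]′ (∈-cut⁻ torso e∈)

    -- A big member of this star singles out a component of G - F, the future slab. The traces cover
    -- R, so the bag is empty, and their cuts consist of unjoined edges.
    traceNode : ∀ F → ∣ F ∣ < a → Node R (Contract.traces F)
    traceNode F F<a = record
      { below = λ c∈ x∈ → case ∈-map⁻ trace c∈ of λ { (v , _ , refl) → proj₂ (trace⁻ x∈) }
      ; apart = λ c∈ d∈ c≢d x∈ y∈ → case ∈-map⁻ trace c∈ , ∈-map⁻ trace d∈ of λ
          { ((v , _ , refl) , (w , _ , refl)) → c≢d (⊆-antisym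
              (λ i → let p , q = trace⁻ i in trace⁺ (proj₁ (trace⁻ y∈) ◅◅ revWalk (proj₁ (trace⁻ x∈)) ◅◅ p) q)
              (λ i → let p , q = trace⁻ i in trace⁺ (proj₁ (trace⁻ x∈) ◅◅ revWalk (proj₁ (trace⁻ y∈)) ◅◅ p) q)) }
      ; bold< = ℕₚ.≤-<-trans (ℕₚ.≤-trans (p⊆q⇒∣p∣≤∣q∣ bold⊆) ∣unjoined∣≤) F<a
      ; bag< = subst (_< b) (sym (trans (cong ∣_∣ (Empty-unique full)) (∣⊥∣≡0 (#V G)))) 0<b
      }
      where
      open Contract F
      bold⊆ : bold torso (R ∷ traces) ⊆ unjoined
      bold⊆ e∈ with ∈-bold⁻ torso (R ∷ traces) e∈
      ... | _ , here refl , _ , i = ⊥-elim (cut-R i)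
      ... | _ , there j , _ , i with ∈-map⁻ trace j
      ...   | v , _ , refl = cut-trace v i
      full : Empty (R ─ ⋃ traces)
      full (x , x∈) = let p , q = ∈-─⁻ x∈ in q (∈-⋃⁺ (∈-map⁺ trace (∈-allFin x)) (trace⁺ ε p))

    -- This star secures the bag-order: hitting it makes R ─ c big, so c, being disjoint from it,
    -- cannot be big and never becomes a core.
    coNode : ∀ {c} → c ⊆ R → ∣ cut torso c ∣ < a → ∣ c ∣ < b → Node R ((R ─ c) ∷ [])
    coNode {c} c⊆R cut< c<b = record
      { below = λ { (here refl) i → proj₁ (∈-─⁻ i) }
      ; apart = λ { (here refl) (here refl) ne → ⊥-elim (ne refl) }
      ; bold< = ℕₚ.≤-<-trans (p⊆q⇒∣p∣≤∣q∣ bold⊆) cut<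
      ; bag< = ℕₚ.≤-<-trans (p⊆q⇒∣p∣≤∣q∣ bag⊆) c<b
      }
      where
      bold⊆ : bold torso (R ∷ (R ─ c) ∷ []) ⊆ cut torso c
      bold⊆ e∈ with ∈-bold⁻ torso (R ∷ (R ─ c) ∷ []) e∈
      ... | _ , here refl , _ , i = ⊥-elim (cut-R i)
      ... | _ , there (here refl) , _ , i = subst (_ ∈_) (cut-co c) i
      bag⊆ : R ─ ⋃ ((R ─ c) ∷ []) ⊆ c
      bag⊆ {x} x∈ with ∈-─⁻ x∈ | x ∈? c
      ... | _ | yes i = i
      ... | x∈R , j | no i = ⊥-elim (j (∈-⋃⁺ {ps = (R ─ c) ∷ []} (here refl) (∈-─⁺ x∈R i)))

    Narrow : Subset (#V G) → Set
    Narrow c = c ⊆ R × ∣ cut torso c ∣ < a × ∣ c ∣ < b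

    few? : ∀ (F : Subset (#E G)) → Dec (∣ F ∣ < a)
    few? F = ∣ F ∣ ℕₚ.<? a

    narrow? : ∀ c → Dec (Narrow c)
    narrow? c = (c ⊆? R) ×-dec ((∣ cut torso c ∣ ℕₚ.<? a) ×-dec (∣ c ∣ ℕₚ.<? b))

    fewEdges : List (Subset (#E G))
    fewEdges = filter few? (allSubsets (#E G))

    co : Subset (#V G) → List (Subset (#V G))
    co c = (R ─ c) ∷ []

    coStars : List (List (Subset (#V G)))
    coStars = List.map co (filter narrow? (allSubsets (#V G)))

    stars : List (List (Subset (#V G)))
    stars = List.map Contract.traces fewEdges ++ coStars

    starNode : ∀ {cs} → cs ∈ˡ stars → Node R cs
    starNode i with ∈-++⁻ (List.map Contract.traces fewEdges) i
    ... | inj₁ j with ∈-map⁻ Contract.traces j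
    ...   | F , F∈ , refl = traceNode F (proj₂ (∈-filter⁻ few? {xs = allSubsets (#E G)} F∈))
    starNode i | inj₂ j with ∈-map⁻ co j
    ...   | c , c∈ , refl with ∈-filter⁻ narrow? {xs = allSubsets (#V G)} c∈
    ...     | _ , c⊆R , cut< , c<b = coNode c⊆R cut< c<b

    module FromDense (dense : Dense 3≤a 0<b stars) where

      open Dense dense

      module _ (F : Subset (#E G)) (F<a : ∣ F ∣ < a) where

        open Contract F

        centre : ∃[ v ] (trace v ∈ˡ ℬ)
        centre with hits (∈-++⁺ˡ (∈-map⁺ Contract.traces (∈-filter⁺ few? (∈-allSubsets F) F<a)))
        ... | c , c∈ , c∈ℬ with ∈-map⁻ trace c∈
        ...   | v , _ , refl = v , c∈ℬ

        block : Subset (#V G)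
        block = trace (proj₁ centre)

        C : Subset (#V G)
        C = comp (∁ F) (proj₁ centre)

        EC : Subset (#E G)
        EC = within C ∩ ∁ F

        stay : ∀ {x y} → x ∈ C → W x y → Walk G EC x y
        stay x∈ ε                = ε
        stay x∈ (step e f j ◅ w) = step e (x∈p∩q⁺ (link-within j x∈ z∈ , f)) j ◅ stay z∈ w
          where z∈ = comp⁺ (comp⁻ x∈ ◅◅ (step e f j ◅ ε))

        slab : Slab G
        slab = record
          { H = record
            { VH = C
            ; EH = EC
            ; closed = λ e∈ → ∈-fromPred⁻ (inside? C) (proj₁ (x∈p∩q⁻ (within C) (∁ F) e∈))
            }
          ; connected = λ u∈ v∈ → stay u∈ (revWalk (comp⁻ u∈) ◅◅ comp⁻ v∈)
          ; core = block
          ; core-nonempty = let x , x∈ = meets (proj₂ centre) (proj₂ centre) in x , proj₁ (x∈p∩q⁻ block block x∈)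
          ; core⊆H = p∩q⊆p C R
          ; core-3ec = λ u∈ v∈ → R-3ec (proj₂ (trace⁻ u∈)) (proj₂ (trace⁻ v∈))
          }

        undisconnected : ¬ Disconnects F slab
        undisconnected (u , v , u∈ , v∈ , ¬w) = ¬w (mapWalk
          (λ e∈ → ∈-─⁺ e∈ λ i → x∈∁p⇒x∉p (proj₂ (x∈p∩q⁻ (within C) (∁ F) e∈)) (proj₁ (x∈p∩q⁻ F EC i)))
          (Slab.connected slab (p∩q⊆p C R u∈) (p∩q⊆p C R v∈)))

        co-block : ¬ (∃[ c ] (c ∈ˡ co block × c ∈ˡ ℬ))
        co-block (_ , here refl , c∈ℬ) with meets (proj₂ centre) c∈ℬ
        ... | x , x∈ with x∈p∩q⁻ block (R ─ block) x∈
        ...   | i , j = proj₂ (∈-─⁻ j) i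

        block-narrow : ∣ block ∣ < b → Narrow block
        block-narrow block<b = (λ i → proj₂ (trace⁻ i))
          , ℕₚ.≤-<-trans (ℕₚ.≤-trans (p⊆q⇒∣p∣≤∣q∣ (cut-trace (proj₁ centre))) ∣unjoined∣≤) F<a
          , block<b

        block≥ : b ≤ ∣ block ∣
        block≥ = ℕₚ.≮⇒≥ λ block<b → co-block (hits (∈-++⁺ʳ (List.map Contract.traces fewEdges)
          (∈-map⁺ co (∈-filter⁺ narrow? (∈-allSubsets block) (block-narrow block<b)))))

      slabs : ∀ Fs → (∀ {F} → F ∈ˡ Fs → ∣ F ∣ < a) → List (Slab G)
      slabs []       _ = []
      slabs (F ∷ Fs) f = slab F (f (here refl)) ∷ slabs Fs (f ∘ there)

      ∈-slabs⁻ : ∀ Fs (f : ∀ {F} → F ∈ˡ Fs → ∣ F ∣ < a) {s} → s ∈ˡ slabs Fs f → ∃₂ λ F (p : ∣ F ∣ < a) → s ≡ slab F p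
      ∈-slabs⁻ (F ∷ Fs) f (here eq) = F , f (here refl) , eq
      ∈-slabs⁻ (F ∷ Fs) f (there i) = ∈-slabs⁻ Fs (f ∘ there) i

      ∈-slabs⁺ : ∀ {Fs F} (f : ∀ {F} → F ∈ˡ Fs → ∣ F ∣ < a) → F ∈ˡ Fs → ∃ λ (p : ∣ F ∣ < a) → slab F p ∈ˡ slabs Fs f
      ∈-slabs⁺ f (here refl) = f (here refl) , here refl
      ∈-slabs⁺ f (there i)   = let p , j = ∈-slabs⁺ (f ∘ there) i in p , there j

      fewEdges< : ∀ {F} → F ∈ˡ fewEdges → ∣ F ∣ < a
      fewEdges< F∈ = proj₂ (∈-filter⁻ few? {xs = allSubsets (#E G)} F∈)

      bramble : Bramble G
      bramble .Bramble.slabs = slabs fewEdges fewEdges<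
      bramble .Bramble.touching i j with ∈-slabs⁻ fewEdges _ i | ∈-slabs⁻ fewEdges _ j
      ... | F , p , refl | F′ , q , refl = meets (proj₂ (centre F p)) (proj₂ (centre F′ q))

      adhesion≥ : ∀ {F} → DisconnectingSet bramble F → a ≤ ∣ F ∣
      adhesion≥ {F} d with a ≤? ∣ F ∣
      ... | yes p = p
      ... | no  p with ∈-slabs⁺ fewEdges< (∈-filter⁺ few? (∈-allSubsets F) (ℕₚ.≰⇒> p))
      ...   | F<a , i = ⊥-elim (undisconnected F F<a (All.lookup d i))

      hasBramble : HasBramble≥ G a b
      hasBramble = bramble≥ bramble adhesion≥ λ i → case ∈-slabs⁻ fewEdges _ i of λ { (F , p , refl) → block≥ F p }

    dichotomy : HasBramble≥ G a b ⊎ RTree NoLeaf R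
    dichotomy = Sum.map₁ FromDense.hasBramble (duality 3≤a 0<b stars (All.tabulate starNode))

-- Assembling the trees of the torsos

module Assembly (G : Graph) (a b : ℕ) (3≤a : 3 ≤ a) (0<b : 0 < b)
  (torsoTree : ∀ r → Trees.RTree (Torso.torso G r) (Class.R G r) (Torso.torso∈R G r) a b NoLeaf (Class.R G r)) where

  open Components G

  private
    en : Ends (#E G) (#V G)
    en = ends G

  module Whole = Trees en ⊤ (λ _ → ∈⊤ , ∈⊤) a b
  open Whole using (RTree; node; emptyTree)

  -- All edges leaving A lead into one component of G - A. This invariant of the recursion leaves at
  -- most one component of G - R that meets both A and its complement.
  OuterConnected : Subset (#V G) → Set
  OuterConnected A = ∀ {e f x y p q} → Link en e x p → x ∈ A → p ∉ A → Link en f y q → y ∈ A → q ∉ A →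
    Walk G (within (∁ A)) p q

  -- The vertex r lies on an edge leaving A, if there is one, and c is the other end. The component
  -- of G - R that contains c is then adjacent to r, which is what `pick` rewards.
  Anchored : Subset (#V G) → Vertex G → Set
  Anchored A r = (∀ {e} → e ∉ cut en A) ⊎ (∃₂ λ e c → Link en e r c × c ∉ A ×
    (∀ {f x p} → Link en f x p → x ∈ A → p ∉ A → Walk G (within (∁ A)) p c))

  module Descend (A : Subset (#V G)) (thinA : Thin A) (r : Vertex G) (r∈A : r ∈ A) (anchored : Anchored A r)
    (recurse : ∀ {Y} → ∣ Y ∣ < ∣ A ∣ → Thin Y → OuterConnected Y → RTree NoLeaf Y) where

    open Torso G r

    within-∁-mono : ∀ {X Y} → X ⊆ Y → within (∁ Y) ⊆ within (∁ X)
    within-∁-mono X⊆Y = within-mono λ i → x∉p⇒x∈∁p λ j → x∈∁p⇒x∉p i (X⊆Y j)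

    R⊆A : R ⊆ A
    R⊆A {x} x∈R with x ∈? A
    ... | yes i = i
    ... | no  i = ⊥-elim (R⁻ x∈R (A , thinA , r∈A , i))

    -- The neighbours of D v lie in R. If two of them were in different components of G - D v, the
    -- cut of one such component would lie in that of D v, hence be thin, and separate two vertices
    -- of R.
    outer-D : ∀ {v} → v ∉ R → OuterConnected (D v)
    outer-D {v} v∉ {p = p} {q} l x∈ p∉ k y∈ q∉ with q ∈? comp (within (∁ (D v))) p
    ... | yes q∈ = comp⁻ q∈
    ... | no  q∉Y = ⊥-elim (R-inseparable (end∈R l x∈ p∉) (end∈R k y∈ q∉)
        (comp (within (∁ (D v))) p , ℕₚ.≤-trans (p⊆q⇒∣p∣≤∣q∣ sub) (D-thin v∉) , comp⁺ ε , q∉Y))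
      where
      end∈R : ∀ {e x p} → Link en e x p → x ∈ D v → p ∉ D v → p ∈ R
      end∈R {p = p} l x∈ p∉ with p ∈? R
      ... | yes i = i
      ... | no  i = ⊥-elim (p∉ (D-closed v∉ l x∈ i))
      sub : cut en (comp (within (∁ (D v))) p) ⊆ cut en (D v)
      sub e∈ with ends-across en e∈
      ... | s , t , m , s∈ , t∉ with t ∈? D v
      ...   | yes t∈ = across-link en (Sum.swap m) t∈ (x∈∁p⇒x∉p s∈∁)
        where s∈∁ = walk-stays (comp⁻ s∈) (x∉p⇒x∈∁p p∉)
      ...   | no  t∉D = ⊥-elim (t∉ (comp⁺ (comp⁻ s∈ ◅◅ (step _ (link-within m s∈∁ (x∉p⇒x∈∁p t∉D)) m ◅ ε))))
        where s∈∁ = walk-stays (comp⁻ s∈) (x∉p⇒x∈∁p p∉)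

    HoldsAnchor : Subset (#V G) → Set
    HoldsAnchor X = ∃₂ λ e c → Link en e r c × c ∉ A × c ∈ X ×
      (∀ {f x p} → Link en f x p → x ∈ A → p ∉ A → Walk G (within (∁ A)) p c)

    holds : ∀ {v f x p} → v ∉ R → Link en f x p → x ∈ A → p ∉ A → p ∈ D v → HoldsAnchor (D v)
    holds {v} v∉ l x∈ p∉ p∈D = anchor anchored
      where
      anchor : Anchored A r → HoldsAnchor (D v)
      anchor (inj₁ none) = ⊥-elim (none (across-link en l x∈ p∉))
      anchor (inj₂ (e , c , k , c∉ , conn)) =
        e , c , k , c∉ , comp⁺ (comp⁻ p∈D ◅◅ mapWalk (within-∁-mono R⊆A) (conn l x∈ p∉)) , conn

    position : ∀ {v} → v ∉ R → D v ⊆ A ⊎ HoldsAnchor (D v) ⊎ Apart A (D v)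
    position {v} v∉ with nonempty? (D v ∩ ∁ A)
    ... | no none = inj₁ λ {x} x∈ → case x ∈? A of λ
      { (yes i) → i ; (no i) → ⊥-elim (none (x , x∈p∩q⁺ (x∈ , x∉p⇒x∈∁p i))) }
    ... | yes (z , z∈) with nonempty? (A ∩ D v)
    ...   | no none = inj₂ (inj₂ λ x∈A x∈D → none (_ , x∈p∩q⁺ (x∈A , x∈D)))
    ...   | yes (y , y∈) with x∈p∩q⁻ (D v) (∁ A) z∈ | x∈p∩q⁻ A (D v) y∈
    ...     | z∈D , z∉A | y∈A , y∈D
      with walk-crosses (revWalk (D-connected v∉ y∈D) ◅◅ D-connected v∉ z∈D) y∈A (x∈∁p⇒x∉p z∉A)
    ...       | f , _ , f∈D , f∈cut with ends-across en f∈cut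
    ...         | x , p , l , x∈A , p∉A = inj₂ (inj₁ (holds v∉ l x∈A p∉A (proj₂ (within-link f∈D l))))

    anchor⇒π≡r : ∀ {v} → v ∉ R → HoldsAnchor (D v) → π v ≡ r
    anchor⇒π≡r v∉ (e , c , l , _ , c∈ , _) = trans (π-D v∉)
      (pick-prefers (across-link en (Sum.swap l) c∈ (r∉D v∉)) (link-end en l))

    φ : Subset (#V G) → Subset (#V G)
    φ Y = fromPred λ x → π x ∈? Y

    φ⁺ : ∀ {Y x} → π x ∈ Y → x ∈ φ Y
    φ⁺ {Y} = ∈-fromPred⁺ λ x → π x ∈? Y

    φ⁻ : ∀ {Y x} → x ∈ φ Y → π x ∈ Y
    φ⁻ {Y} = ∈-fromPred⁻ λ x → π x ∈? Y

    -- A vertex outside A lies in a component of G - R that contains the anchor or has no edge to R.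
    -- Either is sent to r, the latter by the default value of `pick`.
    φ⊆A : ∀ {Y} → r ∉ Y → φ Y ⊆ A
    φ⊆A {Y} r∉Y {x} x∈ with x ∈? A
    ... | yes i = i
    ... | no x∉A = ⊥-elim (contra (position x∉R))
      where
      x∉R : x ∉ R
      x∉R i = x∉A (R⊆A i)
      π≢r : π x ≢ r
      π≢r eq = r∉Y (subst (_∈ Y) eq (φ⁻ x∈))
      contra : D x ⊆ A ⊎ HoldsAnchor (D x) ⊎ Apart A (D x) → Absurd
      contra (inj₁ D⊆A)         = x∉A (D⊆A v∈D)
      contra (inj₂ (inj₁ h))    = π≢r (anchor⇒π≡r x∉R h)
      contra (inj₂ (inj₂ A∥D)) with pick-spec (r∉D x∉R)
      ... | inj₁ (eq , _)             = π≢r (trans (π-D x∉R) eq)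
      ... | inj₂ (e , y , l , y∈D , _) =
        π≢r (anchor⇒π≡r x∉R (holds x∉R (Sum.swap l) (R⊆A (pick∈R x∉R)) (λ i → A∥D i y∈D) y∈D))

    cut-φ : ∀ {Y} → r ∉ Y → cut en (A ∩ φ Y) ≡ cut torso Y
    cut-φ {Y} r∉Y = ⊆-antisym
      (λ e∈ → ∈-cut⁺ torso (Sum.map (λ (i , j) → down i , λ k → j (up k)) (λ (i , j) → (λ k → i (up k)) , down j) (∈-cut⁻ en e∈)))
      (λ e∈ → ∈-cut⁺ en (Sum.map (λ (i , j) → up i , λ k → j (down k)) (λ (i , j) → (λ k → i (down k)) , up j) (∈-cut⁻ torso e∈)))
      where
      down : ∀ {x} → x ∈ A ∩ φ Y → π x ∈ Y
      down i = φ⁻ (proj₂ (x∈p∩q⁻ A (φ Y) i))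
      up : ∀ {x} → π x ∈ Y → x ∈ A ∩ φ Y
      up i = x∈p∩q⁺ (φ⊆A r∉Y (φ⁺ i) , φ⁺ i)

    module _ {v : Vertex G} (v∉ : v ∉ R) where

      private
        Y : Subset (#V G)
        Y = A ∩ D v
        Y⊆A : Y ⊆ A
        Y⊆A = p∩q⊆p A (D v)
        Y⊆D : Y ⊆ D v
        Y⊆D = p∩q⊆q A (D v)

      part-small : ∣ Y ∣ < ∣ A ∣
      part-small = p⊂q⇒∣p∣<∣q∣ (Y⊆A , r , r∈A , λ i → r∉D v∉ (Y⊆D i))

      -- If D v holds the anchor, the anchor edge is in the cuts of A and of D v but not in that of
      -- Y, so 2 + 2 - 2 edges remain. Every outer neighbour of Y then reaches c, by way of r and
      -- the anchor edge if it lies in A.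
      part-inv : Thin Y × OuterConnected Y
      part-inv with position v∉
      ... | inj₁ D⊆A = subst (λ X → Thin X × OuterConnected X)
            (⊆-antisym (λ i → x∈p∩q⁺ (D⊆A i , i)) Y⊆D) (D-thin v∉ , outer-D v∉)
      ... | inj₂ (inj₂ A∥D) = subst (λ X → Thin X × OuterConnected X)
            (sym (Empty-unique λ (_ , i) → A∥D (Y⊆A i) (Y⊆D i)))
            (ℕₚ.≤-trans (ℕₚ.≤-reflexive (cut-⊥ en)) z≤n , λ _ i _ _ _ _ → ⊥-elim (∉⊥ i))
      ... | inj₂ (inj₁ (e₀ , c , l₀ , c∉A , c∈D , conn)) = thin , λ l x∈ p∉ k y∈ q∉ → toAnchor l x∈ p∉ ◅◅ revWalk (toAnchor k y∈ q∉)
        where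
        r∉Y : r ∉ Y
        r∉Y i = r∉D v∉ (Y⊆D i)
        c∉Y : c ∉ Y
        c∉Y i = c∉A (Y⊆A i)
        thin : Thin Y
        thin = ℕₚ.+-cancelˡ-≤ 2 _ _ (ℕₚ.≤-trans (card-drop₂ f e₀∉ (across-link en l₀ r∈A c∉A)
            (across-link en (Sum.swap l₀) c∈D (r∉D v∉))) (ℕₚ.+-mono-≤ thinA (D-thin v∉)))
          where
          f : ∀ {i} → i ∈ cut en Y → i ∈ cut en A ⊎ i ∈ cut en (D v)
          f i∈ with ends-across en i∈
          ... | x , y , l , x∈ , y∉ with y ∈? A
          ...   | no y∉A  = inj₁ (across-link en l (Y⊆A x∈) y∉A)
          ...   | yes y∈A = inj₂ (across-link en l (Y⊆D x∈) λ y∈D → y∉ (x∈p∩q⁺ (y∈A , y∈D)))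
          e₀∉ : e₀ ∉ cut en Y
          e₀∉ i = [ (λ (j , _) → r∉Y j) , (λ (j , _) → c∉Y j) ]′ (cut-at en l₀ i)
        toAnchor : ∀ {e x p} → Link en e x p → x ∈ Y → p ∉ Y → Walk G (within (∁ Y)) p c
        toAnchor {p = p} l x∈ p∉ with p ∈? A
        ... | no p∉A = mapWalk (within-∁-mono Y⊆A) (conn l (Y⊆A x∈) p∉A)
        ... | yes p∈A = mapWalk (within-∁-mono Y⊆D)
            (outer-D v∉ l (Y⊆D x∈) (λ i → p∉ (x∈p∩q⁺ (p∈A , i))) (Sum.swap l₀) c∈D (r∉D v∉))
          ◅◅ (step e₀ (link-within l₀ (x∉p⇒x∈∁p r∉Y) (x∉p⇒x∈∁p c∉Y)) l₀ ◅ ε)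

    module T = Trees torso R torso∈R a b

    module _ {W : Subset (#V G)} {cs : List (Subset (#V G))} (nd : T.Node W cs) where

      open T.Node nd

      attached? : ∀ v → Dec (v ∉ R × π v ∈ W ─ ⋃ cs)
      attached? v = ¬? (v ∈? R) ×-dec (π v ∈? W ─ ⋃ cs)

      attached : List (Vertex G)
      attached = filter attached? (allFin (#V G))

      attached⁻ : ∀ {v} → v ∈ˡ attached → v ∉ R × π v ∈ W ─ ⋃ cs
      attached⁻ v∈ = proj₂ (∈-filter⁻ attached? {xs = allFin (#V G)} v∈)

      -- The components contracted into this bag become further children, which leaves only vertices
      -- of R in the bag. A component is listed once for each of its vertices.
      partD partφ : List (Subset (#V G))
      partD = List.map (λ v → A ∩ D v) attached
      partφ = List.map (λ c → A ∩ φ c) cs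

      data Part : Subset (#V G) → Set where
        isD : ∀ {v} → v ∈ˡ attached → Part (A ∩ D v)
        isφ : ∀ {c} → c ∈ˡ cs → Part (A ∩ φ c)

      part : ∀ {Y} → Y ∈ˡ partD ++ partφ → Part Y
      part Y∈ with ∈-++⁻ partD Y∈
      ... | inj₁ i = let v , v∈ , eq = ∈-map⁻ (λ v → A ∩ D v) i in subst Part (sym eq) (isD v∈)
      ... | inj₂ i = let c , c∈ , eq = ∈-map⁻ (λ c → A ∩ φ c) i in subst Part (sym eq) (isφ c∈)

      -- The children from `partD` are thin and stay out of the bold union; those from `partφ` avoid
      -- r and keep their torso cuts by `cut-φ`. Only the root contains r, and its set A is thin.
      assemble : Thin (A ∩ φ W) ⊎ r ∉ W → r ∉ ⋃ cs → Whole.Node (A ∩ φ W) (partD ++ partφ)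
      assemble top r∉⋃ = record
        { below = λ Y∈ → sub (part Y∈)
        ; apart = λ Y∈ Z∈ → disj (part Y∈) (part Z∈)
        ; bold< = ℕₚ.≤-<-trans (p⊆q⇒∣p∣≤∣q∣ (bold-mono en torso λ { (here refl) → here′ top ; (there Y∈) → there′ (part Y∈) })) bold<
        ; bag< = ℕₚ.≤-<-trans (p⊆q⇒∣p∣≤∣q∣ bag⊆) bag<
        }
        where
        inD : ∀ {v x} → v ∈ˡ attached → x ∈ A ∩ D v → π x ≡ π v
        inD {v} v∈ x∈ = π-≡ (proj₁ (attached⁻ v∈)) (proj₂ (x∈p∩q⁻ A (D v) x∈))
        inφ : ∀ {c x} → x ∈ A ∩ φ c → π x ∈ c
        inφ {c} x∈ = φ⁻ (proj₂ (x∈p∩q⁻ A (φ c) x∈))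
        in-A : ∀ {X x} → x ∈ A ∩ X → x ∈ A
        in-A {X} x∈ = proj₁ (x∈p∩q⁻ A X x∈)
        sub : ∀ {Y} → Part Y → Y ⊆ A ∩ φ W
        sub (isD v∈) x∈ = x∈p∩q⁺ (in-A x∈ , φ⁺ (subst (_∈ W) (sym (inD v∈ x∈)) (proj₁ (∈-─⁻ (proj₂ (attached⁻ v∈))))))
        sub (isφ c∈) x∈ = x∈p∩q⁺ (in-A x∈ , φ⁺ (below c∈ (inφ x∈)))
        mixed : ∀ {v c x} → v ∈ˡ attached → c ∈ˡ cs → x ∈ A ∩ D v → x ∉ A ∩ φ c
        mixed v∈ c∈ x∈ x∈′ = proj₂ (∈-─⁻ (proj₂ (attached⁻ v∈))) (∈-⋃⁺ c∈ (subst (_∈ _) (inD v∈ x∈) (inφ x∈′)))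
        disj : ∀ {Y Z} → Part Y → Part Z → Y ≢ Z → Apart Y Z
        disj (isD {v} v∈) (isD {w} w∈) ne x∈ x∈′ = ne (cong (A ∩_) (trans
          (sym (D-≡ (proj₂ (x∈p∩q⁻ A (D v) x∈)))) (D-≡ (proj₂ (x∈p∩q⁻ A (D w) x∈′)))))
        disj (isD v∈) (isφ c∈) ne x∈ x∈′ = mixed v∈ c∈ x∈ x∈′
        disj (isφ c∈) (isD v∈) ne x∈ x∈′ = mixed v∈ c∈ x∈′ x∈
        disj (isφ c∈) (isφ d∈) ne x∈ x∈′ = apart c∈ d∈ (λ { refl → ne refl }) (inφ x∈) (inφ x∈′)
        here′ : Thin (A ∩ φ W) ⊎ r ∉ W → 3 ≤ ∣ cut en (A ∩ φ W) ∣ → ∃[ Z ] (Z ∈ˡ W ∷ cs × cut en (A ∩ φ W) ≡ cut torso Z)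
        here′ (inj₁ thin) 3≤ = ⊥-elim (ℕₚ.<⇒≱ 3≤ thin)
        here′ (inj₂ r∉W)  _  = W , here refl , cut-φ r∉W
        there′ : ∀ {Y} → Part Y → 3 ≤ ∣ cut en Y ∣ → ∃[ Z ] (Z ∈ˡ W ∷ cs × cut en Y ≡ cut torso Z)
        there′ (isD v∈) 3≤ = ⊥-elim (ℕₚ.<⇒≱ 3≤ (proj₁ (part-inv (proj₁ (attached⁻ v∈)))))
        there′ (isφ c∈) _  = _ , there c∈ , cut-φ (λ i → r∉⋃ (∈-⋃⁺ c∈ i))
        bag⊆ : (A ∩ φ W) ─ ⋃ (partD ++ partφ) ⊆ W ─ ⋃ cs
        bag⊆ {x} x∈ with ∈-─⁻ x∈
        ... | x∈AW , x∉ = settle (x ∈? R)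
          where
          πx∉ : π x ∉ ⋃ cs
          πx∉ i with ∈-⋃⁻ cs i
          ... | c , c∈ , j = x∉ (∈-⋃⁺ {ps = partD ++ partφ} (∈-++⁺ʳ partD (∈-map⁺ (λ c → A ∩ φ c) c∈)) (x∈p∩q⁺ (in-A x∈AW , φ⁺ j)))
          πx∈ : π x ∈ W ─ ⋃ cs
          πx∈ = ∈-─⁺ (inφ x∈AW) πx∉
          settle : Dec (x ∈ R) → x ∈ W ─ ⋃ cs
          settle (yes x∈R) = subst (_∈ W ─ ⋃ cs) (π-R x∈R) πx∈
          settle (no x∉R)  = ⊥-elim (x∉ (∈-⋃⁺ {ps = partD ++ partφ}
            (∈-++⁺ˡ (∈-map⁺ (λ v → A ∩ D v) (∈-filter⁺ attached? (∈-allFin x) (x∉R , πx∈))))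
            (x∈p∩q⁺ (in-A x∈AW , v∈D))))

      assembleTree : Thin (A ∩ φ W) ⊎ r ∉ W → r ∉ ⋃ cs → (∀ {c} → c ∈ˡ cs → RTree NoLeaf (A ∩ φ c)) → RTree NoLeaf (A ∩ φ W)
      assembleTree top r∉⋃ ts = node (partD ++ partφ) (assemble top r∉⋃) (All.tabulate λ Y∈ → tree (part Y∈))
        where
        tree : ∀ {Y} → Part Y → RTree NoLeaf Y
        tree (isD v∈) = let v∉ = proj₁ (attached⁻ v∈) in recurse (part-small v∉) (proj₁ (part-inv v∉)) (proj₂ (part-inv v∉))
        tree (isφ c∈) = ts c∈

    lift : ∀ {W} → T.RTree NoLeaf W → r ∉ W → RTree NoLeaf (A ∩ φ W)
    lift = T.elim (λ W → r ∉ W → RTree NoLeaf (A ∩ φ W)) (λ ()) λ cs nd _ ps r∉W →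
      let r∉⋃ = λ i → let c , c∈ , j = ∈-⋃⁻ cs i in r∉W (T.Node.below nd c∈ j) in
      assembleTree nd (inj₂ r∉W) r∉⋃ (λ c∈ → All.lookup ps c∈ λ i → r∉⋃ (∈-⋃⁺ c∈ i))

    all : A ∩ φ R ≡ A
    all = ⊆-antisym (p∩q⊆p A (φ R)) (λ i → x∈p∩q⁺ (i , φ⁺ (π∈R _)))

    result : RTree NoLeaf A
    -- With r in the root bag, all parts below the root avoid r, as `cut-φ` requires.
    result with T.rerootAt r (torsoTree r) id r∈R (subst (T.RTree NoLeaf) (sym T.Ω─Ω≡⊥) (T.emptyTree 3≤a 0<b))
    ... | inj₁ (_ , _ , ())
    ... | inj₂ (cs , nd , r∉ , ts) = subst (RTree NoLeaf) all
      (assembleTree nd (inj₁ (subst Thin (sym all) thinA)) r∉ (λ c∈ → lift (All.lookup ts c∈) (λ i → r∉ (∈-⋃⁺ c∈ i))))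

  build : ∀ A → Acc _<_ ∣ A ∣ → Thin A → OuterConnected A → RTree NoLeaf A
  build A (acc rs) thin conn with any? (λ e → e ∈? cut en A)
  ... | yes (e , e∈) with ends-across en e∈
  ...   | r , c , l , r∈ , c∉ = Descend.result A thin r r∈ (inj₂ (e , c , l , c∉ , λ k x∈ p∉ → conn k x∈ p∉ l r∈ c∉))
          λ {Y} lt t k → build Y (rs lt) t k
  build A (acc rs) thin conn | no none with nonempty? A
  ... | yes (r , r∈) = Descend.result A thin r r∈ (inj₁ λ e∈ → none (_ , e∈)) λ {Y} lt t k → build Y (rs lt) t k
  ... | no empty     = subst (RTree NoLeaf) (sym (Empty-unique empty)) (emptyTree 3≤a 0<b)

  wholeTree : RTree NoLeaf ⊤
  wholeTree = build ⊤ (<-wellFounded _)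
    (ℕₚ.≤-trans (ℕₚ.≤-reflexive (trans (cong ∣_∣ (Empty-unique none)) (∣⊥∣≡0 (#E G)))) z≤n)
    (λ _ _ p∉ → ⊥-elim (p∉ ∈⊤))
    where
    none : Empty (cut en ⊤)
    none (e , e∈) = let _ , _ , _ , _ , y∉ = ends-across en e∈ in y∉ ∈⊤

-- From trees of parts to tree-cut decompositions

max-map< : ∀ {n k} (f : Fin n → ℕ) → 0 < k → (∀ t → f t < k) → max 0 (List.map f (allFin n)) < k
max-map< {n} {k} f 0<k f< = max<v⁺ {xs = List.map f (allFin n)} 0<k
  (All.tabulate λ i → let t , _ , eq = ∈-map⁻ f i in subst (_< k) (sym eq) (f< t))

≤max-map : ∀ {n} (f : Fin n → ℕ) t → f t ≤ max 0 (List.map f (allFin n))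
≤max-map {n} f t = All.lookup (xs≤max 0 (List.map f (allFin n))) (∈-map⁺ f (∈-allFin t))

-- Trees built by adding leaves: the new leaf is node zero, and edge zero
-- attaches it.
data LeafTree : ℕ → Set where
  single : LeafTree 0
  attach : ∀ {m} → LeafTree m → Fin (suc m) → LeafTree (suc m)

treeEnds : ∀ {m} → LeafTree m → Ends m (suc m)
treeEnds (attach T t) zero    = zero , suc t
treeEnds (attach T t) (suc f) = suc (proj₁ (treeEnds T f)) , suc (proj₂ (treeEnds T f))

treeLoopless : ∀ {m} (T : LeafTree m) f → proj₁ (treeEnds T f) ≢ proj₂ (treeEnds T f)
treeLoopless (attach T t) zero    ()
treeLoopless (attach T t) (suc f) eq = treeLoopless T f (Finₚ.suc-injective eq)

graph : ∀ {m} → LeafTree m → Graph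
graph {m} T = record { #V = suc m ; #E = m ; ends = treeEnds T ; loopless = treeLoopless T }

-- true on the side of the edge that was attached later.
side : ∀ {m} → LeafTree m → Fin m → Fin (suc m) → Bool
side (attach T t) zero    zero    = true
side (attach T t) zero    (suc x) = false
side (attach T t) (suc f) zero    = side T f t
side (attach T t) (suc f) (suc x) = side T f x

side-differs : ∀ {m} (T : LeafTree m) f → side T f (proj₁ (treeEnds T f)) ≢ side T f (proj₂ (treeEnds T f))
side-differs (attach T t) zero    ()
side-differs (attach T t) (suc f) eq = side-differs T f eq

side-agrees : ∀ {m} (T : LeafTree m) {f g} → f ≢ g → side T f (proj₁ (treeEnds T g)) ≡ side T f (proj₂ (treeEnds T g))
side-agrees (attach T t) {zero}  {zero}  ne = ⊥-elim (ne refl)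
side-agrees (attach T t) {zero}  {suc g} ne = refl
side-agrees (attach T t) {suc f} {zero}  ne = refl
side-agrees (attach T t) {suc f} {suc g} ne = side-agrees T λ eq → ne (cong suc eq)

side-step : ∀ {m} (T : LeafTree m) {f g x y} → f ≢ g → Joins (graph T) g x y → side T f x ≡ side T f y
side-step T {f} ne (inj₁ eq) = subst₂ (λ x y → side T f x ≡ side T f y) (cong proj₁ eq) (cong proj₂ eq) (side-agrees T ne)
side-step T {f} ne (inj₂ eq) = sym (side-step T ne (inj₁ eq))

side-walk : ∀ {m} (T : LeafTree m) {f S x y} (w : Walk (graph T) S x y) → f ∉ˡ edges w → side T f x ≡ side T f y
side-walk T ε                f∉ = refl
side-walk T (step g a j ◅ w) f∉ = trans (side-step T (f∉ ∘ here) j) (side-walk T w (f∉ ∘ there))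

embed : ∀ {m} (T : LeafTree m) t {S S′} → (∀ {e} → e ∈ S → suc e ∈ S′) → ∀ {x y} →
  Walk (graph T) S x y → Walk (graph (attach T t)) S′ (suc x) (suc y)
embed T t f ε                = ε
embed T t f (step e a j ◅ w) = step (suc e) (f a) (Sum.map up up j) ◅ embed T t f w
  where
  up : ∀ {p q r s} → (p , q) ≡ (r , s) → (Fin.suc p , Fin.suc q) ≡ (suc r , suc s)
  up refl = refl

treeConnected : ∀ {m} (T : LeafTree m) x y → Walk (graph T) ⊤ x y
treeConnected single       zero    zero    = ε
treeConnected (attach T t) zero    zero    = ε
treeConnected (attach T t) zero    (suc y) = step zero ∈⊤ (inj₁ refl) ◅ embed T t (λ _ → ∈⊤) (treeConnected T t y)
treeConnected (attach T t) (suc x) zero    = embed T t (λ _ → ∈⊤) (treeConnected T x t) ◅◅ (step zero ∈⊤ (inj₂ refl) ◅ ε)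
treeConnected (attach T t) (suc x) (suc y) = embed T t (λ _ → ∈⊤) (treeConnected T x y)

sameSide⇒walk : ∀ {m} (T : LeafTree m) f {x y} → side T f x ≡ side T f y → Walk (graph T) (⊤ - f) x y
sameSide⇒walk (attach T t) zero    {zero}  {zero}  _ = ε
sameSide⇒walk (attach T t) zero    {suc x} {suc y} _ = embed T t (λ _ → x∈p∧x≢y⇒x∈p-y {y = zero} ∈⊤ λ ()) (treeConnected T x y)
sameSide⇒walk (attach T t) (suc f) {x}     {y}     eq =
  toOld x ◅◅ embed T t keep (sameSide⇒walk T f (trans (sym (side-old x)) (trans eq (side-old y)))) ◅◅ revWalk (toOld y)
  where
  old : Fin _ → Fin _
  old zero    = t
  old (suc x) = x
  side-old : ∀ x → side (attach T t) (suc f) x ≡ side T f (old x)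
  side-old zero    = refl
  side-old (suc x) = refl
  toOld : ∀ x → Walk (graph (attach T t)) (⊤ - suc f) x (suc (old x))
  toOld zero    = step zero (x∈p∧x≢y⇒x∈p-y {y = suc f} ∈⊤ λ ()) (inj₁ refl) ◅ ε
  toOld (suc x) = ε
  keep : ∀ {e} → e ∈ ⊤ - f → suc e ∈ ⊤ - suc f
  keep e∈ = x∈p∧x≢y⇒x∈p-y ∈⊤ λ eq → proj₂ (∈-minus⁻ e∈) (Finₚ.suc-injective eq)

graph-isTree : ∀ {m} (T : LeafTree m) → IsTree (graph T)
graph-isTree T = record { nonEmpty = s≤s z≤n ; connected = treeConnected T ; acyclic = acyclic }
  where
  acyclic : ∀ {s} (w : Walk (graph T) ⊤ s s) → ¬ IsCycle w
  acyclic ε                (ne , _)     = ne refl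
  -- The rest of the cycle avoids its first edge f and so stays on one side of f, yet the ends of f
  -- are on different sides.
  acyclic (step f a j ◅ w) (_ , p ∷ _ , _) = differs j (sym (side-walk T w (All¬⇒¬Any p)))
    where
    differs : ∀ {x y} → Joins (graph T) f x y → side T f x ≢ side T f y
    differs (inj₁ eq) = subst₂ (λ x y → side T f x ≢ side T f y) (cong proj₁ eq) (cong proj₂ eq) (side-differs T f)
    differs (inj₂ eq) = ≢-sym (differs (inj₁ eq))

module Compile (G : Graph) (a b : ℕ) (0<a : 0 < a) (0<b : 0 < b) where

  private
    en : Ends (#E G) (#V G)
    en = ends G
    V  = Vertex G
    X  = Subset (#V G)

  open Trees en ⊤ (λ _ → ∈⊤ , ∈⊤) a b

  lower? : ∀ {m} (T : LeafTree m) (ν : V → Fin (suc m)) f v → Dec (side T f (ν v) ≡ true)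
  lower? T ν f v = side T f (ν v) Boolₚ.≟ true

  lower : ∀ {m} → LeafTree m → (V → Fin (suc m)) → Fin m → X
  lower T ν f = fromPred (lower? T ν f)

  -- A tree-cut decomposition under construction. The parts in `todo` still
  -- lie in the bag of their parent, whose `star` already accounts for them.
  record Partial (todo : List X) : Set where
    field
      {m}      : ℕ
      T        : LeafTree m
      ν        : V → Fin (suc m)
      star     : Fin (suc m) → List X
      final    : Fin (suc m) → X
      incident : ∀ {t f} → Incident (graph T) t f → lower T ν f ∈ˡ star t
      bold<    : ∀ t → ∣ bold en (star t) ∣ < a
      final<   : ∀ t → ∣ final t ∣ < b
      home     : ∀ {c} → c ∈ˡ todo → ∃[ t ] (c ∈ˡ star t × (∀ {v} → v ∈ c → ν v ≡ t))
      separate : AllPairs (λ c d → Empty (c ∩ d)) todo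
      placed   : ∀ v → v ∈ final (ν v) ⊎ (∃[ c ] (c ∈ˡ todo × v ∈ c))

  -- `Node.apart` says nothing about repeated entries, and a repeated part would be attached twice;
  -- hence the deduplication.
  apartList : ∀ {cs W} → Node W cs → AllPairs (λ c d → Empty (c ∩ d)) (deduplicate _≟ˢ_ cs)
  apartList {cs} nd = go (deduplicate-! _≟ˢ_ cs) (∈-deduplicate⁻ _≟ˢ_ cs)
    where
    go : ∀ {ds} → Unique ds → (∀ {d} → d ∈ˡ ds → d ∈ˡ cs) → AllPairs (λ c d → Empty (c ∩ d)) ds
    go []       _ = []
    go {d ∷ ds} (u ∷ us) f = All.tabulate (λ {e} e∈ (x , x∈) →
        let p , q = x∈p∩q⁻ d e x∈ in Node.apart nd (f (here refl)) (f (there e∈)) (All.lookup u e∈) p q)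
      ∷ go us (f ∘ there)

  start : ∀ {cs} → Node ⊤ cs → Partial (deduplicate _≟ˢ_ cs)
  start {cs} nd = record
    { T = single
    ; ν = λ _ → zero
    ; star = λ _ → ⊤ ∷ cs
    ; final = λ _ → ⊤ ─ ⋃ cs
    ; incident = λ { {f = ()} }
    ; bold< = λ _ → Node.bold< nd
    ; final< = λ _ → Node.bag< nd
    ; home = λ c∈ → zero , there (∈-deduplicate⁻ _≟ˢ_ cs c∈) , λ _ → refl
    ; separate = apartList nd
    ; placed = placed
    }
    where
    placed : ∀ v → v ∈ ⊤ ─ ⋃ cs ⊎ (∃[ c ] (c ∈ˡ deduplicate _≟ˢ_ cs × v ∈ c))
    placed v with v ∈? ⋃ cs
    ... | no v∉  = inj₁ (∈-─⁺ ∈⊤ v∉)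
    ... | yes v∈ = let c , c∈ , j = ∈-⋃⁻ cs v∈ in inj₂ (c , ∈-deduplicate⁺ _≟ˢ_ c∈ , j)

  module _ {c cs todo} (nd : Node c cs) (st : Partial (c ∷ todo)) where

    open Partial st

    private
      h : Fin (suc m)
      h = proj₁ (home (here refl))

      T⁺ : LeafTree (suc m)
      T⁺ = attach T h

      relocate : ∀ {v} → Dec (v ∈ c) → Fin (suc m) → Fin (suc (suc m))
      relocate (yes _) _ = zero
      relocate (no _)  t = suc t

      ν⁺ : V → Fin (suc (suc m))
      ν⁺ v = relocate (v ∈? c) (ν v)

      star⁺ : Fin (suc (suc m)) → List X
      star⁺ zero    = c ∷ cs
      star⁺ (suc t) = star t

      final⁺ : Fin (suc (suc m)) → X
      final⁺ zero    = c ─ ⋃ cs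
      final⁺ (suc t) = final t

      ν⁺-in : ∀ {v} → v ∈ c → ν⁺ v ≡ zero
      ν⁺-in {v} v∈ with v ∈? c
      ... | yes _ = refl
      ... | no v∉ = ⊥-elim (v∉ v∈)

      ν⁺-out : ∀ {v} → v ∉ c → ν⁺ v ≡ suc (ν v)
      ν⁺-out {v} v∉ with v ∈? c
      ... | yes v∈ = ⊥-elim (v∉ v∈)
      ... | no _   = refl

      side-new : ∀ v → (side T⁺ zero (ν⁺ v) ≡ true → v ∈ c) × (v ∈ c → side T⁺ zero (ν⁺ v) ≡ true)
      side-new v with v ∈? c
      ... | yes v∈ = (λ _ → v∈) , (λ _ → refl)
      ... | no v∉  = (λ ()) , (λ v∈ → ⊥-elim (v∉ v∈))

      side-old : ∀ f v → side T⁺ (suc f) (ν⁺ v) ≡ side T f (ν v)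
      side-old f v with v ∈? c
      ... | yes v∈ = cong (side T f) (sym (proj₂ (proj₂ (home (here refl))) v∈))
      ... | no _   = refl

      lower-new : lower T⁺ ν⁺ zero ≡ c
      lower-new = ⊆-antisym (λ i → proj₁ (side-new _) (∈-fromPred⁻ (lower? T⁺ ν⁺ zero) i))
                            (λ i → ∈-fromPred⁺ (lower? T⁺ ν⁺ zero) (proj₂ (side-new _) i))

      lower-old : ∀ f → lower T⁺ ν⁺ (suc f) ≡ lower T ν f
      lower-old f = ⊆-antisym
        (λ {v} i → ∈-fromPred⁺ (lower? T ν f) (trans (sym (side-old f v)) (∈-fromPred⁻ (lower? T⁺ ν⁺ (suc f)) i)))
        (λ {v} i → ∈-fromPred⁺ (lower? T⁺ ν⁺ (suc f)) (trans (side-old f v) (∈-fromPred⁻ (lower? T ν f) i)))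

      incident⁺ : ∀ {t f} → Incident (graph T⁺) t f → lower T⁺ ν⁺ f ∈ˡ star⁺ t
      incident⁺ {zero}  {zero}  _         = here lower-new
      incident⁺ {suc t} {zero}  (inj₂ eq) = subst₂ (λ Y t → Y ∈ˡ star t) (sym lower-new) (Finₚ.suc-injective eq)
                                              (proj₁ (proj₂ (home (here refl))))
      incident⁺ {suc t} {suc f} inc       = subst (_∈ˡ star t) (sym (lower-old f))
                                              (incident (Sum.map Finₚ.suc-injective Finₚ.suc-injective inc))
      incident⁺ {zero}  {suc f} (inj₁ ())
      incident⁺ {zero}  {suc f} (inj₂ ())

      news : List X
      news = deduplicate _≟ˢ_ cs

      news-below : ∀ {d} → d ∈ˡ news → d ⊆ c
      news-below d∈ = Node.below nd (∈-deduplicate⁻ _≟ˢ_ cs d∈)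

      outside-c : ∀ {d v} → d ∈ˡ todo → v ∈ d → v ∉ c
      outside-c d∈ v∈d v∈c = apartFrom separate
        where
        apartFrom : AllPairs (λ c d → Empty (c ∩ d)) (c ∷ todo) → _
        apartFrom (u ∷ _) = All.lookup u d∈ (_ , x∈p∩q⁺ (v∈c , v∈d))

      home⁺ : ∀ {d} → d ∈ˡ news ++ todo → ∃[ t ] (d ∈ˡ star⁺ t × (∀ {v} → v ∈ d → ν⁺ v ≡ t))
      home⁺ d∈ with ∈-++⁻ news d∈
      ... | inj₁ i = zero , there (∈-deduplicate⁻ _≟ˢ_ cs i) , λ v∈ → ν⁺-in (news-below i v∈)
      ... | inj₂ i = let t , d∈t , at = home (there i) in
        suc t , d∈t , λ v∈ → trans (ν⁺-out (outside-c i v∈)) (cong suc (at v∈))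

      separate⁺ : AllPairs (λ c d → Empty (c ∩ d)) (news ++ todo)
      separate⁺ = ++⁺ (apartList nd) (AllPairs.tail separate) (All.tabulate λ {d} d∈ → All.tabulate λ {e} e∈ (x , x∈) →
        let p , q = x∈p∩q⁻ d e x∈ in outside-c e∈ q (news-below d∈ p))

      placed⁺ : ∀ v → v ∈ final⁺ (ν⁺ v) ⊎ (∃[ d ] (d ∈ˡ news ++ todo × v ∈ d))
      placed⁺ v with v ∈? c | v ∈? ⋃ cs
      ... | yes v∈c | no v∉  = inj₁ (∈-─⁺ v∈c v∉)
      ... | yes v∈c | yes v∈ = let d , d∈ , j = ∈-⋃⁻ cs v∈ in inj₂ (d , ∈-++⁺ˡ (∈-deduplicate⁺ _≟ˢ_ d∈) , j)
      ... | no v∉c  | _ with placed v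
      ...   | inj₁ i = inj₁ i
      ...   | inj₂ (_ , here refl , v∈c) = ⊥-elim (v∉c v∈c)
      ...   | inj₂ (d , there d∈ , v∈d)  = inj₂ (d , ∈-++⁺ʳ news d∈ , v∈d)

    -- All of c sits in its home bag. Moving it to a leaf attached there leaves the set cut off by
    -- every older edge unchanged, and the new edge cuts off exactly c.
    expand : Partial (deduplicate _≟ˢ_ cs ++ todo)
    expand = record
      { T = T⁺
      ; ν = ν⁺
      ; star = star⁺
      ; final = final⁺
      ; incident = λ {t} {f} → incident⁺ {t} {f}
      ; bold< = λ { zero → Node.bold< nd ; (suc t) → bold< t }
      ; final< = λ { zero → Node.bag< nd ; (suc t) → final< t }
      ; home = home⁺
      ; separate = separate⁺
      ; placed = placed⁺
      }

  Resolves : X → Set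
  Resolves c = ∀ {todo} → Partial (c ∷ todo) → Partial todo

  resolveAll : ∀ {cs todo} → (∀ {c} → c ∈ˡ cs → Resolves c) → Partial (cs ++ todo) → Partial todo
  resolveAll {[]}     f st = st
  resolveAll {c ∷ cs} f st = resolveAll {cs} (λ c∈ → f (there c∈)) (f (here refl) st)

  resolves : ∀ {W} → RTree NoLeaf W → Resolves W
  resolves = elim Resolves (λ ()) λ cs nd _ ps st →
    resolveAll {deduplicate _≟ˢ_ cs} (λ c∈ → All.lookup ps (∈-deduplicate⁻ _≟ˢ_ cs c∈)) (expand nd st)

  complete : RTree NoLeaf ⊤ → Partial []
  complete (node cs nd ts) = resolveAll {deduplicate _≟ˢ_ cs}
    (λ c∈ → resolves (All.lookup ts (∈-deduplicate⁻ _≟ˢ_ cs c∈)))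
    (subst Partial (sym (++-identityʳ _)) (start nd))

  module _ (st : Partial []) where

    open Partial st

    private
      bag? : ∀ t v → Dec (ν v ≡ t)
      bag? t v = ν v Finₚ.≟ t

    decomposition : TreeCutDecomposition G
    decomposition = record
      { T = graph T
      ; isTree = graph-isTree T
      ; bag = λ t → fromPred (bag? t)
      ; isNearPartition = record
        { disjoint = λ {s} {t} s≢t (v , v∈) → let p , q = x∈p∩q⁻ _ _ v∈ in
            s≢t (trans (sym (∈-fromPred⁻ (bag? s) p)) (∈-fromPred⁻ (bag? t) q))
        ; covers = λ v → ν v , ∈-fromPred⁺ (bag? (ν v)) refl
        }
      }

    open TreeCutDecomposition decomposition using (adhEdge; adhNode; Bold; bold?; adhesionWidth; bagWidth)

    private
      apart? : ∀ f e → Dec (¬ Walk (graph T) (⊤ - f) (ν (src en e)) (ν (tgt en e)))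
      apart? f e = ¬? (walk? (graph T) (⊤ - f) (ν (src en e)) (ν (tgt en e)))

      walk⇒sameSide : ∀ {f x y} → Walk (graph T) (⊤ - f) x y → side T f x ≡ side T f y
      walk⇒sameSide w = side-walk T w λ i → proj₂ (∈-minus⁻ (edges⊆ w i)) refl

      adhEdge≡cut : ∀ f → adhEdge f ≡ cut en (lower T ν f)
      adhEdge≡cut f = ⊆-antisym to from
        where
        to : adhEdge f ⊆ cut en (lower T ν f)
        to {e} e∈ with side T f (ν (src en e)) in p | side T f (ν (tgt en e)) in q
        ... | true  | true  = ⊥-elim (∈-fromPred⁻ (apart? f) e∈ (sameSide⇒walk T f (trans p (sym q))))
        ... | false | false = ⊥-elim (∈-fromPred⁻ (apart? f) e∈ (sameSide⇒walk T f (trans p (sym q))))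
        ... | true  | false = ∈-cut⁺ en (inj₁ (∈-fromPred⁺ (lower? T ν f) p , λ i → case trans (sym q) (∈-fromPred⁻ (lower? T ν f) i) of λ ()))
        ... | false | true  = ∈-cut⁺ en (inj₂ ((λ i → case trans (sym p) (∈-fromPred⁻ (lower? T ν f) i) of λ ()) , ∈-fromPred⁺ (lower? T ν f) q))
        from : cut en (lower T ν f) ⊆ adhEdge f
        from {e} e∈ = ∈-fromPred⁺ (apart? f) λ w → separated (walk⇒sameSide w) (∈-cut⁻ en e∈)
          where
          separated : side T f (ν (src en e)) ≡ side T f (ν (tgt en e)) → ¬ Across en (lower T ν f) e
          separated eq (inj₁ (i , j)) = j (∈-fromPred⁺ (lower? T ν f) (trans (sym eq) (∈-fromPred⁻ (lower? T ν f) i)))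
          separated eq (inj₂ (i , j)) = i (∈-fromPred⁺ (lower? T ν f) (trans eq (∈-fromPred⁻ (lower? T ν f) j)))

      adhNode⊆ : ∀ t → adhNode t ⊆ bold en (star t)
      adhNode⊆ t e∈ with ∈-⋃⁻ _ e∈
      ... | _ , i , e∈f with ∈-map⁻ adhEdge i
      ...   | f , f∈ , refl with ∈-filter⁻ (λ f → incident? (graph T) t f ×-dec bold? f) {xs = allFin _} f∈
      ...     | _ , inc , 3≤ = ∈-bold⁺ en (incident inc) (subst (λ p → 3 ≤ ∣ p ∣) (adhEdge≡cut f) 3≤)
                  (subst (_ ∈_) (adhEdge≡cut f) e∈f)

      bag⊆ : ∀ t → fromPred (bag? t) ⊆ final t
      bag⊆ t {v} v∈ with placed v
      ... | inj₁ i = subst (λ t → v ∈ final t) (∈-fromPred⁻ (bag? t) v∈) i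

    widths : adhesionWidth < a × bagWidth < b
    widths = max-map< (λ t → ∣ adhNode t ∣) 0<a (λ t → ℕₚ.≤-<-trans (p⊆q⇒∣p∣≤∣q∣ (adhNode⊆ t)) (bold< t))
           , max-map< (λ t → ∣ fromPred (bag? t) ∣) 0<b (λ t → ℕₚ.≤-<-trans (p⊆q⇒∣p∣≤∣q∣ (bag⊆ t)) (final< t))

  compile : RTree NoLeaf ⊤ → HasDecomposition< G a b
  compile t = decomposition (complete t) , widths (complete t)

-- From brambles to tangles

∈-boldUnion⁺ : ∀ G σ {s e} → s ∈ˡ σ → 3 ≤ ∣ δ G (proj₁ s) ∣ → e ∈ δ G (proj₁ s) → e ∈ boldUnion G σ
∈-boldUnion⁺ G σ i 3≤ e∈ = ∈-⋃⁺ (∈-map⁺ (λ s → δ G (proj₁ s)) (∈-filter⁺ (λ s → 3 ≤? ∣ δ G (proj₁ s) ∣) i 3≤)) e∈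

∈-boldUnion⁻ : ∀ G σ {e} → e ∈ boldUnion G σ → ∃[ s ] (s ∈ˡ σ × 3 ≤ ∣ δ G (proj₁ s) ∣ × e ∈ δ G (proj₁ s))
∈-boldUnion⁻ G σ e∈ with ∈-⋃⁻ _ e∈
... | _ , i , e∈s with ∈-map⁻ (λ s → δ G (proj₁ s)) i
...   | s , s∈ , eq with ∈-filter⁻ (λ s → 3 ≤? ∣ δ G (proj₁ s) ∣) {xs = σ} s∈
...     | j , 3≤ = s , j , 3≤ , subst (_ ∈_) eq e∈s

∈-⋂⁺ : ∀ {n} (ps : List (Subset n)) {x} → (∀ {p} → p ∈ˡ ps → x ∈ p) → x ∈ ⋂ ps
∈-⋂⁺ []       _ = ∈⊤
∈-⋂⁺ (p ∷ ps) f = x∈p∩q⁺ (f (here refl) , ∈-⋂⁺ ps (f ∘ there))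

escapes : ∀ {n} {p q : Subset n} → ∣ q ∣ < ∣ p ∣ → ∃[ x ] (x ∈ p × x ∉ q)
escapes {p = p} {q} q<p with nonempty? (p ─ q)
... | yes (x , x∈) = x , ∈-─⁻ x∈
... | no none = ⊥-elim (ℕₚ.<⇒≱ q<p (p⊆q⇒∣p∣≤∣q∣ λ {x} x∈ → case x ∈? q of λ
    { (yes i) → i ; (no i) → ⊥-elim (none (x , ∈-─⁺ x∈ i)) }))

module Brambles {G : Graph} {a b : ℕ} (hasBramble : HasBramble≥ G a b) where

  B : Bramble G
  B = proj₁ hasBramble

  open Bramble B public

  core≥ : ∀ {s} → s ∈ˡ slabs → b ≤ ∣ Slab.core s ∣
  core≥ i = let _ , _ , _ , _ , bagOrder , _ , b≤ = hasBramble in ≥minimum bagOrder b≤ (_ , i , refl)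

  survivor : ∀ F → ∣ F ∣ < a → ∃[ s ] (s ∈ˡ slabs × ¬ Disconnects F s)
  survivor F F<a with All.all? (disconnects? F) slabs
  ... | no ¬d = find (¬All⇒Any¬ (disconnects? F) slabs ¬d)
  ... | yes d = let _ , _ , _ , adhesionOrder , _ , a≤ , _ = hasBramble in
    ⊥-elim (ℕₚ.<⇒≱ F<a (≥minimum adhesionOrder a≤ (F , d , refl)))

  -- A cut of at most two edges cannot split a 3-edge-connected core; a cut contained in F cannot
  -- split one that stays connected in H after the removal of F.
  core-one-side : ∀ {F} s {X u v} → ¬ Disconnects F s → ∣ cut (ends G) X ∣ ≤ 2 ⊎ cut (ends G) X ⊆ F →
    u ∈ Slab.core s → v ∈ Slab.core s → u ∈ X → v ∈ X
  core-one-side {F} s {X} {u} {v} ¬d small u∈ v∈ u∈X with v ∈? X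
  ... | yes v∈X = v∈X
  ... | no v∉X = ⊥-elim (crossed small)
    where
    open Slab s
    crossed : ¬ (∣ cut (ends G) X ∣ ≤ 2 ⊎ cut (ends G) X ⊆ F)
    crossed (inj₁ thin) = ℕₚ.<⇒≱ (3ec⇒3≤∣cut∣ (core-3ec u∈ v∈) u∈X v∉X) thin
    crossed (inj₂ ⊆F) with walk? G (EH ─ (F ∩ EH)) u v
    ... | no ¬w = ¬d (u , v , u∈ , v∈ , ¬w)
    ... | yes w with walk-crosses w u∈X v∉X
    ...   | e , _ , e∈ , e∈cut = let e∈EH , e∉ = ∈-─⁻ e∈ in e∉ (x∈p∩q⁺ (⊆F e∈cut , e∈EH))

  touch : ∀ {s t X Y} → s ∈ˡ slabs → t ∈ˡ slabs → Slab.core s ⊆ X → Slab.core t ⊆ Y → Nonempty (X ∩ Y)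
  touch i j ⊆X ⊆Y with touching i j
  ... | x , x∈ = let p , q = x∈p∩q⁻ _ _ x∈ in x , x∈p∩q⁺ (⊆X p , ⊆Y q)

  𝓛 : Sides G → Set
  𝓛 s = S⃗ G a s × (∃[ t ] (t ∈ˡ slabs × Slab.core t ⊆ proj₂ s))

  flip-separation : ∀ {s} → S⃗ G a s → S⃗ G a (swap s)
  flip-separation {A , B} (sep , ord) = record
    { disjoint = λ (x , x∈) → IsSeparation.disjoint sep (x , x∈p∩q⁺ (swap (x∈p∩q⁻ B A x∈)))
    ; covers = λ v → Sum.swap (IsSeparation.covers sep v)
    } , subst (λ c → ∣ c ∣ < a) (trans (δ≡cut G A) (trans (trans (sym (cut-∁ (ends G) A)) (cong (cut (ends G)) ∁A≡B)) (sym (δ≡cut G B)))) ord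
    where
    ∁A≡B : ∁ A ≡ B
    ∁A≡B = ⊆-antisym
      (λ i → [ (λ j → ⊥-elim (x∈∁p⇒x∉p i j)) , id ]′ (IsSeparation.covers sep _))
      (λ i → x∉p⇒x∈∁p λ j → IsSeparation.disjoint sep (_ , x∈p∩q⁺ (j , i)))

  not-both : ∀ {s} → 𝓛 s → ¬ 𝓛 (swap s)
  not-both {A , B} ((sep , _) , t , i , ⊆B) (_ , t′ , j , ⊆A) =
    IsSeparation.disjoint sep (touch j i ⊆A ⊆B)

  toward : ∀ {s} → S⃗ G a s → 𝓛 s ⊎ 𝓛 (swap s)
  toward {A , B} sep@(isSep , ord) with survivor (δ G A) ord
  ... | t , t∈ , ¬d with Slab.core-nonempty t
  ...   | u , u∈ with u ∈? A
  ...     | yes u∈A = inj₂ (flip-separation sep , t , t∈ , λ v∈ → core-one-side t ¬d (inj₂ (λ e∈ → subst (_ ∈_) (sym (δ≡cut G A)) e∈)) u∈ v∈ u∈A)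
  ...     | no u∉A = inj₁ (sep , t , t∈ , λ {v} v∈ → case IsSeparation.covers isSep v of λ
              { (inj₂ v∈B) → v∈B
              ; (inj₁ v∈A) → ⊥-elim (u∉A (core-one-side t ¬d (inj₂ (λ e∈ → subst (_ ∈_) (sym (δ≡cut G A)) e∈)) v∈ u∈ v∈A)) })

  isTangle : IsTangle G a b 𝓛
  isTangle = record
    { isOrientation = record
      { within = proj₁
      ; exactly = exactly
      }
    ; consistent = λ (_ , t , i , ⊆B) (_ , t′ , j , ⊆D) e → e (touch i j ⊆B ⊆D)
    ; avoids = avoids
    }
    where
    exactly : ∀ {s} → S⃗ G a s → ∃! _≡_ λ r → (r ≡ s ⊎ r ≡ swap s) × 𝓛 r
    exactly {s} sep with toward sep
    ... | inj₁ l = s , (inj₁ refl , l) , λ { (inj₁ refl , _) → refl ; (inj₂ refl , l′) → ⊥-elim (not-both l l′) }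
    ... | inj₂ l = swap s , (inj₂ refl , l) , λ { (inj₁ refl , l′) → ⊥-elim (not-both l′ l) ; (inj₂ refl , _) → refl }
    avoids : ∀ {σ} → ForbiddenStar G a b σ → ¬ All 𝓛 σ
    avoids {σ} forb all with survivor (boldUnion G σ) (ForbiddenStar.smallUnion forb)
    -- The core of the surviving slab is larger than the meet, so one of its vertices lies in some A
    -- of the star. Then the whole core lies in that A, against the orientation.
    ... | t , t∈ , ¬d with escapes (ℕₚ.<-≤-trans (ForbiddenStar.smallMeet forb) (core≥ t∈))
    ...   | k , k∈ , k∉⋂ with any-missing (All.all? (λ s → k ∈? proj₂ s) σ)
      where
      any-missing : Dec (All (λ s → k ∈ proj₂ s) σ) → ∃[ s ] (s ∈ˡ σ × k ∉ proj₂ s)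
      any-missing (no ¬all) = find (¬All⇒Any¬ (λ s → k ∈? proj₂ s) σ ¬all)
      any-missing (yes all) = ⊥-elim (k∉⋂ (∈-⋂⁺ (List.map proj₂ σ) λ i →
        let s , s∈ , eq = ∈-map⁻ proj₂ i in subst (k ∈_) (sym eq) (All.lookup all s∈)))
    ...     | (A , B) , s∈ , k∉B = not-both (All.lookup all s∈)
              (flip-separation sep , t , t∈ , λ v∈ → core-one-side t ¬d small k∈ v∈ k∈A)
      where
      sep = All.lookup (ForbiddenStar.within forb) s∈
      k∈A : k ∈ A
      k∈A = [ id , (λ k∈B → ⊥-elim (k∉B k∈B)) ]′ (IsSeparation.covers (proj₁ sep) k)
      small : ∣ cut (ends G) A ∣ ≤ 2 ⊎ cut (ends G) A ⊆ boldUnion G σ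
      small with 3 ≤? ∣ δ G A ∣
      ... | yes 3≤ = inj₂ λ e∈ → ∈-boldUnion⁺ G σ s∈ 3≤ (subst (_ ∈_) (sym (δ≡cut G A)) e∈)
      ... | no ≰   = inj₁ (subst (λ c → ∣ c ∣ ≤ 2) (δ≡cut G A) (ℕₚ.≤-pred (ℕₚ.≰⇒> ≰)))

-- Brambles and tangles exclude decompositions

∈-⊤-minus : ∀ {n} {x : Fin n} y → x ≢ y → x ∈ ⊤ - y
∈-⊤-minus y x≢y = x∈p∧x≢y⇒x∈p-y ∈⊤ x≢y

avoiding : ∀ {G S u v} f (w : Walk G S u v) → f ∉ˡ edges w → Walk G (⊤ - f) u v
avoiding f ε                _  = ε
avoiding f (step e a j ◅ w) f∉ = step e (∈-⊤-minus f λ { refl → f∉ (here refl) }) j ◅ avoiding f w (f∉ ∘ there)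

prefix : ∀ {G S u v x} (w : Walk G S u v) → x ∈ˡ (u ∷ laterVertices w) → Walk G S u x
prefix w       (here refl) = ε
prefix (s ◅ w) (there i)   = s ◅ prefix w i

incident⇒joins : ∀ T {t f} → Incident T t f → ∃[ s ] Joins T f t s
incident⇒joins T (inj₁ refl) = _ , inj₁ refl
incident⇒joins T (inj₂ refl) = _ , inj₂ refl

joins⇒incident : ∀ T {t f s} → Joins T f t s → Incident T t f
joins⇒incident T = link-end (ends T)

module TreeFacts (T : Graph) (isTree : IsTree T) where

  open IsTree isTree

  bridge : ∀ {f s t} → Joins T f s t → ¬ Walk T (⊤ - f) s t
  bridge {f} {s} {t} j w with toPath w
  ... | p , isPath = acyclic (step f ∈⊤ (Sum.swap j) ◅ p⊤) ((λ ()) , (unique ∷ p-edges) , p-vertices)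
    where
    p⊤ : Walk T ⊤ s t
    p⊤ = mapWalk (λ _ → ∈⊤) p
    p-edges : Unique (edges p⊤)
    p-edges = subst Unique (sym (edges-mapWalk _ p)) (isPath⇒uniqueEdges p isPath)
    p-vertices : Unique (s ∷ laterVertices p⊤)
    p-vertices = subst (λ l → Unique (s ∷ l)) (sym (laterVertices-mapWalk _ p)) isPath
    unique : All (f ≢_) (edges p⊤)
    unique = subst (All (f ≢_)) (sym (edges-mapWalk _ p)) (All.tabulate λ e∈ eq → proj₂ (∈-minus⁻ (edges⊆ p e∈)) (sym eq))

  two-sides : ∀ {f s t} → Joins T f s t → ∀ x → Walk T (⊤ - f) s x ⊎ Walk T (⊤ - f) t x
  two-sides {f} {s} {t} j x = go (inj₁ ε) (connected s x)
    where
    go : ∀ {y} → Walk T (⊤ - f) s y ⊎ Walk T (⊤ - f) t y → Walk T ⊤ y x → Walk T (⊤ - f) s x ⊎ Walk T (⊤ - f) t x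
    go r ε = r
    go r (_◅_ {j = z} (step e _ k) w) with e Finₚ.≟ f
    ... | no e≢f = go (Sum.map (_◅◅ one) (_◅◅ one) r) w
      where one = step e (∈-⊤-minus f e≢f) k ◅ ε
    ... | yes refl with joins-functional T (Sum.swap k) j
    ...   | inj₁ refl = go (inj₁ ε) w
    ...   | inj₂ refl = go (inj₂ ε) w

  -- The first edge of the path from t to x is the only edge at t separating them.
  gate : ∀ {t x} → t ≢ x → ∃[ g ] (Incident T t g × ¬ Walk T (⊤ - g) t x ×
    (∀ {f} → Incident T t f → f ≢ g → Walk T (⊤ - f) t x))
  gate {t} {x} t≢x with toPath (connected t x)
  ... | ε , _ = ⊥-elim (t≢x refl)
  ... | step g _ j ◅ w , (t∉ ∷ _) = g , joins⇒incident T j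
    , (λ w′ → bridge j (w′ ◅◅ revWalk (rest (joins⇒incident T j))))
    , λ inc f≢g → step g (∈-⊤-minus _ (≢-sym f≢g)) j ◅ rest inc
    where
    rest : ∀ {f} → Incident T t f → Walk T (⊤ - f) _ x
    rest {f} inc = avoiding f w λ f∈ → All¬⇒¬Any t∉ (∈-edges⇒∈-vertices w f∈ (proj₂ (incident⇒joins T inc)))

  private
    hidden? : ∀ t f x → Dec (¬ Walk T (⊤ - f) t x)
    hidden? t f x = ¬? (walk? T (⊤ - f) t x)

    beyond : Vertex T → Edge T → Subset (#V T)
    beyond t f = fromPred (hidden? t f)

    beyond-shrinks : ∀ {t s f g} → Joins T f t s → Incident T s g → g ≢ f → beyond s g ⊂ beyond t f
    beyond-shrinks {t} {s} {f} {g} j inc g≢f = sub , s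
      , ∈-fromPred⁺ (hidden? t f) (bridge j) , λ i → ∈-fromPred⁻ (hidden? s g) i ε
      where
      sub : beyond s g ⊆ beyond t f
      sub {x} x∈ = ∈-fromPred⁺ (hidden? t f) λ w → case Any.any? (g Finₚ.≟_) (edges w) of λ
        { (yes g∈) → bridge j (prefix w (∈-edges⇒∈-vertices w g∈ (proj₂ (incident⇒joins T inc))))
        ; (no g∉)  → ∈-fromPred⁻ (hidden? s g) x∈ (step f (∈-⊤-minus g (≢-sym g≢f)) (Sum.swap j) ◅ avoiding g w g∉) }

  -- Chosen edges are followed through the tree. The set of nodes beyond the current edge shrinks
  -- strictly until an edge is chosen from both of its ends.
  sink : ∀ {P : Vertex T → Edge T → Set} → (∀ t → ∃[ f ] (Incident T t f × P t f)) →
    Σ (Edge T) λ f → ∃₂ λ s t → Joins T f s t × P s f × P t f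
  sink {P} choose = go root (choose root) (<-wellFounded _)
    where
    root : Vertex T
    root = fromℕ< nonEmpty
    Chosen : Vertex T → Set
    Chosen t = ∃[ f ] (Incident T t f × P t f)
    go : ∀ t (c : Chosen t) → Acc _<_ (∣ beyond t (proj₁ c) ∣) → Σ (Edge T) λ f → ∃₂ λ s t → Joins T f s t × P s f × P t f
    go t (f , inc , p) (acc rs) with incident⇒joins T inc
    ... | s , j with choose s
    ...   | g , inc′ , q with g Finₚ.≟ f
    ...     | yes refl = f , t , s , j , p , q
    ...     | no g≢f   = go s (g , inc′ , q) (rs (p⊂q⇒∣p∣<∣q∣ (beyond-shrinks j inc′ g≢f)))

module Decompositions {G : Graph} (𝒯 : TreeCutDecomposition G) where

  open TreeCutDecomposition 𝒯
  open TreeFacts T isTree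

  hiddenFrom? : ∀ t f v → Dec (¬ Walk T (⊤ - f) t (nodeOf v))
  hiddenFrom? t f v = ¬? (walk? T (⊤ - f) t (nodeOf v))

  far : Vertex T → Edge T → Subset (#V G)
  far t f = fromPred (hiddenFrom? t f)

  far⁺ : ∀ {t f v} → ¬ Walk T (⊤ - f) t (nodeOf v) → v ∈ far t f
  far⁺ {t} {f} = ∈-fromPred⁺ (hiddenFrom? t f)

  far⁻ : ∀ {t f v} → v ∈ far t f → ¬ Walk T (⊤ - f) t (nodeOf v)
  far⁻ {t} {f} = ∈-fromPred⁻ (hiddenFrom? t f)

  near⁻ : ∀ {t f v} → v ∉ far t f → Walk T (⊤ - f) t (nodeOf v)
  near⁻ {t} {f} {v} v∉ with walk? T (⊤ - f) t (nodeOf v)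
  ... | yes w = w
  ... | no ¬w = ⊥-elim (v∉ (far⁺ ¬w))

  far-apart : ∀ {f s t} → Joins T f s t → Apart (far s f) (far t f)
  far-apart j v∈ v∈′ = [ far⁻ v∈ , far⁻ v∈′ ]′ (two-sides j _)

  private
    adh? : ∀ f e → Dec (¬ Walk T (⊤ - f) (nodeOf (proj₁ (ends G e))) (nodeOf (proj₂ (ends G e))))
    adh? f e = ¬? (walk? T (⊤ - f) (nodeOf (proj₁ (ends G e))) (nodeOf (proj₂ (ends G e))))

  cut-far : ∀ {t f} → Incident T t f → cut (ends G) (far t f) ≡ adhEdge f
  cut-far {t} {f} inc = ⊆-antisym
    (λ e∈ → ∈-fromPred⁺ (adh? f) λ w → case ∈-cut⁻ (ends G) e∈ of λ
      { (inj₁ (u∈ , v∉)) → far⁻ u∈ (near⁻ v∉ ◅◅ revWalk w)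
      ; (inj₂ (u∉ , v∈)) → far⁻ v∈ (near⁻ u∉ ◅◅ w) })
    (λ {e} e∈ → ∈-cut⁺ (ends G) (across (∈-fromPred⁻ (adh? f) e∈)))
    where
    j = proj₂ (incident⇒joins T inc)
    across : ∀ {e} → ¬ Walk T (⊤ - f) (nodeOf (proj₁ (ends G e))) (nodeOf (proj₂ (ends G e))) → Across (ends G) (far t f) e
    across {e} ¬w with proj₁ (ends G e) ∈? far t f | proj₂ (ends G e) ∈? far t f
    ... | yes u∈ | no v∉  = inj₁ (u∈ , v∉)
    ... | no u∉  | yes v∈ = inj₂ (u∉ , v∈)
    ... | no u∉  | no v∉  = ⊥-elim (¬w (revWalk (near⁻ u∉) ◅◅ near⁻ v∉))
    ... | yes u∈ | yes v∈ with two-sides j (nodeOf (proj₁ (ends G e))) | two-sides j (nodeOf (proj₂ (ends G e)))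
    ...   | inj₁ w | _      = ⊥-elim (far⁻ u∈ w)
    ...   | _      | inj₁ w = ⊥-elim (far⁻ v∈ w)
    ...   | inj₂ w | inj₂ x = ⊥-elim (¬w (revWalk w ◅◅ x))

  private
    boldAt? : ∀ t f → Dec (Incident T t f × Bold f)
    boldAt? t f = incident? T t f ×-dec bold? f

  adhEdge⊆adhNode : ∀ {t f} → Incident T t f → Bold f → adhEdge f ⊆ adhNode t
  adhEdge⊆adhNode {t} {f} inc 3≤ = ∈-⋃⁺ (∈-map⁺ adhEdge (∈-filter⁺ (boldAt? t) (∈-allFin f) (inc , 3≤)))

  adhNode<⇒ : ∀ {k} → adhesionWidth < k → ∀ t → ∣ adhNode t ∣ < k
  adhNode<⇒ lt t = ℕₚ.≤-<-trans (≤max-map (λ t → ∣ adhNode t ∣) t) lt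

  bag<⇒ : ∀ {k} → bagWidth < k → ∀ t → ∣ bag t ∣ < k
  bag<⇒ lt t = ℕₚ.≤-<-trans (≤max-map (λ t → ∣ bag t ∣) t) lt

  ∈-bag : ∀ {v t} → t ≡ nodeOf v → v ∈ bag t
  ∈-bag {v} refl = proj₂ (IsNearPartition.covers isNearPartition v)

  thin-or-⊆ : ∀ {t f} → Incident T t f → ∣ cut (ends G) (far t f) ∣ ≤ 2 ⊎ cut (ends G) (far t f) ⊆ adhNode t
  thin-or-⊆ {t} {f} inc with bold? f
  ... | yes 3≤ = inj₂ λ e∈ → adhEdge⊆adhNode inc 3≤ (subst (_ ∈_) (cut-far inc) e∈)
  ... | no ≰   = inj₁ (subst (λ c → ∣ c ∣ ≤ 2) (sym (cut-far inc)) (ℕₚ.≤-pred (ℕₚ.≰⇒> ≰)))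

  bramble-blocks : ∀ {a b} → HasBramble≥ G a b → ¬ (adhesionWidth < a × bagWidth < b)
  bramble-blocks {a} {b} hb (adh< , bag<) =
    let f , s , t , j , (p , p∈ , p⊆) , (q , q∈ , q⊆) = sink {Points} choose
        x , x∈ = touch p∈ q∈ p⊆ q⊆
        u , v = x∈p∩q⁻ (far s f) (far t f) x∈
    in far-apart j u v
    where
    open Brambles hb
    Points : Vertex T → Edge T → Set
    Points t f = ∃[ s ] (s ∈ˡ slabs × Slab.core s ⊆ far t f)
    choose : ∀ t → ∃[ f ] (Incident T t f × Points t f)
    choose t =
      let s , s∈ , ¬d = survivor (adhNode t) (adhNode<⇒ adh< t)
          k , k∈ , k∉ = escapes (ℕₚ.<-≤-trans (bag<⇒ bag< t) (core≥ s∈))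
          g , inc , ¬w , _ = gate {t} {nodeOf k} (λ eq → k∉ (∈-bag eq))
      in g , inc , s , s∈ , λ v∈ → core-one-side s ¬d (thin-or-⊆ inc) k∈ v∈ (far⁺ ¬w)

  module _ {a b a′ b′ : ℕ} (3≤a : 3 ≤ a) (a≤a′ : a ≤ a′) (b≤b′ : b ≤ b′)
    {L : Sides G → Set} (tangle : IsTangle G a′ b′ L) (adh< : adhesionWidth < a) (bag< : bagWidth < b) where

    open IsTangle tangle
    open IsOrientation isOrientation

    private
      inward outward : Vertex T → Edge T → Sides G
      inward  t f = far t f , ∁ (far t f)
      outward t f = ∁ (far t f) , far t f

      opposite : ∀ (X : Subset (#V G)) → IsSeparation G (X , ∁ X)
      opposite X = record
        { disjoint = λ (x , x∈) → let p , q = x∈p∩q⁻ X (∁ X) x∈ in x∈∁p⇒x∉p q p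
        ; covers = λ v → case v ∈? X of λ { (yes i) → inj₁ i ; (no i) → inj₂ (x∉p⇒x∈∁p i) }
        }

      -- The adhesion-width does not bound the cut of a thin tree edge; by `3 ≤ a` its at most two
      -- edges still give a separation that the tangle orients.
      far-order : ∀ {t f} → Incident T t f → ∣ cut (ends G) (far t f) ∣ < a′
      far-order {t} {f} inc = ℕₚ.<-≤-trans (small (thin-or-⊆ inc)) a≤a′
        where
        small : ∣ cut (ends G) (far t f) ∣ ≤ 2 ⊎ cut (ends G) (far t f) ⊆ adhNode t → ∣ cut (ends G) (far t f) ∣ < a
        small (inj₁ thin) = ℕₚ.≤-trans (s≤s thin) 3≤a
        small (inj₂ sub)  = ℕₚ.≤-<-trans (p⊆q⇒∣p∣≤∣q∣ sub) (adhNode<⇒ adh< t)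

      oriented : ∀ {t f} → Incident T t f → L (inward t f) ⊎ L (outward t f)
      oriented {t} {f} inc with exactly (opposite (far t f)
        , subst (λ c → ∣ c ∣ < a′) (sym (δ≡cut G (far t f))) (far-order inc))
      ... | _ , (inj₁ refl , l) , _ = inj₁ l
      ... | _ , (inj₂ refl , l) , _ = inj₂ l

      -- Its presence keeps the star at t nonempty when the tree has a single node.
      Ø : Sides G
      Ø = ⊥ , ⊤

      L-Ø : L Ø
      L-Ø with exactly {Ø} (record
          { disjoint = λ (x , x∈) → ∉⊥ (proj₁ (x∈p∩q⁻ ⊥ ⊤ x∈)) ; covers = λ _ → inj₂ ∈⊤ }
        , subst (_< a′) (sym (trans (cong ∣_∣ (δ≡cut G ⊥)) (cut-⊥ (ends G)))) (ℕₚ.≤-trans (ℕₚ.≤-trans (s≤s z≤n) 3≤a) a≤a′))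
      ... | _ , (inj₁ refl , l) , _ = l
      ... | _ , (inj₂ refl , l) , _ = ⊥-elim (consistent l l λ (x , x∈) → ∉⊥ (proj₁ (x∈p∩q⁻ ⊥ ⊥ x∈)))

      incidentEdges : Vertex T → List (Edge T)
      incidentEdges t = filter (incident? T t) (allFin (#E T))

      ∈-incidentEdges⁻ : ∀ {t f} → f ∈ˡ incidentEdges t → Incident T t f
      ∈-incidentEdges⁻ {t} f∈ = proj₂ (∈-filter⁻ (incident? T t) {xs = allFin (#E T)} f∈)

      starAt : Vertex T → List (Sides G)
      starAt t = Ø ∷ List.map (inward t) (incidentEdges t)

      inStar : ∀ {t f} → Incident T t f → inward t f ∈ˡ starAt t
      inStar {t} inc = there (∈-map⁺ (inward t) (∈-filter⁺ (incident? T t) (∈-allFin _) inc))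

      data InStar (t : Vertex T) : Sides G → Set where
        isØ      : InStar t Ø
        isInward : ∀ {f} → Incident T t f → InStar t (inward t f)

      inStar⁻ : ∀ {t s} → s ∈ˡ starAt t → InStar t s
      inStar⁻ (here refl) = isØ
      inStar⁻ {t} (there i) = let f , f∈ , eq = ∈-map⁻ (inward t) i in
        subst (InStar t) (sym eq) (isInward (∈-incidentEdges⁻ f∈))

      -- By `gate`, only the first edge of the path from t to the node of v separates the two. So
      -- the small sides of the star at t are disjoint.
      far⇒gate : ∀ {t v f g} → Incident T t f → Incident T t g → v ∈ far t f → v ∈ far t g → f ≡ g
      far⇒gate {t} {v} {f} {g} incf incg vf vg with gate {t} {nodeOf v} (λ eq → far⁻ vf (subst (Walk T (⊤ - f) t) eq ε))
      ... | h , _ , _ , others with f Finₚ.≟ h | g Finₚ.≟ h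
      ...   | yes f≡h | yes g≡h = trans f≡h (sym g≡h)
      ...   | no f≢h  | _       = ⊥-elim (far⁻ vf (others incf f≢h))
      ...   | yes _   | no g≢h  = ⊥-elim (far⁻ vg (others incg g≢h))

      forbidden : ∀ {t} → All L (starAt t) → ForbiddenStar G a′ b′ (starAt t)
      forbidden {t} all = record
        { within = All.map within all
        ; isStar = record
          { nonEmpty = λ ()
          ; consistent = λ i j → consistent (All.lookup all i) (All.lookup all j)
          ; disjoint = λ i j → apart (inStar⁻ i) (inStar⁻ j)
          }
        ; smallUnion = ℕₚ.<-≤-trans (ℕₚ.≤-<-trans (p⊆q⇒∣p∣≤∣q∣ union⊆) (adhNode<⇒ adh< t)) a≤a′
        ; smallMeet = ℕₚ.<-≤-trans (ℕₚ.≤-<-trans (p⊆q⇒∣p∣≤∣q∣ meet⊆) (bag<⇒ bag< t)) b≤b′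
        }
        where
        apart : ∀ {s s′} → InStar t s → InStar t s′ → s ≢ s′ → Empty (proj₁ s ∩ proj₁ s′)
        apart isØ _ _ (x , x∈) = ∉⊥ (proj₁ (x∈p∩q⁻ ⊥ _ x∈))
        apart (isInward _) isØ _ (x , x∈) = ∉⊥ (proj₂ (x∈p∩q⁻ _ ⊥ x∈))
        apart (isInward {f} i) (isInward {g} j) ne (x , x∈) =
          let p , q = x∈p∩q⁻ (far t f) (far t g) x∈ in ne (cong (inward t) (far⇒gate i j p q))
        union⊆ : boldUnion G (starAt t) ⊆ adhNode t
        union⊆ e∈ with ∈-boldUnion⁻ G (starAt t) e∈
        ... | s , s∈ , 3≤ , e∈s = part (inStar⁻ s∈) 3≤ e∈s
          where
          part : ∀ {s e} → InStar t s → 3 ≤ ∣ δ G (proj₁ s) ∣ → e ∈ δ G (proj₁ s) → e ∈ adhNode t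
          part isØ 3≤ _ = ⊥-elim (ℕₚ.<⇒≱ 3≤ (ℕₚ.≤-trans (ℕₚ.≤-reflexive (trans (cong ∣_∣ (δ≡cut G ⊥)) (cut-⊥ (ends G)))) z≤n))
          part (isInward {f} inc) 3≤ e∈ rewrite δ≡cut G (far t f) =
            adhEdge⊆adhNode inc (subst (λ c → 3 ≤ ∣ c ∣) (cut-far inc) 3≤) (subst (_ ∈_) (cut-far inc) e∈)
        meet⊆ : ⋂ (List.map proj₂ (starAt t)) ⊆ bag t
        meet⊆ {v} v∈ with t Finₚ.≟ nodeOf v
        ... | yes eq = ∈-bag eq
        ... | no t≢ with gate t≢
        ...   | g , inc , ¬w , _ = ⊥-elim (x∈∁p⇒x∉p (∈-⋂⁻ (∈-map⁺ proj₂ (inStar inc)) v∈) (far⁺ ¬w))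

      choose : ∀ t → ∃[ f ] (Incident T t f × L (outward t f))
      choose t with allOr (All.tabulate {xs = incidentEdges t} λ {f} f∈ →
        Sum.map₂ (λ l → f , ∈-incidentEdges⁻ f∈ , l) (oriented (∈-incidentEdges⁻ f∈)))
      ... | inj₂ found = found
      ... | inj₁ ls    = ⊥-elim (avoids (forbidden all) all)
        where
        all : All L (starAt t)
        all = L-Ø ∷ map⁺ ls

    tangle-blocks : Absurd
    tangle-blocks = let f , s , t , j , l , l′ = sink {λ t f → L (outward t f)} choose in
      consistent l l′ λ (x , x∈) → let p , q = x∈p∩q⁻ _ _ x∈ in far-apart j p q

-- Combining the implications

allFinOr : ∀ {n} {P : Fin n → Set} {Q : Set} → (∀ i → P i ⊎ Q) → (∀ i → P i) ⊎ Q
allFinOr f = Sum.map₁ (λ ps i → All.lookup ps (∈-allFin i)) (allOr (All.tabulate {xs = allFin _} λ {i} _ → f i))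

-- A bramble in the torso of one class is enough, while a decomposition needs a tree for each. The
-- dichotomy is effective for every r, so running through the vertices settles it.
bramble-or-decomposition : ∀ G {a b} → 3 ≤ a → 0 < b → HasBramble≥ G a b ⊎ HasDecomposition< G a b
bramble-or-decomposition G {a} {b} 3≤a 0<b =
  [ inj₂ ∘ decompose , inj₁ ]′ (allFinOr λ r → Sum.swap (Torso.Dichotomy.dichotomy G r a b 3≤a 0<b))
  where
  decompose : (∀ r → Trees.RTree (Torso.torso G r) (Class.R G r) (Torso.torso∈R G r) a b NoLeaf (Class.R G r)) →
    HasDecomposition< G a b
  decompose trees = Compile.compile G a b (ℕₚ.≤-trans (s≤s z≤n) 3≤a) 0<b (Assembly.wholeTree G a b 3≤a 0<b trees)

bramble-weaken : ∀ {G a a′ b} → a ≤ a′ → HasBramble≥ G a′ b → HasBramble≥ G a b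
bramble-weaken a≤a′ (B , o , o′ , m , m′ , a′≤o , b≤o′) =
  B , o , o′ , m , m′ , ≤⁺-trans ℕₚ.≤-trans [ a≤a′ ] a′≤o , b≤o′

-- Without bold edges the adhesion-width is 0.
thin-decomposition : ∀ {G a b} → 0 < a → HasDecomposition< G 3 b → HasDecomposition< G a b
thin-decomposition {G} {a} 0<a (𝒯 , adh< , bag<) = 𝒯
  , max-map< (λ t → ∣ adhNode t ∣) 0<a (λ t → subst (_< a) (sym (none t)) 0<a) , bag<
  where
  open TreeCutDecomposition 𝒯
  open Decompositions 𝒯
  no-bold : ∀ {t f} → Incident T t f → ¬ Bold f
  no-bold {t} inc 3≤ = ℕₚ.<⇒≱ (adhNode<⇒ adh< t) (ℕₚ.≤-trans 3≤ (p⊆q⇒∣p∣≤∣q∣ (adhEdge⊆adhNode inc 3≤)))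
  none : ∀ t → ∣ adhNode t ∣ ≡ 0
  none t = trans (cong ∣_∣ (Empty-unique {p = adhNode t} λ (e , e∈) →
    let _ , i , _ = ∈-⋃⁻ (List.map adhEdge (filter (λ f → incident? T t f ×-dec bold? f) (allFin (#E T)))) e∈
        f , f∈ , _ = ∈-map⁻ adhEdge i
        _ , inc , 3≤ = ∈-filter⁻ (λ f → incident? T t f ×-dec bold? f) {xs = allFin (#E T)} f∈
    in no-bold inc 3≤)) (∣⊥∣≡0 (#E G))

no-decomposition⇒bramble : ∀ G {a b} → 0 < a → 0 < b → ¬ HasDecomposition< G a b → HasBramble≥ G a b
no-decomposition⇒bramble G {a} {b} 0<a 0<b none = byCases (3 ≤? a)
  where
  byCases : Dec (3 ≤ a) → HasBramble≥ G a b
  byCases (yes 3≤a) = [ id , ⊥-elim ∘ none ]′ (bramble-or-decomposition G 3≤a 0<b)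
  byCases (no a<3)  = [ bramble-weaken (ℕₚ.<⇒≤ (ℕₚ.≰⇒> a<3)) , ⊥-elim ∘ none ∘ thin-decomposition 0<a ]′
    (bramble-or-decomposition G ℕₚ.≤-refl 0<b)

theorem3p11 : (G : Graph) → 0 < #V G → (a b : ℕ) → 0 < a → 0 < b →
    (HasBramble≥ G a b ⇔ (¬ HasDecomposition< G a b)) ×
    (HasBramble≥ G a b → HasTangle≥ G a b) ×
    (3 ≤ a → HasTangle≥ G a b → HasBramble≥ G a b)
theorem3p11 G _ a b 0<a 0<b =
    mk⇔ (λ hb (𝒯 , w) → Decompositions.bramble-blocks 𝒯 hb w) (no-decomposition⇒bramble G 0<a 0<b)
  , (λ hb → a , b , ℕₚ.≤-refl , ℕₚ.≤-refl , Brambles.𝓛 hb , Brambles.isTangle hb)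
  , λ { 3≤a (a′ , b′ , a≤a′ , b≤b′ , _ , tangle) → no-decomposition⇒bramble G 0<a 0<b λ (𝒯 , adh< , bag<) →
      Decompositions.tangle-blocks 𝒯 3≤a a≤a′ b≤b′ tangle adh< bag< }
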